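{- Fix an integer $g\ge 0$. For $n,k\ge 1$ let $p(n,k)$ be the number of genus $g$ partitions of $\{1,\ldots,n\}$ with $k$ parts, and let $P(x,y)=\sum_{n,k}p(n,k)x^ny^k$. Then $P(x,y)$ is algebraic (over the field of rational functions in $x$ and $y$). More precisely, there is a rational function $F$ in three variables such that $$P(x,y)=F\left(x,\,y,\,\sqrt{(x+xy-1)^2-4x^2y}\right).$$
   Context: Formal power series have real coefficients, and $\sqrt{(x+xy-1)^2-4x^2y}$ denotes the formal power series square root with constant term $1$. For $n\ge1$ let $\zeta_n=(1,2,\ldots,n)$, and let $z(\cdot)$ be the number of cycles of a permutation (fixed points included). Products of permutations are composed right to left, i.e. $(\alpha^{ -1}\zeta_n)(i)=\alpha^{ -1}(\zeta_n(i))$. The genus $g(\alpha)$ of a permutation $\alpha$ of $\{1,\ldots,n\}$ is the nonnegative integer defined by $n+1-2g(\alpha)=z(\alpha)+z(\alpha^{ -1}\zeta_n)$. A permutation is called a partition if each of its cycles, listed beginning with its least element, is an increasing list; thus partitions correspond bijectively to set partitions of $\{1,\ldots,n\}$, the parts being the cycles. -}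

module Defs where

open import Algebra.Bundles.Raw using (RawRing)
import Algebra.Definitions.RawMonoid as RawMonoidDefs
open import Data.Bool.Properties using () renaming (_≟_ to _≟ᵇ_)
open import Data.Fin.Base using (Fin; zero; suc; fromℕ; punchIn) renaming (_≤_ to _≤ᶠ_; _<_ to _<ᶠ_)
open import Data.Fin.Permutation
  using (Permutation′; _⟨$⟩ʳ_; _∘ₚ_; flip; insert; remove; insert-remove)
  renaming (_≈_ to _≈ₚ_; id to idₚ)
open import Data.Fin.Properties
  using (all?; punchIn-injective) renaming (_≟_ to _≟ᶠ_; _≤?_ to _≤ᶠ?_; _<?_ to _<ᶠ?_)
open import Data.Fin.Subset using (Subset; ∣_∣)
open import Data.List.Base
  using (List; []; _∷_; [_]; map; concatMap; foldr; filter; length; deduplicate; iterate; allFin)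
open import Data.List.Membership.DecPropositional using (_∈?_)
open import Data.List.Membership.Propositional.Properties using (∈-allFin)
open import Data.List.Relation.Unary.All as All using (All)
import Data.List.Relation.Unary.All.Properties as All
open import Data.List.Relation.Unary.AllPairs as AllPairs using (AllPairs; []; _∷_)
import Data.List.Relation.Unary.AllPairs.Properties as AllPairs
open import Data.List.Relation.Unary.Any as Any using (Any; here)
import Data.List.Relation.Unary.Any.Properties as Any
open import Data.List.Relation.Unary.Linked using (Linked; linked?)
open import Data.List.Relation.Unary.Unique.Propositional.Properties using (allFin⁺)
open import Data.Nat.Base as ℕ using (ℕ; zero; suc; _∸_)
import Data.Nat.Properties as ℕ
open import Data.Product.Base using (∃-syntax; ∃₂; _×_; _,_; proj₁; proj₂)
open import Data.Rational.Base as ℚ using (ℚ; 0ℚ; 1ℚ; _<_) renaming (∣_∣ to ∣_∣ᵣ)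
import Data.Rational.Properties as ℚ
open import Data.Rational.Solver using (module +-*-Solver)
open import Data.Vec.Base as Vec using (Vec)
open import Data.Vec.Properties using () renaming (≡-dec to ≡-decᵛ)
open import Level using (0ℓ)
open import Relation.Binary.Definitions using (DecidableEquality)
open import Relation.Binary.PropositionalEquality using (_≡_; refl; sym; trans; cong; subst)
open import Relation.Nullary using (¬_; does)
open import Relation.Nullary.Decidable using (_→-dec_; _×-dec_)
open import Relation.Unary using (Decidable)

------------------------------------------------------------------------
-- Permutations of {1,…,n}, represented as {0,…,n-1} = Fin n

-- The first n iterates of i under α exhaust its orbit.
orbit : ∀ {n} → Permutation′ n → Fin n → Subset n
orbit {n} α i = Vec.tabulate λ j → does (_∈?_ _≟ᶠ_ j (iterate (α ⟨$⟩ʳ_) i n))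

-- The cycle of α through i, listed beginning with i: (i, α i, α² i, …).
cycle : ∀ {n} → Permutation′ n → Fin n → List (Fin n)
cycle α i = iterate (α ⟨$⟩ʳ_) i ∣ orbit α i ∣

_≟ˢ_ : ∀ {n} → DecidableEquality (Subset n)
_≟ˢ_ = ≡-decᵛ _≟ᵇ_

-- Number of cycles: the number of distinct orbits.
z : ∀ {n} → Permutation′ n → ℕ
z {n} α = length (deduplicate _≟ˢ_ (map (orbit α) (allFin n)))

-- i ↦ i+1 with the last element sent to the first: the last element is
-- inserted with image 0 into an identity whose values are shifted up by one.
ζ : ∀ {n} → Permutation′ n
ζ {zero}  = idₚ
ζ {suc m} = insert (fromℕ m) zero idₚ

-- _∘ₚ_ applies its left argument first, so ζ ∘ₚ flip α is i ↦ α⁻¹ (ζ i).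
HasGenus : ∀ {n} → ℕ → Permutation′ n → Set
HasGenus {n} g α = n ℕ.+ 1 ≡ (z α ℕ.+ z (ζ ∘ₚ flip α)) ℕ.+ 2 ℕ.* g

hasGenus? : ∀ {n} g → Decidable (HasGenus {n} g)
hasGenus? g α = _ ℕ.≟ _

IsPartition : ∀ {n} → Permutation′ n → Set
IsPartition α = ∀ i → All (i ≤ᶠ_) (cycle α i) → Linked _<ᶠ_ (cycle α i)

isPartition? : ∀ {n} → Decidable (IsPartition {n})
isPartition? α = all? λ i →
  All.all? (i ≤ᶠ?_) (cycle α i) →-dec linked? _<ᶠ?_ (cycle α i)

allPermutations : ∀ n → List (Permutation′ n)
allPermutations zero    = [ idₚ ]
allPermutations (suc n) =
  concatMap (λ π → map (λ j → insert zero j π) (allFin (suc n))) (allPermutations n)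

-- Together, the next two lemmas say that every permutation is listed exactly
-- once (up to pointwise equality), so that filtering the list really counts.
allPermutations-complete : ∀ {n} (π : Permutation′ n) → Any (π ≈ₚ_) (allPermutations n)
allPermutations-complete {zero}  π = here λ ()
allPermutations-complete {suc n} π =
  Any.concatMap⁺ _ (Any.map
    (λ {σ} ρ≈σ → Any.map⁺ (Any.map (λ { refl → agrees σ ρ≈σ }) (∈-allFin (π ⟨$⟩ʳ zero))))
    (allPermutations-complete (remove zero π)))
  where
  agrees : ∀ σ → remove zero π ≈ₚ σ → π ≈ₚ insert zero (π ⟨$⟩ʳ zero) σ
  agrees σ ρ≈σ zero    = refl
  agrees σ ρ≈σ (suc i) =
    trans (sym (insert-remove zero π (suc i))) (cong (punchIn (π ⟨$⟩ʳ zero)) (ρ≈σ i))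

allPermutations-distinct : ∀ n → AllPairs (λ π ρ → ¬ π ≈ₚ ρ) (allPermutations n)
allPermutations-distinct zero    = All.[] ∷ []
allPermutations-distinct (suc n) = AllPairs.concat⁺
  (All.map⁺ (All.universal
    (λ π → AllPairs.map⁺ (AllPairs.map (λ j≢k eq → j≢k (eq zero)) (allFin⁺ (suc n)))) _))
  (AllPairs.map⁺ (AllPairs.map
    (λ {π} {ρ} π≉ρ → All.map⁺ (All.universal
      (λ j → All.map⁺ (All.universal (λ k eq → π≉ρ (restrict π ρ j k eq)) _)) _))
    (allPermutations-distinct n)))
  where
  restrict : ∀ π ρ j k → insert zero j π ≈ₚ insert zero k ρ → π ≈ₚ ρ
  restrict π ρ j k eq i with refl ← eq zero = punchIn-injective j _ _ (eq (suc i))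

p : ℕ → ℕ → ℕ → ℕ
p g n k = length (filter
  (λ α → isPartition? α ×-dec hasGenus? g α ×-dec (z α ℕ.≟ k)) (allPermutations n))

------------------------------------------------------------------------
-- Real numbers: Cauchy sequences of rationals

record ℝ : Set where
  field
    seq    : ℕ → ℚ
    cauchy : ∀ ε → 0ℚ < ε →
             ∃[ N ] ∀ m n → N ℕ.≤ m → N ℕ.≤ n → ∣ seq m ℚ.- seq n ∣ᵣ < ε
open ℝ

infix 4 _≃_
_≃_ : ℝ → ℝ → Set
x ≃ y = ∀ ε → 0ℚ < ε → ∃[ N ] ∀ n → N ℕ.≤ n → ∣ seq x n ℚ.- seq y n ∣ᵣ < ε

fromℚ : ℚ → ℝ
fromℚ q = record
  { seq    = λ _ → q
  ; cauchy = λ ε 0<ε → 0 , λ _ _ _ _ →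
      subst (_< ε) (sym (cong ∣_∣ᵣ (ℚ.+-inverseʳ q))) 0<ε
  }

negℝ : ℝ → ℝ
negℝ x = record
  { seq    = λ n → ℚ.- seq x n
  ; cauchy = λ ε 0<ε → let N , h = cauchy x ε 0<ε in N , λ m n N≤m N≤n →
      subst (_< ε) (trans (sym (ℚ.∣-p∣≡∣p∣ _)) (cong ∣_∣ᵣ (shuffle (seq x m) (seq x n))))
        (h m n N≤m N≤n)
  }
  where
  shuffle : ∀ a b → ℚ.- (a ℚ.- b) ≡ (ℚ.- a) ℚ.- (ℚ.- b)
  shuffle = solve 2 (λ a b → :- (a :- b) := (:- a) :- (:- b)) refl
    where open +-*-Solver

addℝ : ℝ → ℝ → ℝ
addℝ x y = record
  { seq    = λ n → seq x n ℚ.+ seq y n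
  ; cauchy = λ ε 0<ε →
      let 0<δ = half-pos ε 0<ε
          M , h = cauchy x (ε ℚ.* ℚ.½) 0<δ
          N , k = cauchy y (ε ℚ.* ℚ.½) 0<δ
      in M ℕ.⊔ N , λ m n M⊔N≤m M⊔N≤n → begin-strict
        ∣ (seq x m ℚ.+ seq y m) ℚ.- (seq x n ℚ.+ seq y n) ∣ᵣ
          ≡⟨ cong ∣_∣ᵣ (shuffle (seq x m) (seq y m) (seq x n) (seq y n)) ⟩
        ∣ (seq x m ℚ.- seq x n) ℚ.+ (seq y m ℚ.- seq y n) ∣ᵣ
          ≤⟨ ℚ.∣p+q∣≤∣p∣+∣q∣ (seq x m ℚ.- seq x n) (seq y m ℚ.- seq y n) ⟩
        ∣ seq x m ℚ.- seq x n ∣ᵣ ℚ.+ ∣ seq y m ℚ.- seq y n ∣ᵣ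
          <⟨ ℚ.+-mono-<
               (h m n (ℕ.m⊔n≤o⇒m≤o M N M⊔N≤m) (ℕ.m⊔n≤o⇒m≤o M N M⊔N≤n))
               (k m n (ℕ.m⊔n≤o⇒n≤o M N M⊔N≤m) (ℕ.m⊔n≤o⇒n≤o M N M⊔N≤n)) ⟩
        ε ℚ.* ℚ.½ ℚ.+ ε ℚ.* ℚ.½  ≡⟨ ℚ.*-distribˡ-+ ε ℚ.½ ℚ.½ ⟨
        ε ℚ.* 1ℚ                  ≡⟨ ℚ.*-identityʳ ε ⟩
        ε ∎
  }
  where
  open ℚ.≤-Reasoning
  half-pos : ∀ ε → 0ℚ < ε → 0ℚ < ε ℚ.* ℚ.½
  half-pos ε 0<ε = subst (_< ε ℚ.* ℚ.½) (ℚ.*-zeroˡ ℚ.½) (ℚ.*-monoˡ-<-pos ℚ.½ 0<ε)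
  shuffle : ∀ a b c d → (a ℚ.+ b) ℚ.- (c ℚ.+ d) ≡ (a ℚ.- c) ℚ.+ (b ℚ.- d)
  shuffle = solve 4 (λ a b c d → (a :+ b) :- (c :+ d) := (a :- c) :+ (b :- d)) refl
    where open +-*-Solver

bounded : ∀ x → ∃[ B ] 0ℚ < B × ∃[ N ] ∀ n → N ℕ.≤ n → ∣ seq x n ∣ᵣ < B
bounded x = B , 0<B , N , bound
  where
  open ℚ.≤-Reasoning
  0<1 : 0ℚ < 1ℚ
  0<1 = ℚ.positive⁻¹ 1ℚ
  N = proj₁ (cauchy x 1ℚ 0<1)
  B = ∣ seq x N ∣ᵣ ℚ.+ 1ℚ
  0<B : 0ℚ < B
  0<B = ℚ.+-mono-≤-< (ℚ.0≤∣p∣ (seq x N)) 0<1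
  shuffle : ∀ a b → a ≡ b ℚ.+ (a ℚ.- b)
  shuffle = solve 2 (λ a b → a := b :+ (a :- b)) refl
    where open +-*-Solver
  bound : ∀ n → N ℕ.≤ n → ∣ seq x n ∣ᵣ < B
  bound n N≤n = begin-strict
    ∣ seq x n ∣ᵣ                                  ≡⟨ cong ∣_∣ᵣ (shuffle (seq x n) (seq x N)) ⟩
    ∣ seq x N ℚ.+ (seq x n ℚ.- seq x N) ∣ᵣ        ≤⟨ ℚ.∣p+q∣≤∣p∣+∣q∣ (seq x N) (seq x n ℚ.- seq x N) ⟩
    ∣ seq x N ∣ᵣ ℚ.+ ∣ seq x n ℚ.- seq x N ∣ᵣ     <⟨ ℚ.+-monoʳ-< ∣ seq x N ∣ᵣ (proj₂ (cauchy x 1ℚ 0<1) n N N≤n ℕ.≤-refl) ⟩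
    B ∎

mulℝ : ℝ → ℝ → ℝ
mulℝ x y = record { seq = λ n → seq x n ℚ.* seq y n ; cauchy = cauchy′ }
  where
  open ℚ.≤-Reasoning
  shuffle : ∀ a b c d → a ℚ.* b ℚ.- c ℚ.* d ≡ a ℚ.* (b ℚ.- d) ℚ.+ d ℚ.* (a ℚ.- c)
  shuffle = solve 4 (λ a b c d → a :* b :- c :* d := a :* (b :- d) :+ d :* (a :- c)) refl
    where open +-*-Solver
  product-bound : ∀ {B δ} a b → 0ℚ < B → ∣ a ∣ᵣ < B → ∣ b ∣ᵣ < δ → ∣ a ℚ.* b ∣ᵣ < B ℚ.* δ
  product-bound {B} {δ} a b 0<B a<B b<δ = begin-strict
    ∣ a ℚ.* b ∣ᵣ         ≡⟨ ℚ.∣p*q∣≡∣p∣*∣q∣ a b ⟩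
    ∣ a ∣ᵣ ℚ.* ∣ b ∣ᵣ    ≤⟨ ℚ.*-monoʳ-≤-nonNeg ∣ b ∣ᵣ {{ℚ.∣-∣-nonNeg b}} (ℚ.<⇒≤ a<B) ⟩
    B ℚ.* ∣ b ∣ᵣ         <⟨ ℚ.*-monoʳ-<-pos B {{ℚ.positive 0<B}} b<δ ⟩
    B ℚ.* δ ∎
  cauchy′ : ∀ ε → 0ℚ < ε → ∃[ N ] ∀ m n → N ℕ.≤ m → N ℕ.≤ n →
            ∣ seq x m ℚ.* seq y m ℚ.- seq x n ℚ.* seq y n ∣ᵣ < ε
  cauchy′ ε 0<ε =
    let B , 0<B , K , bx = bounded x
        C , 0<C , L , by = bounded y
        0<D = ℚ.+-mono-< 0<B 0<C
        instance
          posD = ℚ.positive 0<D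
          nzD  = ℚ.pos⇒nonZero (B ℚ.+ C)
          pos1/D = ℚ.1/pos⇒pos (B ℚ.+ C)
        δ = ε ℚ.* ℚ.1/ (B ℚ.+ C)
        0<δ = subst (_< δ) (ℚ.*-zeroˡ (ℚ.1/ (B ℚ.+ C))) (ℚ.*-monoˡ-<-pos (ℚ.1/ (B ℚ.+ C)) 0<ε)
        M , hx = cauchy x δ 0<δ
        N , hy = cauchy y δ 0<δ
    in (K ℕ.⊔ L) ℕ.⊔ (M ℕ.⊔ N) , λ m n ≤m ≤n →
      let KL≤m = ℕ.m⊔n≤o⇒m≤o (K ℕ.⊔ L) (M ℕ.⊔ N) ≤m
          MN≤m = ℕ.m⊔n≤o⇒n≤o (K ℕ.⊔ L) (M ℕ.⊔ N) ≤m
          KL≤n = ℕ.m⊔n≤o⇒m≤o (K ℕ.⊔ L) (M ℕ.⊔ N) ≤n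
          MN≤n = ℕ.m⊔n≤o⇒n≤o (K ℕ.⊔ L) (M ℕ.⊔ N) ≤n
      in begin-strict
        ∣ seq x m ℚ.* seq y m ℚ.- seq x n ℚ.* seq y n ∣ᵣ
          ≡⟨ cong ∣_∣ᵣ (shuffle (seq x m) (seq y m) (seq x n) (seq y n)) ⟩
        ∣ seq x m ℚ.* (seq y m ℚ.- seq y n) ℚ.+ seq y n ℚ.* (seq x m ℚ.- seq x n) ∣ᵣ
          ≤⟨ ℚ.∣p+q∣≤∣p∣+∣q∣ (seq x m ℚ.* (seq y m ℚ.- seq y n)) (seq y n ℚ.* (seq x m ℚ.- seq x n)) ⟩
        ∣ seq x m ℚ.* (seq y m ℚ.- seq y n) ∣ᵣ ℚ.+ ∣ seq y n ℚ.* (seq x m ℚ.- seq x n) ∣ᵣ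
          <⟨ ℚ.+-mono-<
               (product-bound (seq x m) (seq y m ℚ.- seq y n) 0<B
                 (bx m (ℕ.m⊔n≤o⇒m≤o K L KL≤m))
                 (hy m n (ℕ.m⊔n≤o⇒n≤o M N MN≤m) (ℕ.m⊔n≤o⇒n≤o M N MN≤n)))
               (product-bound (seq y n) (seq x m ℚ.- seq x n) 0<C
                 (by n (ℕ.m⊔n≤o⇒n≤o K L KL≤n))
                 (hx m n (ℕ.m⊔n≤o⇒m≤o M N MN≤m) (ℕ.m⊔n≤o⇒m≤o M N MN≤n))) ⟩
        B ℚ.* δ ℚ.+ C ℚ.* δ                      ≡⟨ ℚ.*-distribʳ-+ δ B C ⟨
        (B ℚ.+ C) ℚ.* δ                          ≡⟨ ℚ.*-comm (B ℚ.+ C) δ ⟩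
        ε ℚ.* ℚ.1/ (B ℚ.+ C) ℚ.* (B ℚ.+ C)       ≡⟨ ℚ.*-assoc ε (ℚ.1/ (B ℚ.+ C)) (B ℚ.+ C) ⟩
        ε ℚ.* (ℚ.1/ (B ℚ.+ C) ℚ.* (B ℚ.+ C))     ≡⟨ cong (ε ℚ.*_) (ℚ.*-inverseˡ (B ℚ.+ C)) ⟩
        ε ℚ.* 1ℚ                                 ≡⟨ ℚ.*-identityʳ ε ⟩
        ε ∎

ℝ-rawRing : RawRing 0ℓ 0ℓ
ℝ-rawRing = record
  { Carrier = ℝ
  ; _≈_     = _≃_
  ; _+_     = addℝ
  ; _*_     = mulℝ
  ; -_      = negℝ
  ; 0#      = fromℚ 0ℚ
  ; 1#      = fromℚ 1ℚ
  }

------------------------------------------------------------------------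
-- Formal power series in two variables x, y, polynomials and rational
-- functions, over a ring of coefficients

module Series {c ℓ} (R : RawRing c ℓ) where

  private
    module R = RawRing R

  -- f m n is the coefficient of xᵐyⁿ.
  PowerSeries : Set c
  PowerSeries = ℕ → ℕ → R.Carrier

  -- ∑≤ n f = f 0 + f 1 + ⋯ + f n
  ∑≤ : ℕ → (ℕ → R.Carrier) → R.Carrier
  ∑≤ zero    f = f 0
  ∑≤ (suc n) f = ∑≤ n f R.+ f (suc n)

  constant : R.Carrier → PowerSeries
  constant a zero zero = a
  constant a _    _    = R.0#

  PowerSeries-rawRing : RawRing c ℓ
  PowerSeries-rawRing = record
    { Carrier = PowerSeries
    ; _≈_     = λ f h → ∀ m n → f m n R.≈ h m n
    ; _+_     = λ f h m n → f m n R.+ h m n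
    ; _*_     = λ f h m n → ∑≤ m λ i → ∑≤ n λ j → f i j R.* h (m ∸ i) (n ∸ j)
    ; -_      = λ f m n → R.- f m n
    ; 0#      = constant R.0#
    ; 1#      = constant R.1#
    }

  open RawRing PowerSeries-rawRing
  open RawMonoidDefs +-rawMonoid using () renaming (_×_ to _·_)

  X Y : PowerSeries
  X 1 0 = R.1#
  X _ _ = R.0#
  Y 0 1 = R.1#
  Y _ _ = R.0#

  Nonzero : PowerSeries → Set ℓ
  Nonzero f = ∃₂ λ m n → ¬ f m n R.≈ R.0#

  -- S is the square root of f with constant term 1 (unique if 2 is invertible).
  IsSqrt : PowerSeries → PowerSeries → Set ℓ
  IsSqrt f S = S * S ≈ f × S 0 0 R.≈ R.1#

  -- (x + xy - 1)² - 4x²y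
  Δ : PowerSeries
  Δ = t * t + - (4 · (X * X * Y))
    where
    t : PowerSeries
    t = X + X * Y + - 1#

  -- A polynomial in n+1 variables is a polynomial in the first variable, given by
  -- its list of coefficients in increasing degree, each of which is a
  -- polynomial in the other variables.
  Poly : ℕ → Set c
  Poly zero    = R.Carrier
  Poly (suc n) = List (Poly n)

  NonzeroPoly : ∀ {n} → Poly n → Set (c Level.⊔ ℓ)
  NonzeroPoly {zero}  a = Level.Lift c (¬ a R.≈ R.0#)
  NonzeroPoly {suc n} q = Any (NonzeroPoly {n}) q

  evalPoly : ∀ {n} → Poly n → Vec PowerSeries n → PowerSeries
  evalPoly {zero}  a Vec.[]       = constant a
  evalPoly {suc n} q (v Vec.∷ vs) = foldr (λ a acc → evalPoly {n} a vs + v * acc) 0# q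

  record RatFun (n : ℕ) : Set (c Level.⊔ ℓ) where
    field
      num   : Poly n
      den   : Poly n
      den≢0 : NonzeroPoly {n} den

  -- Formal fractions of power series. No proof that the denominator is
  -- nonzero is stored; when R is a field, sums and products of fractions with
  -- nonzero denominators again have nonzero denominators, and _≃ᶠ_ is then
  -- equality in the field of fractions.
  infix 5 _//_
  record Fraction : Set c where
    constructor _//_
    field
      top    : PowerSeries
      bottom : PowerSeries
  open Fraction public

  infix  4 _≃ᶠ_
  infixl 6 _+ᶠ_
  infixl 7 _*ᶠ_

  _≃ᶠ_ : Fraction → Fraction → Set ℓ
  (a // b) ≃ᶠ (a′ // b′) = a * b′ ≈ a′ * b

  _+ᶠ_ _*ᶠ_ : Fraction → Fraction → Fraction
  (a // b) +ᶠ (a′ // b′) = a * b′ + a′ * b // b * b′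
  (a // b) *ᶠ (a′ // b′) = a * a′ // b * b′

  ⌊_⌋ : PowerSeries → Fraction
  ⌊ f ⌋ = f // 1#

  evalRat : ∀ {n} → RatFun n → Vec PowerSeries n → Fraction
  evalRat {n} F v = evalPoly {n} (RatFun.num F) v // evalPoly {n} (RatFun.den F) v

  -- f = F(v); in particular the right-hand side is defined.
  _≈⟦_⟧_ : ∀ {n} → PowerSeries → RatFun n → Vec PowerSeries n → Set ℓ
  f ≈⟦ F ⟧ v = Nonzero (bottom (evalRat F v)) × (⌊ f ⌋ ≃ᶠ evalRat F v)

  -- ∑ᵢ cᵢ(x,y) fⁱ, for a list c₀, c₁, … of rational functions.
  evalAt : List (RatFun 2) → PowerSeries → Fraction
  evalAt cs f = foldr (λ a acc → evalRat a (X Vec.∷ Y Vec.∷ Vec.[]) +ᶠ ⌊ f ⌋ *ᶠ acc) ⌊ 0# ⌋ cs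

  -- f is a root of a nonzero polynomial in one variable whose coefficients are
  -- rational functions in x and y.
  Algebraic : PowerSeries → Set (c Level.⊔ ℓ)
  Algebraic f = ∃[ cs ] Any (λ a → NonzeroPoly {2} (RatFun.num a)) cs × evalAt cs f ≃ᶠ ⌊ 0# ⌋

open Series ℝ-rawRing public

open RawMonoidDefs (RawRing.+-rawMonoid ℝ-rawRing) using () renaming (_×_ to _·ℝ_)

P : ℕ → PowerSeries
P g zero    k       = fromℚ 0ℚ
P g (suc n) zero    = fromℚ 0ℚ
P g (suc n) (suc k) = p g (suc n) (suc k) ·ℝ fromℚ 1ℚ

{-# OPTIONS --safe #-}

-- Reading a partition from left to right gives a sequence of steps on a stack
-- of open blocks.  Contracting singletons and cutting a block with k points
-- into k - 1 arcs joining neighbouring points turns it into a chord diagram,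
-- and the genus only depends on this diagram: two-colourings of the gaps that
-- agree along the boundary are counted by 2 to the number of cycles of α⁻¹ζ.
-- Removing a chord that joins neighbouring endpoints, or one of two parallel
-- chords, divides this number by two and hence preserves the genus.  A diagram
-- without such chords is called primitive.  In a primitive diagram of genus g
-- all boundary cycles but one pass at least three points, so that an Euler
-- characteristic count leaves at most 12 g endpoints: there are finitely many.
--
-- Let R = x (R + 1) (R + y) be the Narayana series and S = 1 - x - xy - 2xR, so
-- that S² = (x + xy - 1)² - 4x²y, and let o = x / S.  The series that counts
-- all partitions with given diagram satisfies a linear recursion in the first
-- letter of the diagram.  Weighting each primitive diagram by o for every
-- opening letter, by R + 1 for every closing letter that is followed by an
-- opening one, and by R for every other closing letter gives, up to the factor
-- R + 1, a solution of the same recursion, which is unique.  Hence P is, apart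
-- from the empty partition, a finite sum of products of R, R + 1 and o, which
-- lie in ℚ(x, y) + ℚ(x, y) S.  The computation takes place over ℚ; real
-- coefficients enter through constant Cauchy sequences.

module Submission where

-- Contracting every diagram to a primitive one and counting the diagrams above it would require a
-- normal form for the reductions. No primitive core of a diagram is ever constructed here. Instead
-- a language `φ` that the reductions leave invariant is read letter by letter, with its quotients
-- `φ · ℓ` as states, for every number `h` of open arcs. In the sum over primitive words, forbidden
-- beginnings are removed by subtraction, and by the invariance of `φ` what is subtracted is again a
-- sum of the same kind for one arc less. This closes the recursion and explains the correction
-- terms on the side of the path series. The solution is unique because each opening letter carries
-- a factor `o`, which is divisible by `x`, and each closing letter lowers `h`. Cycle numbers obey
-- no simple recursion along a path, since a new point can merge or split cycles of the product with
-- `ζ`. The number of colourings that are constant on cycles does, with the colours at the open arcs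
-- as its state, and it determines the number of cycles.

-- Formal power series in one variable over a commutative ring

module SeriesRing where

  open import Algebra.Bundles using (CommutativeRing)
  open import Algebra.Structures using (IsCommutativeRing)
  open import Data.Nat.Base using (ℕ; zero; suc; _∸_; _≤_; _<_; z≤n; s≤s)
  import Data.Nat.Properties as ℕ
  open import Data.Product.Base using (_,_)
  import Algebra.Properties.Ring as RingProps
  import Algebra.Properties.CommutativeSemigroup as CSG
  import Relation.Binary.Reasoning.Setoid as SetoidReasoning

  module Univariate {c ℓ} (R : CommutativeRing c ℓ) where

    open CommutativeRing R
    ∑≤ : ℕ → (ℕ → Carrier) → Carrier
    ∑≤ zero    f = f 0
    ∑≤ (suc n) f = ∑≤ n f + f (suc n)
    open SetoidReasoning setoid
    private
      module +S = CSG +-commutativeSemigroup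

    infix 4 _≋_
    _≋_ : (ℕ → Carrier) → (ℕ → Carrier) → Set ℓ
    f ≋ h = ∀ n → f n ≈ h n

    ∑≤-cong : ∀ n {f h} → f ≋ h → ∑≤ n f ≈ ∑≤ n h
    ∑≤-cong zero    f≋h = f≋h 0
    ∑≤-cong (suc n) f≋h = +-cong (∑≤-cong n f≋h) (f≋h (suc n))

    ∑≤-head : ∀ n f → ∑≤ (suc n) f ≈ f 0 + ∑≤ n (λ i → f (suc i))
    ∑≤-head zero    f = refl
    ∑≤-head (suc n) f = begin
      ∑≤ (suc n) f + f (suc (suc n))                               ≈⟨ +-congʳ (∑≤-head n f) ⟩
      f 0 + ∑≤ n (λ i → f (suc i)) + f (suc (suc n))               ≈⟨ +-assoc _ _ _ ⟩
      f 0 + (∑≤ n (λ i → f (suc i)) + f (suc (suc n)))             ∎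

    ∑≤-+ : ∀ n f h → ∑≤ n (λ i → f i + h i) ≈ ∑≤ n f + ∑≤ n h
    ∑≤-+ zero    f h = refl
    ∑≤-+ (suc n) f h = trans (+-congʳ (∑≤-+ n f h)) (+S.interchange _ _ _ _)

    ∑≤-*ˡ : ∀ n a f → ∑≤ n (λ i → a * f i) ≈ a * ∑≤ n f
    ∑≤-*ˡ zero    a f = refl
    ∑≤-*ˡ (suc n) a f = trans (+-congʳ (∑≤-*ˡ n a f)) (sym (distribˡ a _ _))

    ∑≤-0 : ∀ n {f} → (∀ i → f i ≈ 0#) → ∑≤ n f ≈ 0#
    ∑≤-0 zero    f≈0 = f≈0 0
    ∑≤-0 (suc n) f≈0 = trans (+-cong (∑≤-0 n f≈0) (f≈0 (suc n))) (+-identityˡ 0#)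

    infixl 6 _⊕_
    infixl 7 _⊛_
    _⊕_ _⊛_ : (ℕ → Carrier) → (ℕ → Carrier) → ℕ → Carrier
    (f ⊕ h) n = f n + h n
    (f ⊛ h) n = ∑≤ n λ i → f i * h (n ∸ i)

    𝟘 𝟙 : ℕ → Carrier
    𝟘 _       = 0#
    𝟙 zero    = 1#
    𝟙 (suc _) = 0#

    tail : (ℕ → Carrier) → ℕ → Carrier
    tail f n = f (suc n)

    ⊛-cong : ∀ {f f′ h h′} → f ≋ f′ → h ≋ h′ → f ⊛ h ≋ f′ ⊛ h′
    ⊛-cong f≋ h≋ n = ∑≤-cong n λ i → *-cong (f≋ i) (h≋ (n ∸ i))

    ⊛-suc : ∀ f h n → (f ⊛ h) (suc n) ≈ f 0 * h (suc n) + (tail f ⊛ h) n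
    ⊛-suc f h n = ∑≤-head n λ i → f i * h (suc n ∸ i)

    ⊛-distribˡ : ∀ f g h → f ⊛ (g ⊕ h) ≋ f ⊛ g ⊕ f ⊛ h
    ⊛-distribˡ f g h n =
      trans (∑≤-cong n λ i → distribˡ (f i) _ _) (∑≤-+ n _ _)

    -- Splitting off the heads of `f` and `h` leaves the product of the two tails, two degrees
    -- lower, which is symmetric by induction. The recursion looks back two degrees, whence the two
    -- base cases.
    ⊛-comm : ∀ f h → f ⊛ h ≋ h ⊛ f
    ⊛-comm f h zero          = *-comm _ _
    ⊛-comm f h (suc zero)    = trans (+-comm _ _) (+-cong (*-comm _ _) (*-comm _ _))
    ⊛-comm f h (suc (suc n)) = begin
      (f ⊛ h) (suc (suc n))                                           ≈⟨ ⊛-suc f h (suc n) ⟩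
      f 0 * h (suc (suc n)) + (tail f ⊛ h) (suc n)                    ≈⟨ +-congˡ (⊛-comm (tail f) h (suc n)) ⟩
      f 0 * h (suc (suc n)) + (h ⊛ tail f) (suc n)                    ≈⟨ +-congˡ (⊛-suc h (tail f) n) ⟩
      f 0 * h (suc (suc n)) + (h 0 * f (suc (suc n)) + (tail h ⊛ tail f) n)
        ≈⟨ +-cong (*-comm _ _) (+-cong (*-comm _ _) (⊛-comm (tail h) (tail f) n)) ⟩
      h (suc (suc n)) * f 0 + (f (suc (suc n)) * h 0 + (tail f ⊛ tail h) n)
        ≈⟨ +S.x∙yz≈y∙xz _ _ _ ⟩
      f (suc (suc n)) * h 0 + (h (suc (suc n)) * f 0 + (tail f ⊛ tail h) n)
        ≈⟨ +-cong (*-comm _ _) (+-congʳ (*-comm _ _)) ⟩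
      h 0 * f (suc (suc n)) + (f 0 * h (suc (suc n)) + (tail f ⊛ tail h) n)
        ≈⟨ +-congˡ (⊛-suc f (tail h) n) ⟨
      h 0 * f (suc (suc n)) + (f ⊛ tail h) (suc n)                    ≈⟨ +-congˡ (⊛-comm f (tail h) (suc n)) ⟩
      h 0 * f (suc (suc n)) + (tail h ⊛ f) (suc n)                    ≈⟨ ⊛-suc h f (suc n) ⟨
      (h ⊛ f) (suc (suc n))                                           ∎

    ⊛-distribʳ : ∀ f g h → (g ⊕ h) ⊛ f ≋ g ⊛ f ⊕ h ⊛ f
    ⊛-distribʳ f g h n = trans (∑≤-cong n λ i → distribʳ _ (g i) (h i)) (∑≤-+ n _ _)

    ⊛-assoc : ∀ f g h → (f ⊛ g) ⊛ h ≋ f ⊛ (g ⊛ h)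
    ⊛-assoc f g h zero    = *-assoc _ _ _
    ⊛-assoc f g h (suc n) = begin
      ((f ⊛ g) ⊛ h) (suc n)                                              ≈⟨ ⊛-suc (f ⊛ g) h n ⟩
      f 0 * g 0 * h (suc n) + (tail (f ⊛ g) ⊛ h) n
        ≈⟨ +-cong (*-assoc _ _ _) (⊛-cong {h = h} {h} (⊛-suc f g) (λ _ → refl) n) ⟩
      f 0 * (g 0 * h (suc n)) + (((λ i → f 0 * g (suc i)) ⊕ tail f ⊛ g) ⊛ h) n
        ≈⟨ +-congˡ (⊛-distribʳ h (λ i → f 0 * g (suc i)) (tail f ⊛ g) n) ⟩
      f 0 * (g 0 * h (suc n)) + (((λ i → f 0 * g (suc i)) ⊛ h) n + ((tail f ⊛ g) ⊛ h) n)
        ≈⟨ +-congˡ (+-cong (trans (∑≤-cong n λ i → *-assoc _ _ _) (∑≤-*ˡ n (f 0) _)) (⊛-assoc (tail f) g h n)) ⟩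
      f 0 * (g 0 * h (suc n)) + (f 0 * (tail g ⊛ h) n + (tail f ⊛ (g ⊛ h)) n)
        ≈⟨ +-assoc _ _ _ ⟨
      f 0 * (g 0 * h (suc n)) + f 0 * (tail g ⊛ h) n + (tail f ⊛ (g ⊛ h)) n
        ≈⟨ +-congʳ (distribˡ (f 0) _ _) ⟨
      f 0 * (g 0 * h (suc n) + (tail g ⊛ h) n) + (tail f ⊛ (g ⊛ h)) n
        ≈⟨ +-congʳ (*-congˡ (⊛-suc g h n)) ⟨
      f 0 * (g ⊛ h) (suc n) + (tail f ⊛ (g ⊛ h)) n                      ≈⟨ ⊛-suc f (g ⊛ h) n ⟨
      (f ⊛ (g ⊛ h)) (suc n)                                              ∎

    ⊛-identityˡ : ∀ f → 𝟙 ⊛ f ≋ f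
    ⊛-identityˡ f zero    = *-identityˡ _
    ⊛-identityˡ f (suc n) = begin
      (𝟙 ⊛ f) (suc n)                         ≈⟨ ⊛-suc 𝟙 f n ⟩
      1# * f (suc n) + (tail 𝟙 ⊛ f) n         ≈⟨ +-cong (*-identityˡ _) (∑≤-0 n λ i → zeroˡ _) ⟩
      f (suc n) + 0#                          ≈⟨ +-identityʳ _ ⟩
      f (suc n)                               ∎

    ⊛-isCommutativeRing : IsCommutativeRing _≋_ _⊕_ _⊛_ (λ f n → - f n) 𝟘 𝟙
    ⊛-isCommutativeRing = record
      { isRing = record
        { +-isAbelianGroup = record
          { isGroup = record
            { isMonoid = record
              { isSemigroup = record
                { isMagma = record
                  { isEquivalence = record
                    { refl  = λ _ → refl
                    ; sym   = λ e n → sym (e n)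
                    ; trans = λ d e n → trans (d n) (e n) }
                  ; ∙-cong = λ d e n → +-cong (d n) (e n) }
                ; assoc = λ f g h n → +-assoc _ _ _ }
              ; identity = (λ f n → +-identityˡ _) , (λ f n → +-identityʳ _) }
            ; inverse = (λ f n → -‿inverseˡ _) , (λ f n → -‿inverseʳ _)
            ; ⁻¹-cong = λ e n → -‿cong (e n) }
          ; comm = λ f g n → +-comm _ _ }
        ; *-cong = ⊛-cong
        ; *-assoc = ⊛-assoc
        ; *-identity = ⊛-identityˡ , λ f n → trans (⊛-comm f 𝟙 n) (⊛-identityˡ f n)
        ; distrib = ⊛-distribˡ , ⊛-distribʳ }
      ; *-comm = ⊛-comm }

    powerSeriesRing : CommutativeRing c ℓ
    powerSeriesRing = record { isCommutativeRing = ⊛-isCommutativeRing }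

    scalar : Carrier → ℕ → Carrier
    scalar a zero    = a
    scalar a (suc _) = 0#

    scalar-⊛ : ∀ a f n → (scalar a ⊛ f) n ≈ a * f n
    scalar-⊛ a f zero    = refl
    scalar-⊛ a f (suc n) = begin
      (scalar a ⊛ f) (suc n)             ≈⟨ ⊛-suc (scalar a) f n ⟩
      a * f (suc n) + (𝟘 ⊛ f) n          ≈⟨ +-congˡ (∑≤-0 n λ i → zeroˡ _) ⟩
      a * f (suc n) + 0#                 ≈⟨ +-identityʳ _ ⟩
      a * f (suc n)                      ∎

    scalar-+ : ∀ a b → scalar (a + b) ≋ scalar a ⊕ scalar b
    scalar-+ a b zero    = refl
    scalar-+ a b (suc n) = sym (+-identityˡ 0#)

    scalar-* : ∀ a b → scalar (a * b) ≋ scalar a ⊛ scalar b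
    scalar-* a b zero    = refl
    scalar-* a b (suc n) = sym (trans (scalar-⊛ a (scalar b) (suc n)) (zeroʳ a))

    scalar-neg : ∀ a → scalar (- a) ≋ λ n → - scalar a n
    scalar-neg a zero    = refl
    scalar-neg a (suc n) = sym (RingProps.-0#≈0# (CommutativeRing.ring R))

    scalar-cong : ∀ {a b} → a ≈ b → scalar a ≋ scalar b
    scalar-cong a≈b zero    = a≈b
    scalar-cong a≈b (suc n) = refl

    scalar-0 : scalar 0# ≋ 𝟘
    scalar-0 zero    = refl
    scalar-0 (suc n) = refl

    scalar-1 : scalar 1# ≋ 𝟙
    scalar-1 zero    = refl
    scalar-1 (suc n) = refl

    𝕏 : ℕ → Carrier
    𝕏 1 = 1#
    𝕏 _ = 0#

    𝕏-⊛-zero : ∀ f → (𝕏 ⊛ f) 0 ≈ 0#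
    𝕏-⊛-zero f = zeroˡ _

    𝕏-⊛-suc : ∀ f n → (𝕏 ⊛ f) (suc n) ≈ f n
    𝕏-⊛-suc f n = begin
      (𝕏 ⊛ f) (suc n)                        ≈⟨ ⊛-suc 𝕏 f n ⟩
      0# * f (suc n) + (tail 𝕏 ⊛ f) n        ≈⟨ +-cong (zeroˡ _) (⊛-cong {h = f} {f} tail-𝕏 (λ _ → refl) n) ⟩
      0# + (𝟙 ⊛ f) n                         ≈⟨ +-identityˡ _ ⟩
      (𝟙 ⊛ f) n                              ≈⟨ ⊛-identityˡ f n ⟩
      f n                                    ∎
      where
      tail-𝕏 : tail 𝕏 ≋ 𝟙
      tail-𝕏 zero    = refl
      tail-𝕏 (suc _) = refl

    infix 4 _≋[_]_
    -- Congruence modulo the `a`-th power of the variable.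
    _≋[_]_ : (ℕ → Carrier) → ℕ → (ℕ → Carrier) → Set ℓ
    f ≋[ a ] h = ∀ {n} → n < a → f n ≈ h n

    ∑≤-cong-≤ : ∀ n {f h} → (∀ {i} → i ≤ n → f i ≈ h i) → ∑≤ n f ≈ ∑≤ n h
    ∑≤-cong-≤ zero    f≈h = f≈h z≤n
    ∑≤-cong-≤ (suc n) f≈h = +-cong (∑≤-cong-≤ n λ i≤n → f≈h (ℕ.m≤n⇒m≤1+n i≤n)) (f≈h ℕ.≤-refl)

    ⊛-cong-mod : ∀ {a f f′ h h′} → f ≋[ a ] f′ → h ≋[ a ] h′ → f ⊛ h ≋[ a ] f′ ⊛ h′
    ⊛-cong-mod f≋ h≋ {n} n<a = ∑≤-cong-≤ n λ {i} i≤n →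
      *-cong (f≋ (ℕ.≤-<-trans i≤n n<a)) (h≋ (ℕ.≤-<-trans (ℕ.m∸n≤m n i) n<a))

    ⊕-cong-mod : ∀ {a f f′ h h′} → f ≋[ a ] f′ → h ≋[ a ] h′ → f ⊕ h ≋[ a ] f′ ⊕ h′
    ⊕-cong-mod f≋ h≋ n<a = +-cong (f≋ n<a) (h≋ n<a)

    𝕏-⊛-mod : ∀ {a f h} → f ≋[ a ] h → 𝕏 ⊛ f ≋[ suc a ] 𝕏 ⊛ h
    𝕏-⊛-mod {f = f} {h} f≋h {zero}  _         = trans (𝕏-⊛-zero f) (sym (𝕏-⊛-zero h))
    𝕏-⊛-mod {f = f} {h} f≋h {suc n} (s≤s n<a) =
      trans (𝕏-⊛-suc f n) (trans (f≋h n<a) (sym (𝕏-⊛-suc h n)))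

    module Fixpoint (F : (ℕ → Carrier) → ℕ → Carrier)
                    (contraction : ∀ {a f h} → f ≋[ a ] h → F f ≋[ suc a ] F h) where

      approximant : ℕ → ℕ → Carrier
      approximant zero    = 𝟘
      approximant (suc m) = F (approximant m)

      -- The approximants converge in the adic topology: by `stable`, the coefficient `n` no longer
      -- changes from the approximant `suc n` on.
      fix : ℕ → Carrier
      fix n = approximant (suc n) n

      private
        stable : ∀ {a} m → a ≤ m → approximant a ≋[ a ] approximant m
        stable {zero}  m       _         ()
        stable {suc a} (suc m) (s≤s a≤m) = contraction (stable m a≤m)

        fix-approximant : ∀ a → fix ≋[ a ] approximant a
        fix-approximant a {n} n<a = stable {suc n} a n<a ℕ.≤-refl

      fix-unfold : fix ≋ F fix
      fix-unfold n = sym (contraction (fix-approximant n) ℕ.≤-refl)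

-- Chord diagrams as words, their reductions, primitive words

module ChordWords where

  open import Data.Bool.Base using (Bool; true; false; not; if_then_else_)
  open import Data.List.Base using (List; []; _∷_; _++_; length)
  open import Data.Maybe.Base using (Maybe; just; nothing)
  open import Data.Nat.Base
  open import Data.Nat.Properties
  open import Relation.Binary.Definitions using (tri<; tri≈; tri>)
  open import Relation.Binary.PropositionalEquality
  open import Relation.Nullary using (contradiction)

  -- Chord diagrams as words: O opens an arc, C j closes the j-th open arc,
  -- counted from the most recently opened one.
  data Letter : Set where
    O : Letter
    C : ℕ → Letter

  Word : Set
  Word = List Letter

  Language : Set
  Language = Word → Bool

  infixl 8 _·_
  -- The left quotient of a language by a letter, which serves as the state after this letter has
  -- been read.
  _·_ : Language → Letter → Language
  (φ · ℓ) w = φ (ℓ ∷ w)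

  -- Doubles the i-th open arc by a parallel arc just beyond it.
  dbl : ℕ → Word → Word
  dbl i []        = []
  dbl i (O ∷ w)   = O ∷ dbl (suc i) w
  dbl i (C j ∷ w) with <-cmp j i
  ... | tri< _ _ _ = C j ∷ dbl (pred i) w
  -- Once the upper copy is closed, the lower one has moved up to place `i`. No doubled arc is open
  -- after that, so the rest of the word stays as it is.
  ... | tri≈ _ _ _ = C i ∷ C i ∷ w
  ... | tri> _ _ _ = C (suc j) ∷ dbl i w

  dbl-< : ∀ {i j} w → j < i → dbl i (C j ∷ w) ≡ C j ∷ dbl (pred i) w
  dbl-< {i} {j} w j<i with <-cmp j i
  ... | tri< _ _ _ = refl
  ... | tri≈ ¬j<i _ _ = contradiction j<i ¬j<i
  ... | tri> ¬j<i _ _ = contradiction j<i ¬j<i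

  dbl-≡ : ∀ i w → dbl i (C i ∷ w) ≡ C i ∷ C i ∷ w
  dbl-≡ i w with <-cmp i i
  ... | tri< _ i≢i _ = contradiction refl i≢i
  ... | tri≈ _ _ _ = refl
  ... | tri> _ i≢i _ = contradiction refl i≢i

  dbl-> : ∀ {i j} w → i < j → dbl i (C j ∷ w) ≡ C (suc j) ∷ dbl i w
  dbl-> {i} {j} w i<j with <-cmp j i
  ... | tri< _ _ ¬i<j = contradiction i<j ¬i<j
  ... | tri≈ _ _ ¬i<j = contradiction i<j ¬i<j
  ... | tri> _ _ _ = refl

  -- The arbitrary prefix `u` makes the invariance pass from `φ` to every quotient `φ · ℓ`, which a
  -- recursion along words needs.
  record Reducible (φ : Language) : Set where
    field
      short    : ∀ u v → φ (u ++ O ∷ C 0 ∷ v) ≡ φ (u ++ v)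
      parallel : ∀ u v → φ (u ++ O ∷ O ∷ dbl 0 v) ≡ φ (u ++ O ∷ v)
  open Reducible public

  Reducible-· : ∀ {φ} ℓ → Reducible φ → Reducible (φ · ℓ)
  Reducible-· ℓ r = record
    { short    = λ u → short r (ℓ ∷ u)
    ; parallel = λ u → parallel r (ℓ ∷ u)
    }

  Doubled : ℕ → Language → Language → Set
  Doubled i φ φ′ = ∀ v → φ (dbl i v) ≡ φ′ v

  -- A letter is weighted according to the letter that follows it, so the weight
  -- of a word depends on the last letter read.
  data Mode : Set where
    initial opened closed : Mode

  -- Every open arc carries a flag that tells whether the arc beyond it was opened
  -- by the next letter; closing the upper arc of such a parallel pair
  -- forbids closing the lower one immediately afterwards.
  lower : List Bool → List Bool
  lower []       = []
  lower (_ ∷ fs) = false ∷ fs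

  topFlag : List Bool → Bool
  topFlag []      = false
  topFlag (f ∷ _) = f

  -- The flag of the former top arc is set exactly if its opening letter was the previous letter:
  -- only then are the two left endpoints neighbours.
  push : Mode → List Bool → List Bool
  push opened (_ ∷ fs) = false ∷ true ∷ fs
  push _      fs       = false ∷ fs

  -- When the arc at place `length xs` is closed, the arc below takes over this place, so this is
  -- the place to ban.
  forbid : List Bool → List Bool → Maybe ℕ
  forbid xs ys = if topFlag ys then just (length xs) else nothing

  allowed : Maybe ℕ → ℕ → Bool
  allowed nothing  _ = true
  allowed (just i) j = not (i ≡ᵇ j)

  -- Compares the ban for a stack with a doubled arc at the places `i` and `suc i` with the ban for
  -- the stack that has a single arc at `i`. A ban on the lower copy has no counterpart.
  data Shifted (i : ℕ) : Maybe ℕ → Maybe ℕ → Set where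
    nowhere  : Shifted i nothing nothing
    upto  : ∀ {j} → j ≤ i → Shifted i (just j) (just j)
    beyond : ∀ {j} → i < j → Shifted i (just (suc j)) (just j)

  ≡ᵇ-refl : ∀ n → (n ≡ᵇ n) ≡ true
  ≡ᵇ-refl zero    = refl
  ≡ᵇ-refl (suc n) = ≡ᵇ-refl n

  ≢⇒≡ᵇ-false : ∀ {m n} → m ≢ n → (m ≡ᵇ n) ≡ false
  ≢⇒≡ᵇ-false {zero}  {zero}  m≢n = contradiction refl m≢n
  ≢⇒≡ᵇ-false {zero}  {suc n} m≢n = refl
  ≢⇒≡ᵇ-false {suc m} {zero}  m≢n = refl
  ≢⇒≡ᵇ-false {suc m} {suc n} m≢n = ≢⇒≡ᵇ-false λ m≡n → m≢n (cong suc m≡n)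

  allowed-≤ : ∀ {i fb fb′ j} → Shifted i fb fb′ → j ≤ i → allowed fb j ≡ allowed fb′ j
  allowed-≤ nowhere      _   = refl
  allowed-≤ (upto _)  _   = refl
  allowed-≤ {j = j} (beyond {k} i<k) j≤i =
    cong not (trans (≢⇒≡ᵇ-false {suc k} {j} (>⇒≢ (m<n⇒m<1+n (≤-<-trans j≤i i<k))))
               (sym (≢⇒≡ᵇ-false {k} {j} (>⇒≢ (≤-<-trans j≤i i<k)))))

  allowed-> : ∀ {i fb fb′ j} → Shifted i fb fb′ → i < j → allowed fb (suc j) ≡ allowed fb′ j
  allowed-> nowhere      _ = refl
  allowed-> {j = j} (upto {k} k≤i) i<j =
    cong not (trans (≢⇒≡ᵇ-false {k} {suc j} (<⇒≢ (m<n⇒m<1+n (≤-<-trans k≤i i<j))))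
               (sym (≢⇒≡ᵇ-false {k} {j} (<⇒≢ (≤-<-trans k≤i i<j)))))
  allowed-> (beyond _) _ = refl

  -- no factor O, C 0 and no parallel pair of arcs closed by consecutive letters
  data Primitive : List Bool → Mode → Maybe ℕ → Word → Set where
    ending  : ∀ {μ fb} → Primitive [] μ fb []
    opening : ∀ {fs μ fb w} → Primitive (push μ fs) opened (just 0) w → Primitive fs μ fb (O ∷ w)
    closing : ∀ {μ fb w} xs f ys → allowed fb (length xs) ≡ true →
      Primitive (xs ++ lower ys) closed (forbid xs ys) w → Primitive (xs ++ f ∷ ys) μ fb (C (length xs) ∷ w)

-- The genus of a chord diagram through colourings

module GenusOfWords where

  open import Data.Bool.Base using (Bool; true; false; if_then_else_)
  open import Data.Bool.Properties using () renaming (_≟_ to _≟ᵇ_)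
  open import Data.List.Base using (List; []; _∷_; _++_; length)
  open import Data.List.Properties using (++-assoc; length-++)
  open import Data.Maybe.Base as Maybe using (Maybe; just; nothing)
  open import Data.Nat.Base
  open import Data.Nat.Properties
  open import Data.Product.Base using (∃; ∃₂; _×_; _,_; map₂)
  open import Relation.Binary.Definitions using (tri<; tri≈; tri>)
  open import Relation.Binary.PropositionalEquality
  open import Relation.Nullary using (does; yes; no)
  open ChordWords

  pick : ∀ {A : Set} → ℕ → List A → Maybe (A × List A)
  pick j       []       = nothing
  pick zero    (a ∷ as) = just (a , as)
  pick (suc j) (a ∷ as) with pick j as
  ... | nothing        = nothing
  ... | just (b , bs)  = just (b , a ∷ bs)

  -- The number of ways to colour, with two colours, the gaps between the
  -- endpoints read by w such that colours agree along the boundary of the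
  -- thickened diagram.  An open arc carries the colours of the gaps after and
  -- before its left endpoint, c is the colour of the current gap and r that of
  -- the first one, which is also the last one.
  run : Word → List (Bool × Bool) → Bool → Bool → ℕ
  runClosed : Word → Maybe ((Bool × Bool) × List (Bool × Bool)) → Bool → Bool → ℕ
  run []        []      c r = if does (c ≟ᵇ r) then 1 else 0
  run []        (_ ∷ _) c r = 0
  run (O ∷ w)   s       c r = run w ((true , c) ∷ s) true r + run w ((false , c) ∷ s) false r
  run (C j ∷ w) s       c r = runClosed w (pick j s) c r
  runClosed w nothing              c r = 0
  runClosed w (just ((i , o) , s)) c r = if does (i ≟ᵇ c) then run w s o r else 0

  colourings : Word → ℕ
  colourings w = run w [] true true + run w [] false false

  chords : Word → ℕ
  chords []        = 0
  chords (O ∷ w)   = suc (chords w)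
  chords (C _ ∷ w) = chords w

  chords-++ : ∀ u v → chords (u ++ v) ≡ chords u + chords v
  chords-++ []        v = refl
  chords-++ (O ∷ u)   v = cong suc (chords-++ u v)
  chords-++ (C _ ∷ u) v = chords-++ u v

  run-cong : ∀ {k} u {v v′} → (∀ s c r → run v s c r ≡ k * run v′ s c r) →
    ∀ s c r → run (u ++ v) s c r ≡ k * run (u ++ v′) s c r
  run-cong {k} []        eq s c r = eq s c r
  run-cong {k} (O ∷ u)   eq s c r =
    trans (cong₂ _+_ (run-cong {k} u eq _ _ _) (run-cong {k} u eq _ _ _)) (sym (*-distribˡ-+ k _ _))
  run-cong {k} (C j ∷ u) eq s c r with pick j s
  ... | nothing = sym (*-zeroʳ k)
  ... | just ((i , o) , s′) with does (i ≟ᵇ c)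
  ...   | true  = run-cong {k} u eq s′ o r
  ...   | false = sym (*-zeroʳ k)

  -- The gap inside the short arc may take either colour, and afterwards the colour before the arc
  -- is restored.
  run-short : ∀ v s c r → run (O ∷ C 0 ∷ v) s c r ≡ 2 * run v s c r
  run-short v s c r = cong (run v s c r +_) (sym (+-identityʳ _))

  pick-here : ∀ {A : Set} xs (a : A) ys → pick (length xs) (xs ++ a ∷ ys) ≡ just (a , xs ++ ys)
  pick-here []       a ys = refl
  pick-here (x ∷ xs) a ys rewrite pick-here xs a ys = refl

  pick-++ʳ : ∀ {A : Set} us k (vs : List A) →
    pick (length us + k) (us ++ vs) ≡ Maybe.map (map₂ (us ++_)) (pick k vs)
  pick-++ʳ []       k vs with pick k vs
  ... | nothing = refl
  ... | just _  = refl
  pick-++ʳ (u ∷ us) k vs rewrite pick-++ʳ us k vs with pick k vs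
  ... | nothing = refl
  ... | just _  = refl

  split : ∀ {A : Set} j (us : List A) → j < length us →
    ∃ λ xs → ∃₂ λ u ys → us ≡ xs ++ u ∷ ys × j ≡ length xs
  split zero    (u ∷ us) _         = [] , u , us , refl , refl
  split (suc j) (u ∷ us) (s≤s j<n) with split j us j<n
  ... | xs , u′ , ys , refl , refl = u ∷ xs , u′ , ys , refl , refl

  -- The gap between the two left endpoints has the colour `e`. Closing the upper arc gives this
  -- colour to the gap between the two right endpoints, so the test for the lower arc succeeds by
  -- itself, and the pair acts like one arc with the colours `p` and `q`.
  run-dbl : ∀ v us p q e ss c r →
    run (dbl (length us) v) (us ++ (p , e) ∷ (e , q) ∷ ss) c r ≡ run v (us ++ (p , q) ∷ ss) c r
  run-dbl []      []       p q e ss c r = refl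
  run-dbl []      (_ ∷ us) p q e ss c r = refl
  run-dbl (O ∷ v) us       p q e ss c r = cong₂ _+_ (run-dbl v (_ ∷ us) p q e ss true r) (run-dbl v (_ ∷ us) p q e ss false r)
  run-dbl (C j ∷ v) us p q e ss c r with <-cmp j (length us)
  ... | tri< j<i _ _ with split j us j<i
  ...   | xs , (i , o) , ys , refl , refl
          rewrite ++-assoc xs ((i , o) ∷ ys) ((p , e) ∷ (e , q) ∷ ss)
                | ++-assoc xs ((i , o) ∷ ys) ((p , q) ∷ ss)
                | pick-here xs (i , o) (ys ++ (p , e) ∷ (e , q) ∷ ss)
                | pick-here xs (i , o) (ys ++ (p , q) ∷ ss) with does (i ≟ᵇ c)
  ...     | false = refl
  ...     | true
            rewrite sym (++-assoc xs ys ((p , e) ∷ (e , q) ∷ ss)) | sym (++-assoc xs ys ((p , q) ∷ ss))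
                  | length-++ xs {(i , o) ∷ ys} | +-suc (length xs) (length ys) | sym (length-++ xs {ys}) =
            run-dbl v (xs ++ ys) p q e ss o r
  run-dbl (C j ∷ v) us p q e ss c r | tri≈ _ refl _
    rewrite pick-here us (p , e) ((e , q) ∷ ss) | pick-here us (p , q) ss with does (p ≟ᵇ c)
  ... | false = refl
  ... | true rewrite pick-here us (e , q) ss = if-same e
    where
    if-same : ∀ e → (if does (e ≟ᵇ e) then run v (us ++ ss) q r else 0) ≡ run v (us ++ ss) q r
    if-same true  = refl
    if-same false = refl
  run-dbl (C j ∷ v) us p q e ss c r | tri> _ _ i<j with m≤n⇒∃[o]m+o≡n i<j
  ... | k , refl
    rewrite sym (+-suc (length us) k) | sym (+-suc (length us) (suc k))
          | pick-++ʳ us (2 + k) ((p , e) ∷ (e , q) ∷ ss) | pick-++ʳ us (1 + k) ((p , q) ∷ ss)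
    with pick k ss
  ... | nothing = refl
  ... | just ((i , o) , s) with does (i ≟ᵇ c)
  ...   | true  = run-dbl v us p q e s o r
  ...   | false = refl

  chords-dbl : ∀ i v → chords (dbl i v) ≡ chords v
  chords-dbl i []        = refl
  chords-dbl i (O ∷ v)   = cong suc (chords-dbl (suc i) v)
  chords-dbl i (C j ∷ v) with <-cmp j i
  ... | tri< _ _ _ = chords-dbl (pred i) v
  ... | tri≈ _ _ _ = refl
  ... | tri> _ _ _ = chords-dbl i v

  -- By `run-dbl` the colour of the gap between the two left endpoints has no influence on the rest,
  -- whence the factor 2.
  run-parallel : ∀ v s c r → run (O ∷ O ∷ dbl 0 v) s c r ≡ 2 * run (O ∷ v) s c r
  run-parallel v s c r = begin
    run (O ∷ O ∷ dbl 0 v) s c r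
      ≡⟨ cong₂ _+_ (cong₂ _+_ (run-dbl v [] _ _ _ s _ r) (run-dbl v [] _ _ _ s _ r))
                   (cong₂ _+_ (run-dbl v [] _ _ _ s _ r) (run-dbl v [] _ _ _ s _ r)) ⟩
    run (O ∷ v) s c r + run (O ∷ v) s c r
      ≡⟨ cong (run (O ∷ v) s c r +_) (sym (+-identityʳ _)) ⟩
    2 * run (O ∷ v) s c r ∎
    where open ≡-Reasoning

  colourings-2 : ∀ u {v v′} → (∀ s c r → run v s c r ≡ 2 * run v′ s c r) →
    colourings (u ++ v) ≡ 2 * colourings (u ++ v′)
  colourings-2 u {v} {v′} eq = trans
    (cong₂ _+_ (run-cong {2} u {v} {v′} eq [] true true) (run-cong {2} u {v} {v′} eq [] false false))
    (sym (*-distribˡ-+ 2 (run (u ++ v′) [] true true) _))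

  -- A diagram with m chords has genus g when it has m + 1 - 2g boundary
  -- components, that is 2 ^ (m + 1 - 2g) colourings.
  genus : ℕ → Language
  genus g w = colourings w * 4 ^ g ≡ᵇ 2 ^ suc (chords w)

  private
    ≡ᵇ-* : ∀ k a b .{{_ : NonZero k}} → (k * a ≡ᵇ k * b) ≡ (a ≡ᵇ b)
    ≡ᵇ-* k a b with a ≟ b
    ... | yes refl = trans (≡ᵇ-refl (k * a)) (sym (≡ᵇ-refl a))
    ... | no a≢b   = trans (≢⇒≡ᵇ-false λ eq → a≢b (*-cancelˡ-≡ a b k eq)) (sym (≢⇒≡ᵇ-false a≢b))

    genus-2 : ∀ g w w′ → colourings w ≡ 2 * colourings w′ → chords w ≡ suc (chords w′) →
      genus g w ≡ genus g w′
    genus-2 g w w′ col ch rewrite col | ch | *-assoc 2 (colourings w′) (4 ^ g) =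
      ≡ᵇ-* 2 (colourings w′ * 4 ^ g) (2 ^ suc (chords w′))

  genus-reducible : ∀ g → Reducible (genus g)
  genus-reducible g = record
    { short = λ u v → genus-2 g (u ++ O ∷ C 0 ∷ v) (u ++ v)
        (colourings-2 u {O ∷ C 0 ∷ v} {v} (run-short v))
        (trans (chords-++ u _) (trans (+-suc _ _) (cong suc (sym (chords-++ u v)))))
    ; parallel = λ u v → genus-2 g (u ++ O ∷ O ∷ dbl 0 v) (u ++ O ∷ v)
        (colourings-2 u {O ∷ O ∷ dbl 0 v} {O ∷ v} (run-parallel v))
        (trans (chords-++ u _) (trans (+-suc _ _) (cong suc
          (trans (cong (λ m → chords u + suc m) (chords-dbl 0 v)) (sym (chords-++ u _))))))
    }

-- Weighted sums over primitive words

module PrimitiveWords where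

  open import Algebra.Bundles using (CommutativeRing)
  open import Algebra.Solver.Ring.AlmostCommutativeRing
    using (fromCommutativeRing; _-Raw-AlmostCommutative⟶_)
  import Algebra.Properties.CommutativeSemigroup as CommutativeSemigroupProperties
  import Algebra.Solver.Ring as RingSolver
  open import Data.Bool.Base using (Bool; true; false; if_then_else_)
  open import Data.List.Base using (List; []; _∷_; _++_; length; replicate)
  open import Data.List.Properties using (length-++; length-replicate; ++-assoc)
  open import Data.Maybe.Base using (Maybe; just; nothing)
  open import Data.Nat.Base as ℕ using (ℕ; zero; suc; _∸_; _≤_; _<_; z≤n; s≤s; pred)
  import Data.Nat.Properties as ℕ
  open import Data.Rational.Base as ℚ using (ℚ)
  import Data.Rational.Properties as ℚ
  open import Relation.Binary.PropositionalEquality as ≡ using (_≡_; _≢_)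
  open import Relation.Nullary using (yes; no)
  import Relation.Binary.Reasoning.Setoid as SetoidReasoning
  open ChordWords

  length-<-++ : ∀ {A : Set} (xs : List A) y ys → length xs < length (xs ++ y ∷ ys)
  length-<-++ []       y ys = s≤s z≤n
  length-<-++ (x ∷ xs) y ys = s≤s (length-<-++ xs y ys)

  module Words-in {c ℓ} (𝕊 : CommutativeRing c ℓ) where

    open CommutativeRing 𝕊
    open SetoidReasoning setoid
    private
      module +S = CommutativeSemigroupProperties +-commutativeSemigroup
      module *S = CommutativeSemigroupProperties *-commutativeSemigroup

    ∑< : ℕ → (ℕ → Carrier) → Carrier
    ∑< zero    g = 0#
    ∑< (suc n) g = g 0 + ∑< n (λ j → g (suc j))

    ∑<-cong : ∀ n {g h} → (∀ {j} → j < n → g j ≈ h j) → ∑< n g ≈ ∑< n h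
    ∑<-cong zero    g≈h = refl
    ∑<-cong (suc n) g≈h = +-cong (g≈h (s≤s z≤n)) (∑<-cong n λ j<n → g≈h (s≤s j<n))

    indicator : Bool → Carrier
    indicator b = if b then 1# else 0#

    Summand : Set c
    Summand = List Bool → Bool → List Bool → Carrier

    -- ∑ g fs is the sum of g xs f ys over all decompositions fs = xs ++ f ∷ ys
    ∑ : Summand → List Bool → Carrier
    ∑ g []       = 0#
    ∑ g (f ∷ fs) = g [] f fs + ∑ (λ xs → g (f ∷ xs)) fs

    ∑-cong : ∀ {g h} fs → (∀ xs f ys → xs ++ f ∷ ys ≡ fs → g xs f ys ≈ h xs f ys) → ∑ g fs ≈ ∑ h fs
    ∑-cong []       g≈h = refl
    ∑-cong (f ∷ fs) g≈h = +-cong (g≈h [] f fs ≡.refl)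
      (∑-cong fs λ xs f′ ys eq → g≈h (f ∷ xs) f′ ys (≡.cong (f ∷_) eq))

    ∑-+* : ∀ {g h k} a fs →
      (∀ xs f ys → xs ++ f ∷ ys ≡ fs → g xs f ys ≈ h xs f ys + a * k xs f ys) →
      ∑ g fs ≈ ∑ h fs + a * ∑ k fs
    ∑-+* a []       eq = sym (trans (+-identityˡ _) (zeroʳ a))
    ∑-+* {g} {h} {k} a (f ∷ fs) eq = begin
      g [] f fs + ∑ (λ xs → g (f ∷ xs)) fs
        ≈⟨ +-cong (eq [] f fs ≡.refl)
             (∑-+* a fs λ xs f′ ys e → eq (f ∷ xs) f′ ys (≡.cong (f ∷_) e)) ⟩
      (h [] f fs + a * k [] f fs) + (∑ (λ xs → h (f ∷ xs)) fs + a * ∑ (λ xs → k (f ∷ xs)) fs)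
        ≈⟨ +S.interchange _ _ _ _ ⟩
      ∑ h (f ∷ fs) + (a * k [] f fs + a * ∑ (λ xs → k (f ∷ xs)) fs)
        ≈⟨ +-congˡ (distribˡ a _ _) ⟨
      ∑ h (f ∷ fs) + a * ∑ k (f ∷ fs) ∎

    ∑-0 : ∀ {g} fs → (∀ xs f ys → g xs f ys ≈ 0#) → ∑ g fs ≈ 0#
    ∑-0 []       g≈0 = refl
    ∑-0 (f ∷ fs) g≈0 = trans (+-cong (g≈0 [] f fs) (∑-0 fs λ xs → g≈0 (f ∷ xs))) (+-identityˡ 0#)

    ∑-replicate : ∀ g h →
      ∑ g (replicate h false) ≈ ∑< h (λ j → g (replicate j false) false (replicate (h ∸ suc j) false))
    ∑-replicate g zero    = refl
    ∑-replicate g (suc h) = +-congˡ (∑-replicate (λ xs → g (false ∷ xs)) h)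

    module Weighted (o c₀ c₁ : Carrier) where

      before-close before-open : Mode → Carrier
      before-close closed = c₀
      before-close _      = 1#
      before-open  closed = c₁
      before-open  _      = 1#

      final : List Bool → Language → Carrier
      final []      φ = indicator (φ [])
      final (_ ∷ _) φ = 0#

      -- The weighted sum over the primitive words of fewer than N letters in φ.
      mutual
        J : ℕ → Language → List Bool → Mode → Maybe ℕ → Carrier
        J zero    φ fs μ fb = 0#
        J (suc N) φ fs μ fb =
          -- A closing letter at the end of the word is weighted as if another closing letter
          -- followed.
          before-close μ * final fs φ
            + (before-open μ * (o * J N (φ · O) (push μ fs) opened (just 0))
            + before-close μ * ∑ (close N φ fb) fs)

        closeAt : ℕ → Language → Maybe ℕ → ℕ → List Bool → Maybe ℕ → Carrier
        closeAt N φ fb j fs fb′ = if allowed fb j then J N (φ · C j) fs closed fb′ else 0#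

        close : ℕ → Language → Maybe ℕ → Summand
        close N φ fb xs f ys = closeAt N φ fb (length xs) (xs ++ lower ys) (forbid xs ys)

      J-cong : ∀ N {φ ψ} → (∀ w → φ w ≡ ψ w) → ∀ fs μ fb → J N φ fs μ fb ≈ J N ψ fs μ fb
      J-cong zero    φ≗ψ fs μ fb = refl
      J-cong (suc N) {φ} {ψ} φ≗ψ fs μ fb =
        +-cong (*-congˡ (final-cong fs))
          (+-cong (*-congˡ (*-congˡ (J-cong N (λ w → φ≗ψ (O ∷ w)) (push μ fs) opened (just 0))))
            (*-congˡ (∑-cong fs λ xs f ys _ → close-cong xs f ys)))
        where
        final-cong : ∀ fs → final fs φ ≈ final fs ψ
        final-cong []      = reflexive (≡.cong indicator (φ≗ψ []))
        final-cong (_ ∷ _) = refl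
        close-cong : ∀ xs f ys → close N φ fb xs f ys ≈ close N ψ fb xs f ys
        close-cong xs f ys with allowed fb (length xs)
        ... | true  = J-cong N (λ w → φ≗ψ (C (length xs) ∷ w)) (xs ++ lower ys) closed (forbid xs ys)
        ... | false = refl

      close-0 : ∀ φ fb xs f ys → close 0 φ fb xs f ys ≈ 0#
      close-0 φ fb xs f ys with allowed fb (length xs)
      ... | true  = refl
      ... | false = refl

      -- the recursion for a nonempty stack, with no exception for N = 0
      J-unfold : ∀ N {φ us f vs} μ fb → J N φ (us ++ f ∷ vs) μ fb ≈
        before-open μ * (o * J (pred N) (φ · O) (push μ (us ++ f ∷ vs)) opened (just 0))
          + before-close μ * ∑ (close (pred N) φ fb) (us ++ f ∷ vs)
      J-unfold zero {φ} {us} {f} {vs} μ fb = sym (begin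
        before-open μ * (o * 0#) + before-close μ * ∑ (close 0 φ fb) (us ++ f ∷ vs)
          ≈⟨ +-cong (trans (*-congˡ (zeroʳ o)) (zeroʳ _))
                    (trans (*-congˡ (∑-0 (us ++ f ∷ vs) (close-0 φ fb))) (zeroʳ _)) ⟩
        0# + 0#  ≈⟨ +-identityˡ 0# ⟩
        0#       ∎)
      J-unfold (suc N) {us = []}     μ fb = trans (+-congʳ (zeroʳ _)) (+-identityˡ _)
      J-unfold (suc N) {us = _ ∷ us} μ fb = trans (+-congʳ (zeroʳ _)) (+-identityˡ _)

      ∑-split : ∀ g us f vs → ∑ g (us ++ f ∷ vs) ≈
        ∑ (λ xs f′ ys → g xs f′ (ys ++ f ∷ vs)) us + (g us f vs + ∑ (λ xs → g (us ++ f ∷ xs)) vs)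
      ∑-split g []       f vs = sym (+-identityˡ _)
      ∑-split g (u ∷ us) f vs =
        trans (+-congˡ (∑-split (λ xs → g (u ∷ xs)) us f vs)) (sym (+-assoc _ _ _))

      close-at : ∀ {N φ fb} xs f ys {j} → length xs ≡ j → close N φ fb xs f ys ≡
        closeAt N φ fb j (xs ++ lower ys) (if topFlag ys then just j else nothing)
      close-at xs f ys ≡.refl = ≡.refl

      closeAt-other : ∀ N φ {i j} fs fb → i ≢ j →
        closeAt N φ (just i) j fs fb ≡ closeAt N φ nothing j fs fb
      closeAt-other N φ fs fb i≢j rewrite ≢⇒≡ᵇ-false i≢j = ≡.refl

      closeAt-forbidden : ∀ N φ j fs fb → closeAt N φ (just j) j fs fb ≡ 0#
      closeAt-forbidden N φ j fs fb rewrite ≡ᵇ-refl j = ≡.refl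

      -- lifting the ban on one closing letter adds the words that start with it
      J-forbid : ∀ N φ us f vs μ → J N φ (us ++ f ∷ vs) μ nothing ≈
        J N φ (us ++ f ∷ vs) μ (just (length us))
          + before-close μ * J (pred N) (φ · C (length us)) (us ++ lower vs) closed (forbid us vs)
      J-forbid N φ us f vs μ = begin
        J N φ (us ++ f ∷ vs) μ nothing
          ≈⟨ J-unfold N {us = us} μ nothing ⟩
        opens + before-close μ * ∑ (close (pred N) φ nothing) (us ++ f ∷ vs)
          ≈⟨ +-congˡ (*-congˡ (∑-split (close (pred N) φ nothing) us f vs)) ⟩
        opens + before-close μ * (leftSum nothing + (banned + rightSum nothing))
          ≈⟨ +-congˡ (*-congˡ (+-cong left≈ (+-congˡ right≈))) ⟩
        opens + before-close μ * (leftSum (just i) + (banned + rightSum (just i)))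
          ≈⟨ +-congˡ (trans (*-congˡ (+S.x∙yz≈xz∙y _ _ _)) (distribˡ _ _ _)) ⟩
        opens + (before-close μ * (leftSum (just i) + rightSum (just i)) + before-close μ * banned)
          ≈⟨ +-assoc _ _ _ ⟨
        opens + before-close μ * (leftSum (just i) + rightSum (just i)) + before-close μ * banned
          ≈⟨ +-congʳ (+-congˡ (*-congˡ (+-congˡ (trans (+-congʳ
               (reflexive (closeAt-forbidden (pred N) φ i (us ++ lower vs) (forbid us vs)))) (+-identityˡ _))))) ⟨
        opens + before-close μ * (leftSum (just i) +
          (close (pred N) φ (just i) us f vs + rightSum (just i))) + before-close μ * banned
          ≈⟨ +-congʳ (+-congˡ (*-congˡ (∑-split (close (pred N) φ (just i)) us f vs))) ⟨
        opens + before-close μ * ∑ (close (pred N) φ (just i)) (us ++ f ∷ vs) + before-close μ * banned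
          ≈⟨ +-congʳ (J-unfold N {us = us} μ (just i)) ⟨
        J N φ (us ++ f ∷ vs) μ (just i) + before-close μ * banned ∎
        where
        i = length us
        opens = before-open μ * (o * J (pred N) (φ · O) (push μ (us ++ f ∷ vs)) opened (just 0))
        banned = J (pred N) (φ · C i) (us ++ lower vs) closed (forbid us vs)
        leftSum rightSum : Maybe ℕ → Carrier
        leftSum fb = ∑ (λ xs f′ ys → close (pred N) φ fb xs f′ (ys ++ f ∷ vs)) us
        rightSum fb = ∑ (λ xs → close (pred N) φ fb (us ++ f ∷ xs)) vs
        left≈ : leftSum nothing ≈ leftSum (just i)
        left≈ = ∑-cong us λ { xs f′ ys ≡.refl → sym (reflexive
          (closeAt-other (pred N) φ _ _ λ eq → ℕ.<⇒≢ (length-<-++ xs f′ ys) (≡.sym eq))) }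
        right≈ : rightSum nothing ≈ rightSum (just i)
        right≈ = ∑-cong vs λ xs f′ ys _ → sym (reflexive
          (closeAt-other (pred N) φ _ _ (ℕ.<⇒≢ (length-<-++ us f xs))))

      -- The words in which the upper arc of a parallel pair is closed immediately
      -- before the lower one correspond to the words with a single arc in place of
      -- the pair.
      J-double : ∀ N {φ φ′} us f vs μ {fb fb′} →
        Doubled (length us) φ φ′ → Shifted (length us) fb fb′ →
        J N φ (us ++ f ∷ false ∷ vs) μ fb ≈
          J N φ (us ++ f ∷ true ∷ vs) μ fb + c₀ * J (pred N) φ′ (us ++ f ∷ vs) μ fb′
      J-double zero    us f vs μ d sh = sym (trans (+-identityˡ _) (zeroʳ c₀))
      J-double (suc N) {φ} {φ′} us f vs μ {fb} {fb′} d sh = begin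
        J (suc N) φ (us ++ f ∷ false ∷ vs) μ fb
          ≈⟨ J-unfold (suc N) {us = us} μ fb ⟩
        bo * (o * opens false) + bc * ∑ (close N φ fb) (us ++ f ∷ false ∷ vs)
          ≈⟨ +-cong (*-congˡ (*-congˡ opens-double)) (*-congˡ closes-double) ⟩
        bo * (o * (opens true + c₀ * base-opens))
          + bc * (∑ (close N φ fb) (us ++ f ∷ true ∷ vs) + c₀ * base-closes)
          ≈⟨ +-cong (trans (*-congˡ (distribˡ _ _ _)) (distribˡ _ _ _)) (distribˡ _ _ _) ⟩
        (bo * (o * opens true) + bo * (o * (c₀ * base-opens)))
          + (bc * ∑ (close N φ fb) (us ++ f ∷ true ∷ vs) + bc * (c₀ * base-closes))
          ≈⟨ +S.interchange _ _ _ _ ⟩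
        (bo * (o * opens true) + bc * ∑ (close N φ fb) (us ++ f ∷ true ∷ vs))
          + (bo * (o * (c₀ * base-opens)) + bc * (c₀ * base-closes))
          ≈⟨ +-cong (J-unfold (suc N) {us = us} μ fb) (trans (distribˡ c₀ _ _)
               (+-cong (trans (*S.x∙yz≈y∙xz c₀ bo _) (*-congˡ (*S.x∙yz≈y∙xz c₀ o _))) (*S.x∙yz≈y∙xz c₀ bc _))) ⟨
        J (suc N) φ (us ++ f ∷ true ∷ vs) μ fb + c₀ * (bo * (o * base-opens) + bc * base-closes)
          ≈⟨ +-congˡ (*-congˡ (J-unfold N {us = us} μ fb′)) ⟨
        J (suc N) φ (us ++ f ∷ true ∷ vs) μ fb + c₀ * J N φ′ (us ++ f ∷ vs) μ fb′ ∎
        where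
        bo = before-open μ
        bc = before-close μ
        opens : Bool → Carrier
        opens b = J N (φ · O) (push μ (us ++ f ∷ b ∷ vs)) opened (just 0)
        base-opens = J (pred N) (φ′ · O) (push μ (us ++ f ∷ vs)) opened (just 0)
        base-closes = ∑ (close (pred N) φ′ fb′) (us ++ f ∷ vs)

        pushed : ∀ us′ {f′} → length us′ ≡ suc (length us) →
          J N (φ · O) (us′ ++ f′ ∷ false ∷ vs) opened (just 0) ≈
            J N (φ · O) (us′ ++ f′ ∷ true ∷ vs) opened (just 0)
              + c₀ * J (pred N) (φ′ · O) (us′ ++ f′ ∷ vs) opened (just 0)
        pushed us′ {f′} eq = J-double N us′ f′ vs opened
          (≡.subst (λ i → Doubled i (φ · O) (φ′ · O)) (≡.sym eq) (λ v → d (O ∷ v))) (upto z≤n)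

        opens-double : opens false ≈ opens true + c₀ * base-opens
        opens-double = go us μ ≡.refl
          where
          -- In mode `opened`, `push` overwrites the top flag. If the stack above the pair is empty,
          -- this is the flag `f` of the upper copy; the flag of the lower copy is never touched.
          go : ∀ us₁ μ → length us₁ ≡ length us →
            J N (φ · O) (push μ (us₁ ++ f ∷ false ∷ vs)) opened (just 0) ≈
              J N (φ · O) (push μ (us₁ ++ f ∷ true ∷ vs)) opened (just 0)
                + c₀ * J (pred N) (φ′ · O) (push μ (us₁ ++ f ∷ vs)) opened (just 0)
          go []       initial  eq = pushed (false ∷ []) (≡.cong suc eq)
          go []       opened eq = pushed (false ∷ []) (≡.cong suc eq)
          go []       closed eq = pushed (false ∷ []) (≡.cong suc eq)
          go (u ∷ us) initial  eq = pushed (false ∷ u ∷ us) (≡.cong suc eq)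
          go (u ∷ us) opened eq = pushed (false ∷ true ∷ us) (≡.cong suc eq)
          go (u ∷ us) closed eq = pushed (false ∷ u ∷ us) (≡.cong suc eq)

        closeAt-double : ∀ {j j′ fs₀ fs₁ fs′ fb₂ fb₂′} us′ f′ vs′ →
          allowed fb j ≡ allowed fb′ j′ → Doubled (length us′) (φ · C j) (φ′ · C j′) →
          Shifted (length us′) fb₂ fb₂′ →
          fs₀ ≡ us′ ++ f′ ∷ false ∷ vs′ → fs₁ ≡ us′ ++ f′ ∷ true ∷ vs′ → fs′ ≡ us′ ++ f′ ∷ vs′ →
          closeAt N φ fb j fs₀ fb₂ ≈ closeAt N φ fb j fs₁ fb₂ + c₀ * closeAt (pred N) φ′ fb′ j′ fs′ fb₂′
        closeAt-double {j} {j′} us′ f′ vs′ al d′ sh′ ≡.refl ≡.refl ≡.refl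
          with allowed fb j | allowed fb′ j′ | al
        ... | true  | .true  | ≡.refl = J-double N us′ f′ vs′ closed d′ sh′
        ... | false | .false | ≡.refl = sym (trans (+-identityˡ _) (zeroʳ c₀))

        close-left : ∀ xs f₁ ys → xs ++ f₁ ∷ ys ≡ us →
          close N φ fb xs f₁ (ys ++ f ∷ false ∷ vs) ≈ close N φ fb xs f₁ (ys ++ f ∷ true ∷ vs)
            + c₀ * close (pred N) φ′ fb′ xs f₁ (ys ++ f ∷ vs)
        -- The closed arc lies directly above the upper copy, whose own flag is therefore cleared.
        close-left xs f₁ [] ≡.refl = closeAt-double xs false vs (allowed-≤ sh (ℕ.<⇒≤ j<i))
          (λ v → ≡.trans (≡.cong φ (≡.sym (≡.trans (dbl-< v j<i) (≡.cong (λ i → C j ∷ dbl i v) (≡.cong pred len))))) (d (C j ∷ v)))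
          (shifted f) ≡.refl ≡.refl ≡.refl
          where
          j = length xs
          j<i = length-<-++ xs f₁ []
          len : length (xs ++ f₁ ∷ []) ≡ suc j
          len = ≡.trans (length-++ xs) (ℕ.+-comm j 1)
          shifted : ∀ f → Shifted j (if f then just j else nothing) (if f then just j else nothing)
          shifted true  = upto ℕ.≤-refl
          shifted false = nowhere
        close-left xs f₁ (g ∷ ys) ≡.refl = closeAt-double (xs ++ false ∷ ys) f vs (allowed-≤ sh (ℕ.<⇒≤ j<i))
          (λ v → ≡.trans (≡.cong φ (≡.sym (≡.trans (dbl-< v j<i) (≡.cong (λ i → C j ∷ dbl i v) (≡.cong pred len))))) (d (C j ∷ v)))
          (shifted g) (≡.sym (++-assoc xs _ _)) (≡.sym (++-assoc xs _ _)) (≡.sym (++-assoc xs _ _))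
          where
          j = length xs
          j<i = length-<-++ xs f₁ (g ∷ ys)
          len : length (xs ++ f₁ ∷ g ∷ ys) ≡ suc (length (xs ++ false ∷ ys))
          len = ≡.trans (length-++ xs) (≡.trans (ℕ.+-suc j _) (≡.cong suc (≡.sym (length-++ xs))))
          shifted : ∀ f → Shifted (length (xs ++ false ∷ ys))
            (if f then just j else nothing) (if f then just j else nothing)
          shifted true  = upto (ℕ.<⇒≤ (length-<-++ xs false ys))
          shifted false = nowhere

        -- Only here do the two flags of the lower copy make a difference: with `true` this copy
        -- must not be closed next. By `J-forbid` the difference consists of the words that do close
        -- it next, and `before-close closed`, which is `c₀`, is the weight of the first of the two
        -- closing letters.
        close-upper : close N φ fb us f (false ∷ vs) ≈
          close N φ fb us f (true ∷ vs) + c₀ * close (pred N) φ′ fb′ us f vs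
        close-upper with allowed fb (length us) | allowed fb′ (length us) | allowed-≤ sh (ℕ.≤-refl {length us})
        ... | false | .false | ≡.refl = sym (trans (+-identityˡ _) (zeroʳ c₀))
        ... | true  | .true  | ≡.refl = trans (J-forbid N (φ · C (length us)) us false vs closed)
          (+-congˡ (*-congˡ (J-cong (pred N)
            (λ v → ≡.trans (≡.cong φ (≡.sym (dbl-≡ (length us) v))) (d (C (length us) ∷ v)))
            (us ++ lower vs) closed (forbid us vs))))

        close-right : ∀ xs f₁ ys → close N φ fb (us ++ f ∷ false ∷ xs) f₁ ys ≈
          close N φ fb (us ++ f ∷ true ∷ xs) f₁ ys + c₀ * close (pred N) φ′ fb′ (us ++ f ∷ xs) f₁ ys
        close-right xs f₁ ys = trans (reflexive (close-at {N} {φ} {fb} xs₀ f₁ ys len₀)) (trans (closeAt-double us f (xs ++ lower ys)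
          (allowed-> sh i<j) (λ v → ≡.trans (≡.cong φ (≡.sym (dbl-> v i<j))) (d (C j ∷ v)))
          (shifted (topFlag ys)) (++-assoc us (f ∷ false ∷ xs) _) (++-assoc us (f ∷ true ∷ xs) _) (++-assoc us (f ∷ xs) _))
          (+-congʳ (sym (reflexive (close-at {N} {φ} {fb} (us ++ f ∷ true ∷ xs) f₁ ys (len true))))))
          where
          j = length (us ++ f ∷ xs)
          xs₀ = us ++ f ∷ false ∷ xs
          i<j = length-<-++ us f xs
          len : ∀ b → length (us ++ f ∷ b ∷ xs) ≡ suc j
          len₀ = len false
          len b = ≡.trans (length-++ us) (≡.trans (ℕ.+-suc (length us) _) (≡.cong suc (≡.sym (length-++ us))))
          shifted : ∀ f → Shifted (length us) (if f then just (suc j) else nothing) (if f then just j else nothing)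
          shifted true  = beyond i<j
          shifted false = nowhere

        closes-double : ∑ (close N φ fb) (us ++ f ∷ false ∷ vs) ≈
          ∑ (close N φ fb) (us ++ f ∷ true ∷ vs) + c₀ * base-closes
        closes-double = begin
          ∑ (close N φ fb) (us ++ f ∷ false ∷ vs)
            ≈⟨ ∑-split (close N φ fb) us f (false ∷ vs) ⟩
          left false + (close N φ fb us f (false ∷ vs) + (close N φ fb (us ++ f ∷ []) false vs + right false))
            -- Closing the lower copy before the upper one contributes the same term on both sides,
            -- because the flag of the arc being closed is not inspected.
            ≈⟨ +-cong (∑-+* c₀ us close-left)
                 (+-cong close-upper (+-congˡ (∑-+* c₀ vs λ xs f₁ ys _ → close-right xs f₁ ys))) ⟩
          (left true + c₀ * left′) + ((close N φ fb us f (true ∷ vs) + c₀ * close (pred N) φ′ fb′ us f vs)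
            + (close N φ fb (us ++ f ∷ []) true vs + (right true + c₀ * right′)))
            ≈⟨ +-congˡ (trans (+-congˡ (sym (+-assoc _ _ _))) (+S.interchange _ _ _ _)) ⟩
          (left true + c₀ * left′) + ((close N φ fb us f (true ∷ vs) + (close N φ fb (us ++ f ∷ []) true vs + right true))
            + (c₀ * close (pred N) φ′ fb′ us f vs + c₀ * right′))
            ≈⟨ +S.interchange _ _ _ _ ⟩
          (left true + (close N φ fb us f (true ∷ vs) + (close N φ fb (us ++ f ∷ []) true vs + right true)))
            + (c₀ * left′ + (c₀ * close (pred N) φ′ fb′ us f vs + c₀ * right′))
            ≈⟨ +-cong (∑-split (close N φ fb) us f (true ∷ vs))
                 (trans (distribˡ c₀ _ _) (+-congˡ (distribˡ c₀ _ _))) ⟨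
          ∑ (close N φ fb) (us ++ f ∷ true ∷ vs)
            + c₀ * (left′ + (close (pred N) φ′ fb′ us f vs + right′))
            ≈⟨ +-congˡ (*-congˡ (∑-split (close (pred N) φ′ fb′) us f vs)) ⟨
          ∑ (close N φ fb) (us ++ f ∷ true ∷ vs) + c₀ * base-closes ∎
          where
          left right : Bool → Carrier
          left b = ∑ (λ xs f′ ys → close N φ fb xs f′ (ys ++ f ∷ b ∷ vs)) us
          right b = ∑ (λ xs → close N φ fb (us ++ f ∷ b ∷ xs)) vs
          left′ = ∑ (λ xs f′ ys → close (pred N) φ′ fb′ xs f′ (ys ++ f ∷ vs)) us
          right′ = ∑ (λ xs → close (pred N) φ′ fb′ (us ++ f ∷ xs)) vs

      -- Raising the bound only adds the words of exactly `N` letters, and `φ` rejects these.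
      J-stable : ∀ N {φ fs μ fb} → (∀ {w} → Primitive fs μ fb w → N ≤ length w → φ w ≡ false) →
        J (suc N) φ fs μ fb ≈ J N φ fs μ fb
      J-stable zero {φ} {fs} {μ} {fb} rejects = begin
        before-close μ * final fs φ
          + (before-open μ * (o * 0#) + before-close μ * ∑ (close 0 φ fb) fs)
          ≈⟨ +-cong (*-congˡ (final-0 fs rejects)) (+-cong (*-congˡ (zeroʳ o)) (*-congˡ (∑-0 fs (close-0 φ fb)))) ⟩
        before-close μ * 0# + (before-open μ * 0# + before-close μ * 0#)
          ≈⟨ +-cong (zeroʳ _) (trans (+-cong (zeroʳ _) (zeroʳ _)) (+-identityˡ 0#)) ⟩
        0# + 0#
          ≈⟨ +-identityˡ 0# ⟩
        0# ∎
        where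
        final-0 : ∀ fs → (∀ {w} → Primitive fs μ fb w → 0 ≤ length w → φ w ≡ false) → final fs φ ≈ 0#
        final-0 []      rejects = reflexive (≡.cong (if_then 1# else 0#) (rejects ending z≤n))
        final-0 (_ ∷ _) rejects = refl
      J-stable (suc N) {φ} {fs} {μ} {fb} rejects = +-congˡ (+-cong
        (*-congˡ (*-congˡ (J-stable N λ pr N≤ → rejects (opening pr) (s≤s N≤))))
        (*-congˡ (∑-cong fs λ { xs f ys ≡.refl → stable xs f ys rejects })))
        where
        stable : ∀ xs f ys → (∀ {w} → Primitive (xs ++ f ∷ ys) μ fb w → suc N ≤ length w → φ w ≡ false) →
          close (suc N) φ fb xs f ys ≈ close N φ fb xs f ys
        stable xs f ys rejects with allowed fb (length xs) in al
        ... | true  = J-stable N λ pr N≤ → rejects (closing xs f ys al pr) (s≤s N≤)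
        ... | false = refl

      J-stable-≥ : ∀ {N M φ fs μ fb} → N ≤ M → (∀ {w} → Primitive fs μ fb w → N ≤ length w → φ w ≡ false) →
        J M φ fs μ fb ≈ J N φ fs μ fb
      J-stable-≥ {N} {M} N≤M rejects with ℕ.≤⇒≤′ N≤M
      ... | ℕ.≤′-refl = refl
      ... | ℕ.≤′-step {M} N≤′M = trans
        (J-stable M λ pr M≤ → rejects pr (ℕ.≤-trans (ℕ.≤′⇒≤ N≤′M) M≤))
        (J-stable-≥ (ℕ.≤′⇒≤ N≤′M) rejects)

      unflagged : ℕ → List Bool
      unflagged h = replicate h false

      ∑-unflagged : ∀ g h {t} → (∀ j k → j ℕ.+ suc k ≡ h → g (unflagged j) false (unflagged k) ≈ t j) →
        ∑ g (unflagged h) ≈ ∑< h t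
      ∑-unflagged g h g≈t = trans (∑-replicate g h) (∑<-cong h λ {j} j<h →
        g≈t j (h ∸ suc j) (≡.trans (ℕ.+-suc j _) (ℕ.m+[n∸m]≡n j<h)))

      unflagged-lower : ∀ j k → unflagged j ++ lower (unflagged k) ≡ unflagged (j ℕ.+ k)
      unflagged-lower zero    zero    = ≡.refl
      unflagged-lower zero    (suc k) = ≡.refl
      unflagged-lower (suc j) k       = ≡.cong (false ∷_) (unflagged-lower j k)

      top-unflagged : ∀ k → topFlag (unflagged k) ≡ false
      top-unflagged zero    = ≡.refl
      top-unflagged (suc k) = ≡.refl

      J-close : ∀ N φ h → ∑ (close N φ nothing) (unflagged h) ≈
        ∑< h (λ j → J N (φ · C j) (unflagged (pred h)) closed nothing)
      J-close N φ h = ∑-unflagged (close N φ nothing) h λ { j k ≡.refl → term j k }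
        where
        term : ∀ j k → close N φ nothing (unflagged j) false (unflagged k) ≈
          J N (φ · C j) (unflagged (pred (j ℕ.+ suc k))) closed nothing
        term j k rewrite length-replicate j {false} | top-unflagged k | unflagged-lower j k | ℕ.+-suc j k = refl

      J-close-opened : ∀ N φ h → ∑ (close N φ (just 0)) (unflagged (suc h)) ≈
        ∑< h (λ j → J N (φ · C (suc j)) (unflagged h) closed nothing)
      -- The ban on place 0 has turned the first summand into zero.
      J-close-opened N φ h = trans (+-identityˡ _)
        (∑-unflagged (λ xs → close N φ (just 0) (false ∷ xs)) h λ { j k ≡.refl → term j k })
        where
        term : ∀ j k → close N φ (just 0) (false ∷ unflagged j) false (unflagged k) ≈
          J N (φ · C (suc j)) (unflagged (j ℕ.+ suc k)) closed nothing
        term j k rewrite length-replicate j {false} | top-unflagged k | unflagged-lower j k | ℕ.+-suc j k = refl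

  -- The common recursion of the path series and the primitive sums

  module Comparison {c ℓ} (𝕊 : CommutativeRing c ℓ)
    (con-hom : CommutativeRing.rawRing ℚ.+-*-commutativeRing
                 -Raw-AlmostCommutative⟶ fromCommutativeRing 𝕊)
    where

    open CommutativeRing 𝕊
    open Words-in 𝕊
    open SetoidReasoning setoid
    open _-Raw-AlmostCommutative⟶_ con-hom using () renaming (⟦_⟧ to con)

    private
      con-≟ : ∀ p q → Maybe (con p ≈ con q)
      con-≟ p q with p ℚ.≟ q
      ... | yes ≡.refl = just refl
      ... | no _       = nothing

    module Solver = RingSolver (CommutativeRing.rawRing ℚ.+-*-commutativeRing)
      (fromCommutativeRing 𝕊) con-hom con-≟
    open Solver using (solve; _:=_; _:+_; _:*_; :-_)

    module System (x y R S o : Carrier)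
      (R-unfold : R ≈ x * (R * R + R * y + R + y))
      (S-* : ∀ f → S * f ≈ f + - (x * f + x * y * f + (x * R * f + x * R * f)))
      (o*S≈x : o * S ≈ x)
      (A : ℕ → Language → Carrier) where

      open Weighted o R (R + 1#)

      -- The counterparts of the weighted primitive sums in the modes `initial`, `opened` and
      -- `closed`. In `fromClosed`, the point that ends an arc either completes its block, whence
      -- the factor `y`, or starts the next arc of the block. The form of `fromOpened` is dictated
      -- by the recursion for `fromStart`, since `o * S` is `x`.
      fromStart fromOpened fromClosed : ℕ → Language → Carrier
      fromStart h φ = A h φ + - (x * (R + y) * A h φ)
      fromOpened h φ = S * (A (suc h) (φ · O) + - (R * A h φ))
      fromClosed h φ = x * (y * A h φ + A (suc h) (φ · O))

      -- The equation `R = x (R + 1) (R + y)` is equivalent to `(R + 1) (1 - x (R + y)) = 1`.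
      A≈fromStart : ∀ h φ → A h φ ≈ (R + 1#) * fromStart h φ
      A≈fromStart h φ = sym (begin
        (R + 1#) * fromStart h φ          ≈⟨ trans (distribʳ _ R 1#) (+-congˡ (*-identityˡ _)) ⟩
        R * fromStart h φ + fromStart h φ         ≈⟨ +-congʳ (trans (distribˡ R _ _) (+-congʳ (*-congʳ R-unfold))) ⟩
        (x * (R * R + R * y + R + y) * A h φ + R * - (x * (R + y) * A h φ)) + fromStart h φ
          ≈⟨ solve 4 (λ x y r a →
               (x :* (r :* r :+ r :* y :+ r :+ y) :* a :+ r :* :- (x :* (r :+ y) :* a)) :+ (a :+ :- (x :* (r :+ y) :* a))
                 := a) refl x y R (A h φ) ⟩
        A h φ ∎)

      module Unfold
        -- The summands distinguish by the next point: there is none, it is a singleton, it is the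
        -- first point of a block, or it ends the arc at place `j`.
        (A-unfold : ∀ h φ → Reducible φ → A h φ ≈ final (unflagged h) φ +
          (x * (y * A h φ) + (x * A (suc h) (φ · O) + ∑< h (λ j → fromClosed (pred h) (φ · C j))))) where

        o*fromOpened : ∀ h φ → o * fromOpened h φ ≈ x * (A (suc h) (φ · O) + - (R * A h φ))
        o*fromOpened h φ = trans (sym (*-assoc o S _)) (*-congʳ o*S≈x)

        -- Subtracting `x (R + y) A` cancels the term for singletons and completes the opening term
        -- to `o * fromOpened`.
        fromStart-unfold : ∀ h φ → Reducible φ → fromStart h φ ≈ final (unflagged h) φ +
          (o * fromOpened h φ + ∑< h (λ j → fromClosed (pred h) (φ · C j)))
        fromStart-unfold h φ r = begin
          A h φ + - (x * (R + y) * A h φ)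
            ≈⟨ +-congʳ (A-unfold h φ r) ⟩
          (d + (x * (y * A h φ) + (x * A (suc h) (φ · O) + s))) + - (x * (R + y) * A h φ)
            ≈⟨ solve 7 (λ x y r a b d s →
                 (d :+ (x :* (y :* a) :+ (x :* b :+ s))) :+ :- (x :* (r :+ y) :* a)
                   := d :+ (x :* (b :+ :- (r :* a)) :+ s)) refl x y R (A h φ) (A (suc h) (φ · O)) d s ⟩
          d + (x * (A (suc h) (φ · O) + - (R * A h φ)) + s)
            ≈⟨ +-congˡ (+-congʳ (o*fromOpened h φ)) ⟨
          d + (o * fromOpened h φ + s) ∎
          where
          d = final (unflagged h) φ
          s = ∑< h (λ j → fromClosed (pred h) (φ · C j))

        -- In fact `fromClosed = R * fromStart + o * fromOpened`, because `R (1 - x (R + y)) = x (R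
        -- + y)` by the equation for `R`.
        fromClosed-unfold : ∀ h φ → Reducible φ → fromClosed h φ ≈ R * final (unflagged h) φ +
          ((R + 1#) * (o * fromOpened h φ) + R * ∑< h (λ j → fromClosed (pred h) (φ · C j)))
        fromClosed-unfold h φ r = sym (begin
          R * d + ((R + 1#) * (o * fromOpened h φ) + R * s)
            ≈⟨ +-congˡ (+-congʳ (trans (distribʳ _ R 1#) (+-congˡ (*-identityˡ _)))) ⟩
          R * d + (R * (o * fromOpened h φ) + o * fromOpened h φ + R * s)
            ≈⟨ solve 4 (λ r d l s → r :* d :+ (r :* l :+ l :+ r :* s) := r :* (d :+ (l :+ s)) :+ l)
                 refl R d (o * fromOpened h φ) s ⟩
          R * (d + (o * fromOpened h φ + s)) + o * fromOpened h φ
            ≈⟨ +-cong (*-congˡ (sym (fromStart-unfold h φ r))) (o*fromOpened h φ) ⟩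
          R * fromStart h φ + x * (A (suc h) (φ · O) + - (R * A h φ))
            ≈⟨ +-congʳ (trans (distribˡ R _ _) (+-congʳ (*-congʳ R-unfold))) ⟩
          (x * (R * R + R * y + R + y) * A h φ + R * - (x * (R + y) * A h φ))
            + x * (A (suc h) (φ · O) + - (R * A h φ))
            ≈⟨ solve 5 (λ x y r a b →
                 (x :* (r :* r :+ r :* y :+ r :+ y) :* a :+ r :* :- (x :* (r :+ y) :* a)) :+ x :* (b :+ :- (r :* a))
                   := x :* (y :* a :+ b)) refl x y R (A h φ) (A (suc h) (φ · O)) ⟩
          fromClosed h φ ∎)
          where
          d = final (unflagged h) φ
          s = ∑< h (λ j → fromClosed (pred h) (φ · C j))

        -- This is `fromStart-unfold` for `φ · O`, whose final term vanishes because an arc is open.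
        -- The two subtracted terms correspond to the exclusion of a parallel pair and of a short
        -- arc among the primitive words.
        fromOpened-unfold : ∀ h φ → Reducible φ → fromOpened h φ ≈ o * (fromOpened (suc h) (φ · O) + - (R * fromOpened h φ)) +
          (∑< (suc h) (λ j → fromClosed h (φ · O · C j)) + - fromClosed h φ)
        fromOpened-unfold h φ r = sym (begin
          o * (l′ + - (R * l)) + (s + - k)
            ≈⟨ solve 6 (λ o r l l′ s k → o :* (l′ :+ :- (r :* l)) :+ (s :+ :- k)
                 := (o :* l′ :+ s) :+ (:- (r :* (o :* l)) :+ :- k)) refl o R l l′ s k ⟩
          (o * l′ + s) + (- (R * (o * l)) + - k)
            ≈⟨ +-cong (trans (sym (+-identityˡ _)) (sym (fromStart-unfold (suc h) (φ · O) (Reducible-· O r))))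
                 (+-congʳ (-‿cong (*-congˡ (o*fromOpened h φ)))) ⟩
          (b + - (x * (R + y) * b)) + (- (R * (x * (b + - (R * a)))) + - (x * (y * a + b)))
            ≈⟨ solve 5 (λ x y r a b →
                 let f = b :+ :- (r :* a) in
                 (b :+ :- (x :* (r :+ y) :* b)) :+ (:- (r :* (x :* f)) :+ :- (x :* (y :* a :+ b)))
                   := (b :+ :- (x :* (r :* r :+ r :* y :+ r :+ y) :* a))
                        :+ :- (x :* f :+ x :* y :* f :+ (x :* r :* f :+ x :* r :* f))) refl x y R a b ⟩
          (b + - (x * (R * R + R * y + R + y) * a)) + - (x * f + x * y * f + (x * R * f + x * R * f))
            ≈⟨ +-congʳ (+-congˡ (-‿cong (*-congʳ R-unfold))) ⟨
          f + - (x * f + x * y * f + (x * R * f + x * R * f))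
            ≈⟨ S-* f ⟨
          l ∎)
          where
          a = A h φ
          b = A (suc h) (φ · O)
          f = b + - (R * a)
          l = fromOpened h φ
          l′ = fromOpened (suc h) (φ · O)
          s = ∑< (suc h) (λ j → fromClosed h (φ · O · C j))
          k = fromClosed h φ

        module Approximation
          (_≈[_]_ : Carrier → ℕ → Carrier → Set ℓ)
          (≈⇒≈[] : ∀ {a f g} → f ≈ g → f ≈[ a ] g)
          (≈[]-trans : ∀ {a f g h} → f ≈[ a ] g → g ≈[ a ] h → f ≈[ a ] h)
          (≈[0] : ∀ f g → f ≈[ 0 ] g)
          (≈[]-+ : ∀ {a f f′ g g′} → f ≈[ a ] f′ → g ≈[ a ] g′ → (f + g) ≈[ a ] (f′ + g′))
          (≈[]-* : ∀ {a f f′} g → f ≈[ a ] f′ → (g * f) ≈[ a ] (g * f′))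
          (≈[]-neg : ∀ {a f f′} → f ≈[ a ] f′ → (- f) ≈[ a ] (- f′))
          -- Divisibility of `o` by `x`, when the relation is read as congruence modulo powers of
          -- `x`.
          (≈[]-o : ∀ {a f f′} → f ≈[ a ] f′ → (o * f) ≈[ suc a ] (o * f′)) where

          fromStartₙ fromOpenedₙ fromClosedₙ : ℕ → ℕ → Language → Carrier
          fromStartₙ N h φ = J N φ (unflagged h) initial nothing
          fromOpenedₙ N h φ = J N (φ · O) (unflagged (suc h)) opened (just 0)
          fromClosedₙ N h φ = J N φ (unflagged h) closed nothing

          fromStartₙ-unfold : ∀ N h φ → fromStartₙ (suc N) h φ ≈ final (unflagged h) φ +
            (o * fromOpenedₙ N h φ + ∑< h (λ j → fromClosedₙ N (pred h) (φ · C j)))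
          fromStartₙ-unfold N h φ = +-cong (*-identityˡ _) (+-cong (*-identityˡ _) (trans (*-identityˡ _) (J-close N φ h)))

          fromClosedₙ-unfold : ∀ N h φ → fromClosedₙ (suc N) h φ ≈ R * final (unflagged h) φ +
            ((R + 1#) * (o * fromOpenedₙ N h φ) + R * ∑< h (λ j → fromClosedₙ N (pred h) (φ · C j)))
          fromClosedₙ-unfold N h φ = +-congˡ (+-cong (*-congˡ (*-congˡ (reflexive ≡.refl))) (*-congˡ (J-close N φ h)))

          -- A second opening letter creates a flagged pair. By `J-double` and invariance under
          -- `parallel`, the flagged sum is the unflagged one minus `R` times the sum for a single
          -- arc. The sum over closing letters lacks `j = 0`, which by invariance under `short` is
          -- `fromClosedₙ` for `φ` itself.
          fromOpenedₙ-unfold : ∀ N h φ → Reducible φ → fromOpenedₙ (suc N) h φ ≈ o * (fromOpenedₙ N (suc h) (φ · O) + - (R * fromOpenedₙ (pred N) h φ)) +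
            (∑< (suc h) (λ j → fromClosedₙ N h (φ · O · C j)) + - fromClosedₙ N h φ)
          fromOpenedₙ-unfold N h φ r = begin
            1# * 0# + (1# * (o * flagged) + 1# * ∑ (close N (φ · O) (just 0)) (unflagged (suc h)))
              ≈⟨ +-cong (zeroʳ _) (+-cong (*-identityˡ _) (*-identityˡ _)) ⟩
            0# + (o * flagged + ∑ (close N (φ · O) (just 0)) (unflagged (suc h)))
              ≈⟨ +-identityˡ _ ⟩
            o * flagged + ∑ (close N (φ · O) (just 0)) (unflagged (suc h))
              ≈⟨ +-congˡ (J-close-opened N (φ · O) h) ⟩
            o * flagged + s
              ≈⟨ solve 5 (λ o f e s k → o :* f :+ s := o :* ((f :+ e) :+ :- e) :+ ((k :+ s) :+ :- k))
                   refl o flagged (R * fromOpenedₙ (pred N) h φ) s (fromClosedₙ N h φ) ⟩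
            o * (flagged + R * fromOpenedₙ (pred N) h φ + - (R * fromOpenedₙ (pred N) h φ)) + (fromClosedₙ N h φ + s + - fromClosedₙ N h φ)
              ≈⟨ +-cong (*-congˡ (+-congʳ (J-double N [] false (unflagged h) opened (parallel r []) (upto z≤n))))
                   (+-congʳ (+-congʳ (J-cong N (short r []) (unflagged h) closed nothing))) ⟨
            o * (fromOpenedₙ N (suc h) (φ · O) + - (R * fromOpenedₙ (pred N) h φ)) +
              (∑< (suc h) (λ j → fromClosedₙ N h (φ · O · C j)) + - fromClosedₙ N h φ) ∎
            where
            flagged = J N (φ · O · O) (false ∷ true ∷ unflagged h) opened (just 0)
            s = ∑< h (λ j → fromClosedₙ N h (φ · O · C (suc j)))

          ∑<-≈[] : ∀ {a} n {g g′} → (∀ {j} → j < n → g j ≈[ a ] g′ j) → ∑< n g ≈[ a ] ∑< n g′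
          ∑<-≈[] zero    eq = ≈⇒≈[] refl
          ∑<-≈[] (suc n) eq = ≈[]-+ (eq (s≤s z≤n)) (∑<-≈[] n λ j<n → eq (s≤s j<n))

          private
            step : ∀ {h a N} → h ℕ.+ (suc a ℕ.+ suc a) ≤ suc N → suc (h ℕ.+ (a ℕ.+ a)) ≤ N
            step {h} {a} {N} le = ℕ.s≤s⁻¹ (≡.subst (_≤ suc N)
              (≡.trans (≡.cong (h ℕ.+_) (≡.cong suc (ℕ.+-suc a a)))
                (≡.trans (ℕ.+-suc h _) (≡.cong suc (ℕ.+-suc h _)))) le)

            step-close : ∀ {j h a N} → j < h → h ℕ.+ a ≤ suc N → pred h ℕ.+ a ≤ N
            step-close {h = suc h} _ (s≤s le) = le

          mutual
            -- An opening letter raises `h` by one but needs one power of `x` less; a closing letter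
            -- lowers `h` by one. Hence `h + 2a` drops with every letter, and that many letters
            -- determine the series modulo the `a`-th power of `x`. In `fromOpened` one more arc is
            -- open, whence `suc h`.
            fromStart-approx : ∀ N a h φ → Reducible φ → h ℕ.+ (a ℕ.+ a) ≤ N → fromStart h φ ≈[ a ] fromStartₙ N h φ
            fromStart-approx N zero h φ r le = ≈[0] _ _
            fromStart-approx zero (suc a) h φ r le with () ← ≡.subst (_≤ 0) (ℕ.+-suc h _) le
            fromStart-approx (suc N) (suc a) h φ r le = ≈[]-trans (≈⇒≈[] (fromStart-unfold h φ r))
              (≈[]-trans (≈[]-+ (≈⇒≈[] refl) (≈[]-+
                (≈[]-o (fromOpened-approx N a h φ r (step le)))
                (∑<-≈[] h λ {j} j<h → fromClosed-approx N (suc a) (pred h) (φ · C j) (Reducible-· (C j) r) (step-close j<h le))))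
              (≈⇒≈[] (sym (fromStartₙ-unfold N h φ))))

            fromClosed-approx : ∀ N a h φ → Reducible φ → h ℕ.+ (a ℕ.+ a) ≤ N → fromClosed h φ ≈[ a ] fromClosedₙ N h φ
            fromClosed-approx N zero h φ r le = ≈[0] _ _
            fromClosed-approx zero (suc a) h φ r le with () ← ≡.subst (_≤ 0) (ℕ.+-suc h _) le
            fromClosed-approx (suc N) (suc a) h φ r le = ≈[]-trans (≈⇒≈[] (fromClosed-unfold h φ r))
              (≈[]-trans (≈[]-+ (≈⇒≈[] refl) (≈[]-+
                (≈[]-* (R + 1#) (≈[]-o (fromOpened-approx N a h φ r (step le))))
                (≈[]-* R (∑<-≈[] h λ {j} j<h → fromClosed-approx N (suc a) (pred h) (φ · C j) (Reducible-· (C j) r) (step-close j<h le)))))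
              (≈⇒≈[] (sym (fromClosedₙ-unfold N h φ))))

            fromOpened-approx : ∀ N a h φ → Reducible φ → suc h ℕ.+ (a ℕ.+ a) ≤ N → fromOpened h φ ≈[ a ] fromOpenedₙ N h φ
            fromOpened-approx N zero h φ r le = ≈[0] _ _
            fromOpened-approx (suc zero) (suc a) h φ r (s≤s le) with () ← ≡.subst (_≤ 0) (ℕ.+-suc h _) le
            fromOpened-approx (suc (suc N)) (suc a) h φ r le = ≈[]-trans (≈⇒≈[] (fromOpened-unfold h φ r))
              (≈[]-trans (≈[]-+
                (≈[]-o (≈[]-+ (fromOpened-approx (suc N) a (suc h) (φ · O) (Reducible-· O r) (step {suc h} le))
                  (≈[]-neg (≈[]-* R (fromOpened-approx N a h φ r (ℕ.s≤s⁻¹ (step {suc h} le)))))))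
                (≈[]-+ (∑<-≈[] (suc h) λ {j} _ → fromClosed-approx (suc N) (suc a) h (φ · O · C j)
                    (Reducible-· (C j) (Reducible-· O r)) (ℕ.s≤s⁻¹ le))
                  (≈[]-neg (fromClosed-approx (suc N) (suc a) h φ r (ℕ.s≤s⁻¹ le)))))
              (≈⇒≈[] (sym (fromOpenedₙ-unfold (suc N) h φ r))))

-- The series `R` and `o` in two variables

module BivariateSeries where

  open import Algebra.Bundles using (CommutativeRing)
  open import Algebra.Solver.Ring.AlmostCommutativeRing
    using (fromCommutativeRing; _-Raw-AlmostCommutative⟶_)
  open import Data.Nat.Base using (suc)
  open import Data.Rational.Base as ℚ using (ℚ)
  import Data.Rational.Properties as ℚ
  open import Relation.Binary.PropositionalEquality as ≡ using (_≡_)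
  open SeriesRing

  module 𝕐 = Univariate ℚ.+-*-commutativeRing
  module 𝕏𝕐 = Univariate 𝕐.powerSeriesRing

  𝕊 : CommutativeRing _ _
  𝕊 = 𝕏𝕐.powerSeriesRing

  open CommutativeRing 𝕊

  con : ℚ → Carrier
  con q = 𝕏𝕐.scalar (𝕐.scalar q)

  con-hom : CommutativeRing.rawRing ℚ.+-*-commutativeRing
              -Raw-AlmostCommutative⟶ fromCommutativeRing 𝕊
  con-hom = record
    { ⟦_⟧    = con
    ; +-homo = λ p q → trans (𝕏𝕐.scalar-cong (𝕐.scalar-+ p q)) (𝕏𝕐.scalar-+ _ _)
    ; *-homo = λ p q → trans (𝕏𝕐.scalar-cong (𝕐.scalar-* p q)) (𝕏𝕐.scalar-* (𝕐.scalar p) (𝕐.scalar q))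
    ; -‿homo = λ p → trans (𝕏𝕐.scalar-cong (𝕐.scalar-neg p)) (𝕏𝕐.scalar-neg _)
    ; 0-homo = trans (𝕏𝕐.scalar-cong 𝕐.scalar-0) 𝕏𝕐.scalar-0
    ; 1-homo = trans (𝕏𝕐.scalar-cong 𝕐.scalar-1) 𝕏𝕐.scalar-1
    }

  x y : Carrier
  x = 𝕏𝕐.𝕏
  y = 𝕏𝕐.scalar 𝕐.𝕏

  private
    FR : Carrier → Carrier
    FR f = x * (f * f + f * y + f + y)

    FR-contraction : ∀ {a f h} → f 𝕏𝕐.≋[ a ] h → FR f 𝕏𝕐.≋[ suc a ] FR h
    FR-contraction {a} {f} {h} f≋h = 𝕏𝕐.𝕏-⊛-mod {f = f * f + f * y + f + y} {h * h + h * y + h + y}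
      (𝕏𝕐.⊕-cong-mod {f = f * f + f * y + f} {h * h + h * y + h} {y} {y}
        (𝕏𝕐.⊕-cong-mod {f = f * f + f * y} {h * h + h * y} {f} {h}
          (𝕏𝕐.⊕-cong-mod {f = f * f} {h * h} {f * y} {h * y}
            (𝕏𝕐.⊛-cong-mod {f = f} {h} {f} {h} f≋h f≋h)
            (𝕏𝕐.⊛-cong-mod {f = f} {h} {y} {y} f≋h (λ _ _ → ≡.refl)))
          f≋h)
        (λ _ _ → ≡.refl))

  -- the Narayana series, which counts the noncrossing partitions
  R : Carrier
  R = 𝕏𝕐.Fixpoint.fix FR FR-contraction

  R-unfold : R ≈ x * (R * R + R * y + R + y)
  R-unfold = 𝕏𝕐.Fixpoint.fix-unfold FR FR-contraction

  private
    e : Carrier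
    e = 1# + y + (R + R)

    Fo : Carrier → Carrier
    Fo f = x * (1# + f * e)

    Fo-contraction : ∀ {a f h} → f 𝕏𝕐.≋[ a ] h → Fo f 𝕏𝕐.≋[ suc a ] Fo h
    Fo-contraction {a} {f} {h} f≋h = 𝕏𝕐.𝕏-⊛-mod {f = 1# + f * e} {1# + h * e}
      (𝕏𝕐.⊕-cong-mod {f = 1#} {1#} {f * e} {h * e} (λ _ _ → ≡.refl)
        (𝕏𝕐.⊛-cong-mod {f = f} {h} {e} {e} f≋h (λ _ _ → ≡.refl)))

  -- The quotient `x / S`, obtained without division by solving `o (1 - x (1 + y + 2R)) = x` for `o`
  -- iteratively.
  o : Carrier
  o = 𝕏𝕐.Fixpoint.fix Fo Fo-contraction

  o-unfold : o ≈ x * (1# + o * (1# + y + (R + R)))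
  o-unfold = 𝕏𝕐.Fixpoint.fix-unfold Fo Fo-contraction

-- Rational polynomials, and the quadratic extension generated by `S`

module Polynomials where

  open import Algebra.Bundles using (CommutativeRing)
  open import Algebra.Solver.Ring.AlmostCommutativeRing
    using (fromCommutativeRing; _-Raw-AlmostCommutative⟶_)
  import Algebra.Properties.CommutativeSemigroup as CommutativeSemigroupProperties
  open import Data.Bool.Base using (true; false)
  open import Data.Fin.Base using (Fin; zero; suc)
  open import Data.List.Base using ([]; _∷_; _++_; length; map; foldr)
  open import Data.List.Relation.Unary.Any using (here; there)
  open import Data.Nat.Base as ℕ using (ℕ; zero; suc)
  import Data.Nat.Properties as ℕ
  open import Data.Rational.Base as ℚ using (ℚ; 0ℚ; 1ℚ; ½)
  import Data.Rational.Properties as ℚ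
  open import Data.Sum.Base using (_⊎_; inj₁; inj₂)
  open import Data.Vec.Base as Vec using (Vec; []; _∷_; lookup)
  open import Level as Level using (lift)
  open import Relation.Binary.PropositionalEquality as ≡ using (_≡_)
  open import Relation.Nullary using (¬_; yes; no; contradiction)
  import Relation.Binary.Reasoning.Setoid as SetoidReasoning
  open import Defs using (module Series)
  open ChordWords
  open PrimitiveWords

  ℚ-rawRing = CommutativeRing.rawRing ℚ.+-*-commutativeRing

  open Series ℚ-rawRing using () renaming (Poly to Polyℚ; NonzeroPoly to NonzeroPolyℚ) public

  _⊞_ : ∀ {n} → Polyℚ n → Polyℚ n → Polyℚ n
  _⊞_ {zero}  a       b       = a ℚ.+ b
  _⊞_ {suc n} []      q       = q
  _⊞_ {suc n} (a ∷ p) []      = a ∷ p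
  _⊞_ {suc n} (a ∷ p) (b ∷ q) = _⊞_ {n} a b ∷ _⊞_ {suc n} p q

  constantPoly : ∀ {n} → ℚ → Polyℚ n
  constantPoly {zero}  a = a
  constantPoly {suc n} a = constantPoly {n} a ∷ []

  _⊠_ : ∀ {n} → Polyℚ n → Polyℚ n → Polyℚ n
  _⊠_ {zero}  a       b = a ℚ.* b
  _⊠_ {suc n} []      q = []
  _⊠_ {suc n} (a ∷ p) q = _⊞_ {suc n} (map (_⊠_ {n} a) q) (constantPoly {n} 0ℚ ∷ _⊠_ {suc n} p q)

  variable-poly : ∀ {n} → Fin n → Polyℚ n
  variable-poly {suc n} zero    = constantPoly {n} 0ℚ ∷ constantPoly {n} 1ℚ ∷ []
  variable-poly {suc n} (suc i) = variable-poly {n} i ∷ []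

  module RationalPolynomials {c ℓ} (𝕊 : CommutativeRing c ℓ)
    (con-hom : ℚ-rawRing -Raw-AlmostCommutative⟶ fromCommutativeRing 𝕊) where

    open CommutativeRing 𝕊 hiding (zero)
    open SetoidReasoning setoid
    open _-Raw-AlmostCommutative⟶_ con-hom using (+-homo; *-homo; -‿homo; 0-homo; 1-homo) renaming (⟦_⟧ to con)
    open Comparison 𝕊 con-hom using (module Solver)
    open Solver using (solve; _:=_; _:+_; _:*_; :-_) renaming (con to :con)
    private
      module +S = CommutativeSemigroupProperties +-commutativeSemigroup
      module *S = CommutativeSemigroupProperties *-commutativeSemigroup

    eval : ∀ {n} → Polyℚ n → Vec Carrier n → Carrier
    eval {zero}  a []       = con a
    eval {suc n} p (v ∷ vs) = foldr (λ a acc → eval {n} a vs + v * acc) 0# p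

    eval-⊞ : ∀ {n} (p q : Polyℚ n) vs → eval {n} (_⊞_ {n} p q) vs ≈ eval {n} p vs + eval {n} q vs
    eval-⊞ {zero}  a       b       []       = +-homo a b
    eval-⊞ {suc n} []      q       (v ∷ vs) = sym (+-identityˡ _)
    eval-⊞ {suc n} (a ∷ p) []      (v ∷ vs) = sym (+-identityʳ _)
    eval-⊞ {suc n} (a ∷ p) (b ∷ q) (v ∷ vs) = begin
      eval {n} (_⊞_ {n} a b) vs + v * eval {suc n} (_⊞_ {suc n} p q) (v ∷ vs)
        ≈⟨ +-cong (eval-⊞ {n} a b vs) (*-congˡ (eval-⊞ {suc n} p q (v ∷ vs))) ⟩
      (eval {n} a vs + eval {n} b vs) + v * (eval {suc n} p (v ∷ vs) + eval {suc n} q (v ∷ vs))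
        ≈⟨ +-congˡ (distribˡ v _ _) ⟩
      (eval {n} a vs + eval {n} b vs) + (v * eval {suc n} p (v ∷ vs) + v * eval {suc n} q (v ∷ vs))
        ≈⟨ +S.interchange _ _ _ _ ⟩
      eval {suc n} (a ∷ p) (v ∷ vs) + eval {suc n} (b ∷ q) (v ∷ vs) ∎

    eval-constant : ∀ {n} a vs → eval {n} (constantPoly {n} a) vs ≈ con a
    eval-constant {zero}  a []       = refl
    eval-constant {suc n} a (v ∷ vs) = begin
      eval {n} (constantPoly {n} a) vs + v * 0#  ≈⟨ +-cong (eval-constant {n} a vs) (zeroʳ v) ⟩
      con a + 0#                                 ≈⟨ +-identityʳ _ ⟩
      con a                                      ∎

    eval-⊠ : ∀ {n} (p q : Polyℚ n) vs → eval {n} (_⊠_ {n} p q) vs ≈ eval {n} p vs * eval {n} q vs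
    eval-scale : ∀ {n} (a : Polyℚ n) (q : Polyℚ (suc n)) v vs →
      eval {suc n} (map (_⊠_ {n} a) q) (v ∷ vs) ≈ eval {n} a vs * eval {suc n} q (v ∷ vs)
    eval-⊠ {zero}  a       b []       = *-homo a b
    eval-⊠ {suc n} []      q (v ∷ vs) = sym (zeroˡ _)
    eval-⊠ {suc n} (a ∷ p) q (v ∷ vs) = begin
      eval {suc n} (_⊞_ {suc n} (map (_⊠_ {n} a) q) (constantPoly {n} 0ℚ ∷ _⊠_ {suc n} p q)) (v ∷ vs)
        ≈⟨ eval-⊞ {suc n} (map (_⊠_ {n} a) q) (constantPoly {n} 0ℚ ∷ _⊠_ {suc n} p q) (v ∷ vs) ⟩
      eval {suc n} (map (_⊠_ {n} a) q) (v ∷ vs) +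
        (eval {n} (constantPoly {n} 0ℚ) vs + v * eval {suc n} (_⊠_ {suc n} p q) (v ∷ vs))
        ≈⟨ +-cong (eval-scale {n} a q v vs) (trans (+-cong (trans (eval-constant {n} 0ℚ vs) 0-homo)
             (*-congˡ (eval-⊠ {suc n} p q (v ∷ vs)))) (+-identityˡ _)) ⟩
      eval {n} a vs * e + v * (eval {suc n} p (v ∷ vs) * e)
        ≈⟨ +-congˡ (*-assoc v _ _) ⟨
      eval {n} a vs * e + v * eval {suc n} p (v ∷ vs) * e
        ≈⟨ distribʳ e _ _ ⟨
      eval {suc n} (a ∷ p) (v ∷ vs) * e ∎
      where e = eval {suc n} q (v ∷ vs)
    eval-scale {n} a []      v vs = sym (zeroʳ _)
    eval-scale {n} a (b ∷ q) v vs = begin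
      eval {n} (_⊠_ {n} a b) vs + v * eval {suc n} (map (_⊠_ {n} a) q) (v ∷ vs)
        ≈⟨ +-cong (eval-⊠ {n} a b vs) (*-congˡ (eval-scale {n} a q v vs)) ⟩
      eval {n} a vs * eval {n} b vs + v * (eval {n} a vs * eval {suc n} q (v ∷ vs))
        ≈⟨ +-congˡ (*S.x∙yz≈y∙xz v _ _) ⟩
      eval {n} a vs * eval {n} b vs + eval {n} a vs * (v * eval {suc n} q (v ∷ vs))
        ≈⟨ distribˡ _ _ _ ⟨
      eval {n} a vs * eval {suc n} (b ∷ q) (v ∷ vs) ∎

    eval-variable : ∀ {n} i (vs : Vec Carrier n) → eval {n} (variable-poly {n} i) vs ≈ lookup vs i
    eval-variable {suc n} zero (v ∷ vs) = begin
      eval {n} (constantPoly {n} 0ℚ) vs + v * (eval {n} (constantPoly {n} 1ℚ) vs + v * 0#)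
        ≈⟨ +-cong (trans (eval-constant {n} 0ℚ vs) 0-homo)
             (*-congˡ (trans (+-cong (trans (eval-constant {n} 1ℚ vs) 1-homo) (zeroʳ v)) (+-identityʳ 1#))) ⟩
      0# + v * 1#  ≈⟨ trans (+-identityˡ _) (*-identityʳ v) ⟩
      v            ∎
    eval-variable {suc n} (suc i) (v ∷ vs) =
      trans (+-cong (eval-variable {n} i vs) (zeroʳ v)) (+-identityʳ _)

    -- Lets a nonzero value certify a nonzero coefficient, so that the coefficients of computed sums
    -- and products never have to be inspected.
    eval-0 : ∀ {n} (p : Polyℚ n) → NonzeroPolyℚ {n} p ⊎ (∀ vs → eval {n} p vs ≈ 0#)
    eval-0 {zero} a with a ℚ.≟ 0ℚ
    ... | yes ≡.refl = inj₂ λ { [] → 0-homo }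
    ... | no a≢0     = inj₁ (lift a≢0)
    eval-0 {suc n} []      = inj₂ λ { (v ∷ vs) → refl }
    eval-0 {suc n} (a ∷ p) with eval-0 {n} a | eval-0 {suc n} p
    ... | inj₁ a≢0 | _        = inj₁ (here a≢0)
    ... | inj₂ _   | inj₁ p≢0 = inj₁ (there p≢0)
    ... | inj₂ a≈0 | inj₂ p≈0 = inj₂ λ { (v ∷ vs) → trans (+-cong (a≈0 vs)
            (trans (*-congˡ (p≈0 (v ∷ vs))) (zeroʳ v))) (+-identityˡ 0#) }

    weaken : ∀ {n} → Polyℚ n → Polyℚ (n ℕ.+ 1)
    weaken {zero}  a = a ∷ []
    weaken {suc n} p = map (weaken {n}) p

    eval-weaken : ∀ {n} (p : Polyℚ n) vs v → eval {n ℕ.+ 1} (weaken {n} p) (vs Vec.++ v ∷ []) ≈ eval {n} p vs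
    eval-weaken {zero}  a       []       v = trans (+-congˡ (zeroʳ v)) (+-identityʳ _)
    eval-weaken {suc n} []      (u ∷ vs) v = refl
    eval-weaken {suc n} (a ∷ p) (u ∷ vs) v = +-cong (eval-weaken {n} a vs v) (*-congˡ (eval-weaken {suc n} p (u ∷ vs) v))

    record Polynomial {n} (vs : Vec Carrier n) (f : Carrier) : Set ℓ where
      constructor polynomial
      field
        poly   : Polyℚ n
        eval-≈ : eval {n} poly vs ≈ f
    open Polynomial public

    module _ {n} {vs : Vec Carrier n} where

      poly-resp : ∀ {f h} → f ≈ h → Polynomial vs f → Polynomial vs h
      poly-resp f≈h (polynomial p eq) = polynomial p (trans eq f≈h)

      poly-+ : ∀ {f h} → Polynomial vs f → Polynomial vs h → Polynomial vs (f + h)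
      poly-+ (polynomial p eq) (polynomial q eq′) = polynomial (_⊞_ {n} p q) (trans (eval-⊞ {n} p q vs) (+-cong eq eq′))

      poly-* : ∀ {f h} → Polynomial vs f → Polynomial vs h → Polynomial vs (f * h)
      poly-* (polynomial p eq) (polynomial q eq′) = polynomial (_⊠_ {n} p q) (trans (eval-⊠ {n} p q vs) (*-cong eq eq′))

      poly-con : ∀ a → Polynomial vs (con a)
      poly-con a = polynomial (constantPoly {n} a) (eval-constant {n} a vs)

      poly-0 : Polynomial vs 0#
      poly-0 = poly-resp 0-homo (poly-con 0ℚ)

      poly-1 : Polynomial vs 1#
      poly-1 = poly-resp 1-homo (poly-con 1ℚ)

      poly-neg : ∀ {f} → Polynomial vs f → Polynomial vs (- f)
      poly-neg {f} p = poly-resp (solve 1 (λ f → :con (ℚ.- 1ℚ) :* f := :- f) refl f) (poly-* (poly-con (ℚ.- 1ℚ)) p)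

      poly-var : ∀ i → Polynomial vs (lookup vs i)
      poly-var i = polynomial (variable-poly {n} i) (eval-variable {n} i vs)

    poly-weaken : ∀ {n} {vs : Vec Carrier n} {f} v → Polynomial vs f → Polynomial (vs Vec.++ v ∷ []) f
    poly-weaken {n} {vs} v (polynomial p eq) = polynomial (weaken {n} p) (trans (eval-weaken {n} p vs v) eq)

    poly-nonzero : ∀ {n} {vs : Vec Carrier n} {f} (pf : Polynomial vs f) → ¬ f ≈ 0# → NonzeroPolyℚ {n} (poly pf)
    poly-nonzero {n} {vs} (polynomial p eq) f≉0 with eval-0 {n} p
    ... | inj₁ p≢0 = p≢0
    ... | inj₂ p≈0 = contradiction (trans (sym eq) (p≈0 vs)) f≉0

    module Narayana (x y R o : Carrier)
      (R-unfold : R ≈ x * (R * R + R * y + R + y))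
      (o-unfold : o ≈ x * (1# + o * (1# + y + (R + R)))) where

      private
        one = con 1ℚ

        1≈one : 1# ≈ one
        1≈one = sym 1-homo

      S : Carrier
      S = 1# + - (x + x * y + (x * R + x * R))

      S-* : ∀ f → S * f ≈ f + - (x * f + x * y * f + (x * R * f + x * R * f))
      S-* f = begin
        (1# + - (x + x * y + (x * R + x * R))) * f
          ≈⟨ trans (distribʳ f 1# _) (+-congʳ (*-identityˡ f)) ⟩
        f + - (x + x * y + (x * R + x * R)) * f
          ≈⟨ solve 4 (λ x y r f → f :+ :- (x :+ x :* y :+ (x :* r :+ x :* r)) :* f
               := f :+ :- (x :* f :+ x :* y :* f :+ (x :* r :* f :+ x :* r :* f))) refl x y R f ⟩
        f + - (x * f + x * y * f + (x * R * f + x * R * f)) ∎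

      o*S≈x : o * S ≈ x
      o*S≈x = begin
        o * S                                     ≈⟨ trans (*-comm o S) (S-* o) ⟩
        o + - (x * o + x * y * o + (x * R * o + x * R * o))
          ≈⟨ +-congʳ (trans o-unfold (*-congˡ (+-cong 1≈one (*-congˡ (+-congʳ (+-congʳ 1≈one)))))) ⟩
        x * (one + o * (one + y + (R + R))) + - (x * o + x * y * o + (x * R * o + x * R * o))
          ≈⟨ solve 4 (λ x y r o → x :* (:con 1ℚ :+ o :* (:con 1ℚ :+ y :+ (r :+ r)))
               :+ :- (x :* o :+ x :* y :* o :+ (x :* r :* o :+ x :* r :* o)) := x) refl x y R o ⟩
        x                                         ∎

      -- The sum is associated in the way in which the multiple `4 ·` in `Δ` unfolds, so that the
      -- two expressions can be matched term by term.
      discriminant : Carrier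
      discriminant = t * t + - (z + (z + (z + (z + 0#))))
        where
        t = x + x * y + - 1#
        z = x * x * y

      -- `S` is the derivative of `R - x (R + 1) (R + y)` with respect to `R`, and the square of the
      -- derivative of a quadratic polynomial at a root is its discriminant. The difference of the
      -- two sides is `4x` times the defect `e` of the equation for `R`.
      S²≈discriminant : S * S ≈ discriminant
      S²≈discriminant = begin
        S * S
          ≈⟨ *-cong (+-congʳ 1≈one) (+-congʳ 1≈one) ⟩
        (one + - (x + x * y + (x * R + x * R))) * (one + - (x + x * y + (x * R + x * R)))
          ≈⟨ solve 3 (λ x y r →
               let s = :con 1ℚ :+ :- (x :+ x :* y :+ (x :* r :+ x :* r))
                   t = x :+ x :* y :+ :- :con 1ℚ
                   e = x :* (r :* r :+ r :* y :+ r :+ y) :+ :- r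
                   z = x :* x :* y in
               s :* s := (t :* t :+ :- (z :+ (z :+ (z :+ (z :+ :con 0ℚ))))) :+ x :* (e :+ e :+ (e :+ e))) refl x y R ⟩
        discriminant′ + x * (e + e + (e + e))
          ≈⟨ +-congˡ (trans (*-congˡ (trans (+-cong (+-cong e≈0 e≈0) (+-cong e≈0 e≈0))
               (trans (+-cong (+-identityˡ 0#) (+-identityˡ 0#)) (+-identityˡ 0#)))) (zeroʳ x)) ⟩
        discriminant′ + 0#
          ≈⟨ +-identityʳ _ ⟩
        discriminant′
          ≈⟨ +-cong (*-cong (+-congˡ (-‿cong 1≈one)) (+-congˡ (-‿cong 1≈one)))
               (-‿cong (+-congˡ (+-congˡ (+-congˡ (+-congˡ (sym 0-homo)))))) ⟨
        discriminant ∎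
        where
        z = x * x * y
        e = x * (R * R + R * y + R + y) + - R
        e≈0 : e ≈ 0#
        e≈0 = trans (+-congʳ (sym R-unfold)) (-‿inverseʳ R)
        discriminant′ = (x + x * y + - one) * (x + x * y + - one) + - (z + (z + (z + (z + con 0ℚ))))

      xy : Vec Carrier 2
      xy = x ∷ y ∷ []

      poly-x : Polynomial xy x
      poly-x = poly-var zero

      poly-y : Polynomial xy y
      poly-y = poly-var (suc zero)

      poly-discriminant : Polynomial xy discriminant
      poly-discriminant = poly-+ (poly-* poly-t poly-t) (poly-neg (poly-+ poly-z (poly-+ poly-z (poly-+ poly-z (poly-+ poly-z poly-0)))))
        where
        poly-t = poly-+ (poly-+ poly-x (poly-* poly-x poly-y)) (poly-neg poly-1)
        poly-z = poly-* (poly-* poly-x poly-x) poly-y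

      record Quadratic (f : Carrier) : Set (c Level.⊔ ℓ) where
        constructor quadratic
        field
          {part₀ part₁} : Carrier
          poly-part₀    : Polynomial xy part₀
          poly-part₁    : Polynomial xy part₁
          form          : f ≈ part₀ + part₁ * S
      open Quadratic public

      quad-resp : ∀ {f h} → f ≈ h → Quadratic f → Quadratic h
      quad-resp f≈h (quadratic pa pb eq) = quadratic pa pb (trans (sym f≈h) eq)

      quad-poly : ∀ {f} → Polynomial xy f → Quadratic f
      quad-poly pf = quadratic pf poly-0 (sym (trans (+-congˡ (zeroˡ S)) (+-identityʳ _)))

      quad-+ : ∀ {f h} → Quadratic f → Quadratic h → Quadratic (f + h)
      quad-+ (quadratic {a} {b} pa pb eq) (quadratic {a′} {b′} pa′ pb′ eq′) = quadratic (poly-+ pa pa′) (poly-+ pb pb′)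
        (trans (+-cong eq eq′) (trans (+S.interchange a (b * S) a′ (b′ * S)) (+-congˡ (sym (distribʳ S b b′)))))

      quad-* : ∀ {f h} → Quadratic f → Quadratic h → Quadratic (f * h)
      quad-* (quadratic {a} {b} pa pb eq) (quadratic {a′} {b′} pa′ pb′ eq′) =
        quadratic (poly-+ (poly-* pa pa′) (poly-* (poly-* pb pb′) poly-discriminant)) (poly-+ (poly-* pa pb′) (poly-* pa′ pb))
          (trans (*-cong eq eq′) (trans
            (solve 5 (λ a b a′ b′ s → (a :+ b :* s) :* (a′ :+ b′ :* s)
               := (a :* a′ :+ b :* b′ :* (s :* s)) :+ (a :* b′ :+ a′ :* b) :* s) refl a b a′ b′ S)
            (+-congʳ (+-congˡ (*-congˡ S²≈discriminant)))))

      -- `R` needs a denominator `x`, and `o = x S / (S * S)` needs the discriminant. Powers of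
      -- their product serve for all sums and products.
      denominator : Carrier
      denominator = x * discriminant

      poly-denominator : Polynomial xy denominator
      poly-denominator = poly-* poly-x poly-discriminant

      infixr 8 _↑_
      _↑_ : Carrier → ℕ → Carrier
      f ↑ zero  = 1#
      f ↑ suc n = f * f ↑ n

      ↑-+ : ∀ f m n → f ↑ (m ℕ.+ n) ≈ f ↑ m * f ↑ n
      ↑-+ f zero    n = sym (*-identityˡ _)
      ↑-+ f (suc m) n = trans (*-congˡ (↑-+ f m n)) (sym (*-assoc f _ _))

      poly-↑ : ∀ {f} n → Polynomial xy f → Polynomial xy (f ↑ n)
      poly-↑ zero    pf = poly-1
      poly-↑ (suc n) pf = poly-* pf (poly-↑ n pf)

      record Fractional (f : Carrier) : Set (c Level.⊔ ℓ) where
        constructor fractional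
        field
          exponent : ℕ
          cleared  : Quadratic (f * denominator ↑ exponent)
      open Fractional public

      frac-resp : ∀ {f h} → f ≈ h → Fractional f → Fractional h
      frac-resp f≈h (fractional m q) = fractional m (quad-resp (*-congʳ f≈h) q)

      frac-poly : ∀ {f} → Polynomial xy f → Fractional f
      frac-poly pf = fractional 0 (quad-resp (sym (*-identityʳ _)) (quad-poly pf))

      private
        quad-↑ : ∀ n → Quadratic (denominator ↑ n)
        quad-↑ n = quad-poly (poly-↑ n poly-denominator)

      frac-+ : ∀ {f h} → Fractional f → Fractional h → Fractional (f + h)
      frac-+ {f} {h} (fractional m q) (fractional n q′) = fractional (m ℕ.+ n) (quad-resp (begin
        f * dᵐ * dⁿ + h * dⁿ * dᵐ
          ≈⟨ solve 4 (λ f h a b → f :* a :* b :+ h :* b :* a := (f :+ h) :* (a :* b)) refl f h dᵐ dⁿ ⟩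
        (f + h) * (dᵐ * dⁿ)
          ≈⟨ *-congˡ (↑-+ denominator m n) ⟨
        (f + h) * denominator ↑ (m ℕ.+ n) ∎)
        (quad-+ (quad-* q (quad-↑ n)) (quad-* q′ (quad-↑ m))))
        where
        dᵐ = denominator ↑ m
        dⁿ = denominator ↑ n

      frac-* : ∀ {f h} → Fractional f → Fractional h → Fractional (f * h)
      frac-* {f} {h} (fractional m q) (fractional n q′) = fractional (m ℕ.+ n) (quad-resp (begin
        f * dᵐ * (h * dⁿ)       ≈⟨ *S.interchange f dᵐ h dⁿ ⟩
        f * h * (dᵐ * dⁿ)       ≈⟨ *-congˡ (↑-+ denominator m n) ⟨
        f * h * denominator ↑ (m ℕ.+ n) ∎)
        (quad-* q q′))
        where
        dᵐ = denominator ↑ m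
        dⁿ = denominator ↑ n

      frac-o : Fractional o
      frac-o = fractional 1 (quadratic poly-0 (poly-* poly-x poly-x) (begin
        o * (x * discriminant * 1#)  ≈⟨ *-congˡ (trans (*-identityʳ _) (*-congˡ (sym S²≈discriminant))) ⟩
        o * (x * (S * S))            ≈⟨ solve 3 (λ o x s → o :* (x :* (s :* s)) := x :* (o :* s) :* s) refl o x S ⟩
        x * (o * S) * S              ≈⟨ *-congʳ (*-congˡ o*S≈x) ⟩
        x * x * S                    ≈⟨ +-identityˡ _ ⟨
        0# + x * x * S               ∎))

      -- Solving the definition of `S` for `R` gives `2x R = 1 - x - xy - S`.
      frac-R : Fractional R
      frac-R = fractional 1 (quadratic
        (poly-* (poly-con ½) (poly-* poly-discriminant (poly-+ poly-1 (poly-neg (poly-+ poly-x (poly-* poly-x poly-y))))))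
        (poly-* (poly-con (ℚ.- ½)) poly-discriminant) (begin
        R * (x * discriminant * 1#)
          ≈⟨ *-congˡ (*-identityʳ _) ⟩
        R * (x * discriminant)
          ≈⟨ solve 4 (λ x y r d → r :* (x :* d) := :con ½ :* (d :* (:con 1ℚ :+ :- (x :+ x :* y)))
               :+ (:con (ℚ.- ½)) :* d :* (:con 1ℚ :+ :- (x :+ x :* y :+ (x :* r :+ x :* r)))) refl x y R discriminant ⟩
        con ½ * (discriminant * (one + - (x + x * y))) + con (ℚ.- ½) * discriminant * (one + - (x + x * y + (x * R + x * R)))
          ≈⟨ +-cong (*-congˡ (*-congˡ (+-congʳ 1≈one))) (*-congˡ (+-congʳ 1≈one)) ⟨
        con ½ * (discriminant * (1# + - (x + x * y))) + con (ℚ.- ½) * discriminant * S ∎))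

      open Words-in 𝕊
      open Weighted o R (R + 1#)

      frac-0 : Fractional 0#
      frac-0 = frac-poly poly-0

      frac-1 : Fractional 1#
      frac-1 = frac-poly poly-1

      frac-indicator : ∀ b → Fractional (indicator b)
      frac-indicator true  = frac-1
      frac-indicator false = frac-0

      frac-∑ : ∀ {g} fs → (∀ xs f ys → Fractional (g xs f ys)) → Fractional (∑ g fs)
      frac-∑ []       fg = frac-0
      frac-∑ (f ∷ fs) fg = frac-+ (fg [] f fs) (frac-∑ fs λ xs → fg (f ∷ xs))

      frac-J : ∀ N φ fs μ fb → Fractional (J N φ fs μ fb)
      frac-J zero    φ fs μ fb = frac-0
      frac-J (suc N) φ fs μ fb = frac-+ (frac-* (frac-before-close μ) (frac-final fs))
        (frac-+ (frac-* (frac-before-open μ) (frac-* frac-o (frac-J N _ _ _ _)))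
          (frac-* (frac-before-close μ) (frac-∑ fs frac-close)))
        where
        frac-before-close : ∀ μ → Fractional (before-close μ)
        frac-before-close initial = frac-1
        frac-before-close opened  = frac-1
        frac-before-close closed  = frac-R
        frac-before-open : ∀ μ → Fractional (before-open μ)
        frac-before-open initial = frac-1
        frac-before-open opened  = frac-1
        frac-before-open closed  = frac-+ frac-R frac-1
        frac-final : ∀ fs → Fractional (final fs φ)
        frac-final []      = frac-indicator (φ [])
        frac-final (_ ∷ _) = frac-0
        frac-close : ∀ xs f ys → Fractional (close N φ fb xs f ys)
        frac-close xs f ys with allowed fb (length xs)
        ... | true  = frac-J N _ _ _ _
        ... | false = frac-0

      ↑-* : ∀ f h n → (f * h) ↑ n ≈ f ↑ n * h ↑ n
      ↑-* f h zero    = sym (*-identityˡ 1#)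
      ↑-* f h (suc n) = trans (*-congˡ (↑-* f h n)) (*S.interchange f h _ _)

      -- f D = a + b S makes f a root of (D f - a)² - b² S².
      quadratic-equation : ∀ {f D a b} → f * D ≈ a + b * S →
        (a * a + - (b * b * discriminant)) + f * (- (D * a + D * a) + f * (D * D + f * 0#)) ≈ 0#
      quadratic-equation {f} {D} {a} {b} eq = begin
        (a * a + - (b * b * discriminant)) + f * (- (D * a + D * a) + f * (D * D + f * 0#))
          ≈⟨ +-cong (+-congˡ (-‿cong (*-congˡ (sym S²≈discriminant)))) (*-congˡ (+-congˡ (*-congˡ (+-congˡ (zeroʳ f))))) ⟩
        (a * a + - (b * b * (S * S))) + f * (- (D * a + D * a) + f * (D * D + 0#))
          ≈⟨ +-congˡ (*-congˡ (+-congˡ (*-congˡ (+-identityʳ _)))) ⟩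
        (a * a + - (b * b * (S * S))) + f * (- (D * a + D * a) + f * (D * D))
          ≈⟨ solve 5 (λ f d a b s → (a :* a :+ :- (b :* b :* (s :* s))) :+ f :* (:- (d :* a :+ d :* a) :+ f :* (d :* d))
               := (f :* d :+ :- (a :+ b :* s)) :* (f :* d :+ :- a :+ b :* s)) refl f D a b S ⟩
        (f * D + - (a + b * S)) * (f * D + - a + b * S)
          ≈⟨ *-congʳ (trans (+-congʳ eq) (-‿inverseʳ _)) ⟩
        0# * (f * D + - a + b * S)
          ≈⟨ zeroˡ _ ⟩
        0# ∎

-- Block structures as paths, and the permutation of a path

module BlockPaths where

  open import Data.Fin.Base using (Fin; zero; suc; toℕ; punchIn; punchOut)
  open import Data.Fin.Properties using (punchIn-injective; punchInᵢ≢i; punchIn-punchOut) renaming (_≟_ to _≟ᶠ_)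
  open import Data.List.Base using ([]; _∷_)
  open import Data.Nat.Base
  open import Data.Nat.Properties
  open import Data.Product.Base using (∃; _,_)
  open import Data.Sum.Base using (_⊎_; inj₁; inj₂)
  open import Function.Base using (_∘_; id)
  open import Relation.Binary.PropositionalEquality
  open import Relation.Nullary using (contradiction; yes; no)
  open ChordWords
  open GenusOfWords using (chords)

  -- Path h n: how h open blocks may be continued by n points, each of which is a
  -- singleton, opens a block, or is the middle or the last point of the
  -- block at the given place of the stack of open blocks.
  data Path : ℕ → ℕ → Set where
    end       : Path 0 0
    singleton : ∀ {h n} → Path h n → Path h (suc n)
    first     : ∀ {h n} → Path (suc h) n → Path h (suc n)
    middle    : ∀ {h n} → Fin (suc h) → Path (suc h) n → Path (suc h) (suc n)
    last      : ∀ {h n} → Fin (suc h) → Path h n → Path (suc h) (suc n)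

  -- A middle point ends one arc of its block and starts the next. It therefore yields two letters,
  -- and its block moves to the top of the stack.
  chordWord : ∀ {h n} → Path h n → Word
  chordWord end           = []
  chordWord (singleton w) = chordWord w
  chordWord (first w)     = O ∷ chordWord w
  chordWord (middle j w)  = C (toℕ j) ∷ O ∷ chordWord w
  chordWord (last j w)    = C (toℕ j) ∷ chordWord w

  blocks : ∀ {h n} → Path h n → ℕ
  blocks end           = 0
  blocks (singleton w) = suc (blocks w)
  blocks (first w)     = blocks w
  blocks (middle j w)  = blocks w
  blocks (last j w)    = suc (blocks w)

  -- Each point either starts an arc or is the last of its block, never both.
  chords+blocks : ∀ {h n} (w : Path h n) → chords (chordWord w) + blocks w ≡ n
  chords+blocks end           = refl
  chords+blocks (singleton w) = trans (+-suc _ _) (cong suc (chords+blocks w))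
  chords+blocks (first w)     = cong suc (chords+blocks w)
  chords+blocks (middle j w)  = cong suc (chords+blocks w)
  chords+blocks (last j w)    = trans (+-suc _ _) (cong suc (chords+blocks w))

  swap : ℕ → ℕ → ℕ → ℕ
  swap a b i with i ≟ a | i ≟ b
  ... | yes _ | _     = b
  ... | no _  | yes _ = a
  ... | no _  | no _  = i

  swap-left : ∀ a b → swap a b a ≡ b
  swap-left a b with a ≟ a
  ... | yes _  = refl
  ... | no a≢a = contradiction refl a≢a

  swap-right : ∀ a b → swap a b b ≡ a
  swap-right a b with b ≟ a | b ≟ b
  ... | yes b≡a | _      = b≡a
  ... | no _    | yes _  = refl
  ... | no _    | no b≢b = contradiction refl b≢b

  swap-other : ∀ {a b i} → i ≢ a → i ≢ b → swap a b i ≡ i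
  swap-other {a} {b} {i} i≢a i≢b with i ≟ a | i ≟ b
  ... | yes i≡a | _       = contradiction i≡a i≢a
  ... | no _    | yes i≡b = contradiction i≡b i≢b
  ... | no _    | no _    = refl

  swap-involutive : ∀ a b i → swap a b (swap a b i) ≡ i
  swap-involutive a b i = go (i ≟ a) (i ≟ b)
    where
    go : _ → _ → swap a b (swap a b i) ≡ i
    go (yes refl) _          = trans (cong (swap a b) (swap-left a b)) (swap-right a b)
    go (no _)     (yes refl) = trans (cong (swap a b) (swap-right a b)) (swap-left a b)
    go (no i≢a)   (no i≢b)   = trans (cong (swap a b) (swap-other i≢a i≢b)) (swap-other i≢a i≢b)

  swap-< : ∀ {a b m} i → a < m → b < m → i < m → swap a b i < m
  swap-< {a} {b} i a<m b<m i<m with i ≟ a | i ≟ b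
  ... | yes _ | _     = b<m
  ... | no _  | yes _ = a<m
  ... | no _  | no _  = i<m

  -- the last points of the open blocks among t points
  record Stack (t h : ℕ) : Set where
    field
      at           : Fin h → ℕ
      at<          : ∀ k → at k < t
      at-injective : ∀ {j k} → at j ≡ at k → j ≡ k
  open Stack public

  skip : ∀ {t h} → Stack t h → Stack (suc t) h
  skip s = record { at = at s ; at< = λ k → m<n⇒m<1+n (at< s k) ; at-injective = at-injective s }

  add : ∀ {t h} → Stack t h → Stack (suc t) (suc h)
  add {t} s = record
    { at           = λ { zero → t ; (suc k) → at s k }
    ; at<          = λ { zero → ≤-refl ; (suc k) → m<n⇒m<1+n (at< s k) }
    ; at-injective = λ
        { {zero}  {zero}  _  → refl
        ; {zero}  {suc k} eq → contradiction (sym eq) (<⇒≢ (at< s k))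
        ; {suc j} {zero}  eq → contradiction eq (<⇒≢ (at< s j))
        ; {suc j} {suc k} eq → cong suc (at-injective s eq) }
    }

  drop : ∀ {t h} → Fin (suc h) → Stack t (suc h) → Stack t h
  drop j s = record
    { at           = λ k → at s (punchIn j k)
    ; at<          = λ k → at< s (punchIn j k)
    ; at-injective = λ eq → punchIn-injective j _ _ (at-injective s eq)
    }

  empty : Stack 0 0
  empty = record { at = λ () ; at< = λ () ; at-injective = λ { {()} } }

  punchIn-view : ∀ {h} (j k : Fin (suc h)) → k ≡ j ⊎ ∃ λ k′ → k ≡ punchIn j k′
  punchIn-view j k with j ≟ᶠ k
  ... | yes j≡k = inj₁ (sym j≡k)
  ... | no j≢k  = inj₂ (punchOut j≢k , sym (punchIn-punchOut j≢k))

  infix 4 _∉_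
  _∉_ : ∀ {t h} → ℕ → Stack t h → Set
  i ∉ s = ∀ k → at s k ≢ i

  -- Appending the point t to the block that ends at p composes the permutation
  -- with the transposition (p t) on the right.
  permute : ∀ {t h n} → Stack t h → Path h n → ℕ → ℕ
  permute s end           = id
  permute s (singleton w) = permute (skip s) w
  permute s (first w)     = permute (add s) w
  permute {t} s (middle j w) = swap (at s j) t ∘ permute (add (drop j s)) w
  permute {t} s (last j w)   = swap (at s j) t ∘ permute (skip (drop j s)) w

  permute⁻¹ : ∀ {t h n} → Stack t h → Path h n → ℕ → ℕ
  permute⁻¹ s end           = id
  permute⁻¹ s (singleton w) = permute⁻¹ (skip s) w
  permute⁻¹ s (first w)     = permute⁻¹ (add s) w
  permute⁻¹ {t} s (middle j w) = permute⁻¹ (add (drop j s)) w ∘ swap (at s j) t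
  permute⁻¹ {t} s (last j w)   = permute⁻¹ (skip (drop j s)) w ∘ swap (at s j) t

  permute-inverseˡ : ∀ {t h n} (s : Stack t h) (w : Path h n) i → permute⁻¹ s w (permute s w i) ≡ i
  permute-inverseˡ s end           i = refl
  permute-inverseˡ s (singleton w) i = permute-inverseˡ (skip s) w i
  permute-inverseˡ s (first w)     i = permute-inverseˡ (add s) w i
  permute-inverseˡ {t} s (middle j w) i =
    trans (cong (permute⁻¹ (add (drop j s)) w) (swap-involutive (at s j) t _)) (permute-inverseˡ (add (drop j s)) w i)
  permute-inverseˡ {t} s (last j w) i =
    trans (cong (permute⁻¹ (skip (drop j s)) w) (swap-involutive (at s j) t _)) (permute-inverseˡ (skip (drop j s)) w i)

  permute-inverseʳ : ∀ {t h n} (s : Stack t h) (w : Path h n) i → permute s w (permute⁻¹ s w i) ≡ i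
  permute-inverseʳ s end           i = refl
  permute-inverseʳ s (singleton w) i = permute-inverseʳ (skip s) w i
  permute-inverseʳ s (first w)     i = permute-inverseʳ (add s) w i
  permute-inverseʳ {t} s (middle j w) i =
    trans (cong (swap (at s j) t) (permute-inverseʳ (add (drop j s)) w _)) (swap-involutive (at s j) t i)
  permute-inverseʳ {t} s (last j w) i =
    trans (cong (swap (at s j) t) (permute-inverseʳ (skip (drop j s)) w _)) (swap-involutive (at s j) t i)

  private
    t<t+1+n : ∀ t n → t < t + suc n
    t<t+1+n t n = m<m+n t (s≤s z≤n)

    <-+-suc : ∀ {i} t n → i < t + suc n → i < suc t + n
    <-+-suc {i} t n = subst (i <_) (+-suc t n)

    <-+-suc⁻¹ : ∀ {i} t n → i < suc t + n → i < t + suc n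
    <-+-suc⁻¹ {i} t n = subst (i <_) (sym (+-suc t n))

  permute-< : ∀ {t h n} (s : Stack t h) (w : Path h n) {i} → i < t + n → permute s w i < t + n
  permute-< s end i<m = i<m
  permute-< {t} {n = suc n} s (singleton w) i<m rewrite +-suc t n = permute-< (skip s) w i<m
  permute-< {t} {n = suc n} s (first w)     i<m rewrite +-suc t n = permute-< (add s) w i<m
  permute-< {t} {n = suc n} s (middle j w) i<m = swap-< _ (<-trans (at< s j) (t<t+1+n t n)) (t<t+1+n t n)
    (<-+-suc⁻¹ t n (permute-< (add (drop j s)) w (<-+-suc t n i<m)))
  permute-< {t} {n = suc n} s (last j w) i<m = swap-< _ (<-trans (at< s j) (t<t+1+n t n)) (t<t+1+n t n)
    (<-+-suc⁻¹ t n (permute-< (skip (drop j s)) w (<-+-suc t n i<m)))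

  permute⁻¹-< : ∀ {t h n} (s : Stack t h) (w : Path h n) {i} → i < t + n → permute⁻¹ s w i < t + n
  permute⁻¹-< s end i<m = i<m
  permute⁻¹-< {t} {n = suc n} s (singleton w) i<m rewrite +-suc t n = permute⁻¹-< (skip s) w i<m
  permute⁻¹-< {t} {n = suc n} s (first w)     i<m rewrite +-suc t n = permute⁻¹-< (add s) w i<m
  permute⁻¹-< {t} {n = suc n} s (middle j w) {i} i<m =
    <-+-suc⁻¹ t n (permute⁻¹-< (add (drop j s)) w (<-+-suc t n
      (swap-< i (<-trans (at< s j) (t<t+1+n t n)) (t<t+1+n t n) i<m)))
  permute⁻¹-< {t} {n = suc n} s (last j w) {i} i<m =
    <-+-suc⁻¹ t n (permute⁻¹-< (skip (drop j s)) w (<-+-suc t n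
      (swap-< i (<-trans (at< s j) (t<t+1+n t n)) (t<t+1+n t n) i<m)))

  ∉-skip-drop : ∀ {t h} (s : Stack t (suc h)) j → at s j ∉ skip (drop j s)
  ∉-skip-drop s j k eq = punchInᵢ≢i j k (at-injective s eq)

  ∉-add-drop : ∀ {t h} (s : Stack t (suc h)) j → at s j ∉ add (drop j s)
  ∉-add-drop s j zero    eq = <⇒≢ (at< s j) (sym eq)
  ∉-add-drop s j (suc k) eq = ∉-skip-drop s j k eq

  t∉skip : ∀ {t h} (s : Stack t h) → t ∉ skip s
  t∉skip s k = <⇒≢ (at< s k)

  -- The remaining transpositions only involve the last points of open blocks and points that are
  -- not yet read.
  permute-fix : ∀ {t h n} (s : Stack t h) (w : Path h n) {i} → i < t → i ∉ s → permute s w i ≡ i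
  permute-fix s end           i<t i∉s = refl
  permute-fix s (singleton w) i<t i∉s = permute-fix (skip s) w (m<n⇒m<1+n i<t) i∉s
  permute-fix s (first w)     i<t i∉s =
    permute-fix (add s) w (m<n⇒m<1+n i<t) λ { zero eq → <⇒≢ i<t (sym eq) ; (suc k) → i∉s k }
  permute-fix s (middle j w) i<t i∉s = trans (cong (swap _ _)
    (permute-fix (add (drop j s)) w (m<n⇒m<1+n i<t) λ { zero eq → <⇒≢ i<t (sym eq) ; (suc k) → i∉s _ }))
    (swap-other (i∉s j ∘ sym) (<⇒≢ i<t))
  permute-fix s (last j w) i<t i∉s = trans (cong (swap _ _)
    (permute-fix (skip (drop j s)) w (m<n⇒m<1+n i<t) (i∉s ∘ punchIn j)))
    (swap-other (i∉s j ∘ sym) (<⇒≢ i<t))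

  mutual
    -- An open block has to be continued, and its last point is sent to the next point of the block,
    -- which is still unread.
    permute-stack : ∀ {t h n} (s : Stack t h) (w : Path h n) k → t ≤ permute s w (at s k)
    permute-stack s (singleton w) k = <⇒≤ (permute-stack (skip s) w k)
    permute-stack s (first w)     k = <⇒≤ (permute-stack (add s) w (suc k))
    permute-stack s (middle j w)  k with punchIn-view j k
    ... | inj₁ refl        = ≤-reflexive (sym (permute-middle s j w))
    ... | inj₂ (k′ , refl) = <⇒≤ (permute-middle-other s j w k′)
    permute-stack s (last j w)    k with punchIn-view j k
    ... | inj₁ refl        = ≤-reflexive (sym (permute-last s j w))
    ... | inj₂ (k′ , refl) = <⇒≤ (permute-last-other s j w k′)

    permute-middle : ∀ {t h n} (s : Stack t (suc h)) j (w : Path (suc h) n) → permute s (middle j w) (at s j) ≡ t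
    permute-middle s j w = trans (cong (swap _ _)
      (permute-fix (add (drop j s)) w (m<n⇒m<1+n (at< s j)) (∉-add-drop s j))) (swap-left (at s j) _)

    permute-last : ∀ {t h n} (s : Stack t (suc h)) j (w : Path h n) → permute s (last j w) (at s j) ≡ t
    permute-last s j w = trans (cong (swap _ _)
      (permute-fix (skip (drop j s)) w (m<n⇒m<1+n (at< s j)) (∉-skip-drop s j))) (swap-left (at s j) _)

    swap-> : ∀ {a b i} → a < b → b < i → swap a b i ≡ i
    swap-> a<b b<i = swap-other (>⇒≢ (<-trans a<b b<i)) (>⇒≢ b<i)

    permute-middle-other : ∀ {t h n} (s : Stack t (suc h)) j (w : Path (suc h) n) k →
      t < permute s (middle j w) (at s (punchIn j k))
    permute-middle-other s j w k = subst (_ <_) (sym (swap-> (at< s j) t<)) t<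
      where t< = permute-stack (add (drop j s)) w (suc k)

    permute-last-other : ∀ {t h n} (s : Stack t (suc h)) j (w : Path h n) k →
      t < permute s (last j w) (at s (punchIn j k))
    permute-last-other s j w k = subst (_ <_) (sym (swap-> (at< s j) t<)) t<
      where t< = permute-stack (skip (drop j s)) w k

  permute-singleton-t : ∀ {t h n} (s : Stack t h) (w : Path h n) → permute s (singleton w) t ≡ t
  permute-singleton-t s w = permute-fix (skip s) w ≤-refl (t∉skip s)

  permute-first-t : ∀ {t h n} (s : Stack t h) (w : Path (suc h) n) → t < permute s (first w) t
  permute-first-t s w = permute-stack (add s) w zero

  permute-middle-t : ∀ {t h n} (s : Stack t (suc h)) j (w : Path (suc h) n) → t < permute s (middle j w) t
  permute-middle-t s j w = subst (_ <_) (sym (swap-> (at< s j) t<)) t<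
    where t< = permute-stack (add (drop j s)) w zero

  permute-last-t : ∀ {t h n} (s : Stack t (suc h)) j (w : Path h n) → permute s (last j w) t ≡ at s j
  permute-last-t {t} s j w = trans (cong (swap _ _)
    (permute-fix (skip (drop j s)) w ≤-refl (t∉skip (drop j s)))) (swap-right (at s j) t)

  private
    unswap : ∀ a b {f g : ℕ → ℕ} → (∀ i → swap a b (f i) ≡ swap a b (g i)) → ∀ i → f i ≡ g i
    unswap a b {f} {g} eq i =
      trans (sym (swap-involutive a b (f i))) (trans (cong (swap a b) (eq i)) (swap-involutive a b (g i)))

  -- The step at `t` can be read off the permutation. It is `middle j` or `last j` exactly if some
  -- open point `at s j` is sent to `t`, and this point determines `j`; within either group, the
  -- image of `t` compared with `t` decides.
  permute-injective : ∀ {t h n} (s : Stack t h) (w w′ : Path h n) →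
    (∀ i → permute s w i ≡ permute s w′ i) → w ≡ w′
  permute-injective s end end eq = refl
  permute-injective s (singleton w) (singleton w′) eq = cong singleton (permute-injective (skip s) w w′ eq)
  permute-injective s (first w) (first w′) eq = cong first (permute-injective (add s) w w′ eq)
  permute-injective {t} s (singleton w) (first w′) eq =
    contradiction (trans (sym (permute-singleton-t s w)) (eq t)) (<⇒≢ (permute-first-t s w′))
  permute-injective {t} s (first w) (singleton w′) eq =
    contradiction (trans (sym (permute-singleton-t s w′)) (sym (eq t))) (<⇒≢ (permute-first-t s w))
  permute-injective s (singleton w) (middle j w′) eq =
    contradiction (trans (sym (permute-middle s j w′)) (sym (eq _))) (<⇒≢ (permute-stack (skip s) w j))
  permute-injective s (middle j w) (singleton w′) eq =
    contradiction (trans (sym (permute-middle s j w)) (eq _)) (<⇒≢ (permute-stack (skip s) w′ j))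
  permute-injective s (singleton w) (last j w′) eq =
    contradiction (trans (sym (permute-last s j w′)) (sym (eq _))) (<⇒≢ (permute-stack (skip s) w j))
  permute-injective s (last j w) (singleton w′) eq =
    contradiction (trans (sym (permute-last s j w)) (eq _)) (<⇒≢ (permute-stack (skip s) w′ j))
  permute-injective s (first w) (middle j w′) eq =
    contradiction (trans (sym (permute-middle s j w′)) (sym (eq _))) (<⇒≢ (permute-stack (add s) w (suc j)))
  permute-injective s (middle j w) (first w′) eq =
    contradiction (trans (sym (permute-middle s j w)) (eq _)) (<⇒≢ (permute-stack (add s) w′ (suc j)))
  permute-injective s (first w) (last j w′) eq =
    contradiction (trans (sym (permute-last s j w′)) (sym (eq _))) (<⇒≢ (permute-stack (add s) w (suc j)))
  permute-injective s (last j w) (first w′) eq =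
    contradiction (trans (sym (permute-last s j w)) (eq _)) (<⇒≢ (permute-stack (add s) w′ (suc j)))
  permute-injective {t} s (middle j w) (last j′ w′) eq =
    contradiction (trans (sym (permute-last-t s j′ w′)) (sym (eq t))) (<⇒≢ (<-trans (at< s j′) (permute-middle-t s j w)))
  permute-injective {t} s (last j w) (middle j′ w′) eq =
    contradiction (trans (sym (permute-last-t s j w)) (eq t)) (<⇒≢ (<-trans (at< s j) (permute-middle-t s j′ w′)))
  permute-injective {t} s (middle j w) (middle j′ w′) eq with punchIn-view j j′
  ... | inj₁ refl        = cong (middle j) (permute-injective (add (drop j s)) w w′ (unswap (at s j) t eq))
  ... | inj₂ (k′ , refl) =
    contradiction (trans (sym (permute-middle s j′ w′)) (sym (eq _))) (<⇒≢ (permute-middle-other s j w k′))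
  permute-injective {t} s (last j w) (last j′ w′) eq with punchIn-view j j′
  ... | inj₁ refl        = cong (last j) (permute-injective (skip (drop j s)) w w′ (unswap (at s j) t eq))
  ... | inj₂ (k′ , refl) =
    contradiction (trans (sym (permute-last s j′ w′)) (sym (eq _))) (<⇒≢ (permute-last-other s j w k′))

-- Permutations with a single descent on each cycle come from paths

module Encoding where

  open import Data.Fin.Base using (zero; suc; punchIn)
  open import Data.Fin.Properties using (punchInᵢ≢i)
  open import Data.Nat.Base
  open import Data.Nat.Properties
  open import Data.Nat.GeneralisedArithmetic using (fold)
  open import Data.Product.Base using (∃; _×_; _,_; proj₁; proj₂)
  open import Data.Sum.Base using (_⊎_; inj₁; inj₂)
  open import Function.Base using (_∘_; id)
  open import Relation.Binary.PropositionalEquality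
  open import Relation.Nullary using (contradiction; yes; no)
  open BlockPaths

  swap-injective : ∀ a b {i j} → swap a b i ≡ swap a b j → i ≡ j
  swap-injective a b {i} {j} eq =
    trans (sym (swap-involutive a b i)) (trans (cong (swap a b) eq) (swap-involutive a b j))

  <-split : ∀ {i t} → i < suc t → i ≡ t ⊎ i < t
  <-split (s≤s i≤t) with m≤n⇒m<n∨m≡n i≤t
  ... | inj₁ i<t = inj₂ i<t
  ... | inj₂ i≡t = inj₁ i≡t

  assign : ∀ {A : Set} → ℕ → A → (ℕ → A) → ℕ → A
  assign t a f i with i ≟ t
  ... | yes _ = a
  ... | no _  = f i

  assign-≡ : ∀ {A : Set} t (a : A) f → assign t a f t ≡ a
  assign-≡ t a f with t ≟ t
  ... | yes _  = refl
  ... | no t≢t = contradiction refl t≢t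

  assign-≢ : ∀ {A : Set} {t i} {a : A} {f} → i ≢ t → assign t a f i ≡ f i
  assign-≢ {t = t} {i} i≢t with i ≟ t
  ... | yes i≡t = contradiction i≡t i≢t
  ... | no _    = refl

  -- ℓ is constant on the cycles of f, and every cycle has a single descent,
  -- which leads to its label
  record Labelling (f ℓ : ℕ → ℕ) : Set where
    field
      invariant : ∀ i → ℓ (f i) ≡ ℓ i
      descent   : ∀ i → f i ≤ i → f i ≡ ℓ i
  open Labelling public

  private
    -- Here `f` is the permutation of the points read so far, in which every open block is
    -- provisionally closed to a cycle; by `stack`, its last point is the place of the descent.
    record Labelled {t h} (s : Stack t h) (f ℓ : ℕ → ℕ) : Set where
      field
        labelling  : Labelling f ℓ
        injective  : ∀ {i j} → f i ≡ f j → i ≡ j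
        fixed      : f t ≡ t
        fixed-next : ∀ i → t < i → f i ≡ i
        stack      : ∀ k → f (at s k) ≤ at s k
    open Labelled

    -- Inserting `t` after `p` in its cycle turns the descent from `p` to `f p` into the ascent from
    -- `p` to `t` followed by the descent from `t` to `f p`. The cycle still has one descent, with
    -- the same target.
    join : ∀ {t h} {s : Stack t (suc h)} {f ℓ} j → Labelled s f ℓ →
      let f′ = f ∘ swap (at s j) t; ℓ′ = assign t (ℓ (at s j)) ℓ in
      Labelled (skip (drop j s)) f′ ℓ′ × f′ t ≤ t
    join {t} {s = s} {f} {ℓ} j l = record
      { labelling  = record { invariant = inv ; descent = desc }
      ; injective  = swap-injective p t ∘ injective l
      ; fixed      = trans (cong f (swap-other (>⇒≢ (m<n⇒m<1+n p<t)) (>⇒≢ ≤-refl))) (fixed-next l (suc t) ≤-refl)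
      ; fixed-next = λ i t<i → trans (cong f (swap-other (>⇒≢ (<-trans p<t (<-trans ≤-refl t<i))) (>⇒≢ (<-trans ≤-refl t<i))))
                                     (fixed-next l i (<-trans ≤-refl t<i))
      ; stack      = λ k → subst (_≤ at s (punchIn j k)) (sym (cong f (swap-other
                       (punchInᵢ≢i j k ∘ at-injective s) (<⇒≢ (at< s _))))) (stack l (punchIn j k))
      } , subst (_≤ t) (sym f′t) (<⇒≤ fp<t)
      where
      p = at s j
      p<t = at< s j
      fp<t = ≤-<-trans (stack l j) p<t
      f′ = f ∘ swap p t
      f′t : f′ t ≡ f p
      f′t = cong f (swap-right p t)
      f′p : f′ p ≡ t
      f′p = trans (cong f (swap-left p t)) (fixed l)
      f′-other : ∀ {i} → i ≢ p → i ≢ t → f′ i ≡ f i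
      f′-other i≢p i≢t = cong f (swap-other i≢p i≢t)
      ℓ′ = assign t (ℓ p) ℓ
      f≢t : ∀ {i} → i ≢ t → f i ≢ t
      f≢t i≢t eq = i≢t (injective l (trans eq (sym (fixed l))))
      inv : ∀ i → ℓ′ (f′ i) ≡ ℓ′ i
      inv i = go (i ≟ t) (i ≟ p)
        where
        go : _ → _ → ℓ′ (f′ i) ≡ ℓ′ i
        go (yes refl) _ = trans (trans (cong ℓ′ f′t) (trans (assign-≢ (<⇒≢ fp<t)) (invariant (labelling l) p)))
          (sym (assign-≡ t (ℓ p) ℓ))
        go (no i≢t) (yes refl) = trans (cong ℓ′ f′p) (trans (assign-≡ t (ℓ p) ℓ) (sym (assign-≢ i≢t)))
        go (no i≢t) (no i≢p) = trans (cong ℓ′ (f′-other i≢p i≢t))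
          (trans (assign-≢ (f≢t i≢t)) (trans (invariant (labelling l) i) (sym (assign-≢ i≢t))))
      desc : ∀ i → f′ i ≤ i → f′ i ≡ ℓ′ i
      desc i le = go (i ≟ t) (i ≟ p)
        where
        go : _ → _ → f′ i ≡ ℓ′ i
        go (yes refl) _ = trans f′t (trans (descent (labelling l) p (stack l j)) (sym (assign-≡ t (ℓ p) ℓ)))
        go (no i≢t) (yes refl) = contradiction (subst (_≤ i) f′p le) (<⇒≱ p<t)
        go (no i≢t) (no i≢p) = trans (f′-other i≢p i≢t) (trans
          (descent (labelling l) i (subst (_≤ i) (f′-other i≢p i≢t) le)) (sym (assign-≢ i≢t)))

    skip-labelled : ∀ {t h} {s : Stack t h} {f ℓ} → Labelled s f ℓ → Labelled (skip s) f ℓ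
    skip-labelled l = record
      { labelling = labelling l ; injective = injective l ; fixed = fixed-next l _ ≤-refl
      ; fixed-next = λ i t<i → fixed-next l i (<-trans ≤-refl t<i) ; stack = stack l }

    add-labelled : ∀ {t h} {s : Stack t h} {f ℓ} → Labelled (skip s) f ℓ → f t ≤ t → Labelled (add s) f ℓ
    add-labelled l ft≤t = record
      { labelling = labelling l ; injective = injective l ; fixed = fixed l ; fixed-next = fixed-next l
      ; stack = λ { zero → ft≤t ; (suc k) → stack l k } }

    label : ∀ {t h n} {s : Stack t h} (w : Path h n) {f ℓ} → Labelled s f ℓ → ∃ (Labelling (f ∘ permute s w))
    label end           l = _ , labelling l
    label (singleton w) l = label w (skip-labelled l)
    label (first w)     l = label w (add-labelled (skip-labelled l) (≤-reflexive (fixed l)))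
    label (middle j w)  l = label w (add-labelled (proj₁ (join j l)) (proj₂ (join j l)))
    label (last j w)    l = label w (proj₁ (join j l))

  permute-labelling : ∀ {n} (w : Path 0 n) → ∃ (Labelling (permute empty w))
  permute-labelling w = label {s = empty} w {id} {id} record
    { labelling = record { invariant = λ _ → refl ; descent = λ _ _ → refl }
    ; injective = id ; fixed = refl ; fixed-next = λ _ _ → refl ; stack = λ () }

  Reaches : (ℕ → ℕ) → ℕ → ℕ → Set
  Reaches a m i = ∃ λ k → fold m a k ≡ i

  -- A permutation all of whose cycles have a single descent comes from a path.
  module Encode {N} {a b : ℕ → ℕ} (a∘b : ∀ i → a (b i) ≡ i) (b∘a : ∀ i → b (a i) ≡ i)
    (a< : ∀ {i} → i < N → a i < N)
    -- `m ≤ b m` says that `m` is entered by a descent; any descent on the cycle of `m` then leads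
    -- to `m`.
    (single : ∀ {m i} → Reaches a m i → m ≤ b m → a i ≤ i → a i ≡ m) where

    private
      -- `f` agrees with `a` on the finished points and closes each open block to a cycle, so its
      -- value at the last point of an open block is the first point of that block. The fields
      -- `least` and `reach` store what `single` requires of this first point once the block is
      -- completed.
      record Invariant {t h} (s : Stack t h) (f : ℕ → ℕ) : Set where
        field
          unread : ∀ i → t ≤ i → f i ≡ i
          later  : ∀ k → t ≤ a (at s k)
          least  : ∀ k → f (at s k) ≤ b (f (at s k))
          reach  : ∀ k → Reaches a (f (at s k)) (at s k)
          open-  : ∀ i → i < t → t ≤ a i → ∃ λ k → at s k ≡ i
          done   : ∀ i → i < t → i ∉ s → f i ≡ a i
      open Invariant

      Reaches-next : ∀ {m i j} → a i ≡ j → Reaches a m i → Reaches a m j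
      Reaches-next refl (k , refl) = suc k , refl

      skip-invariant : ∀ {t h} {s : Stack t h} {f} → Invariant s f → a t ≡ t → Invariant (skip s) f
      skip-invariant {t} {s = s} inv at≡t = record
        { unread = λ i t<i → unread inv i (<⇒≤ t<i)
        ; later  = λ k → ≤∧≢⇒< (later inv k) λ eq →
            <⇒≢ (at< s k) (trans (sym (b∘a _)) (trans (cong b (trans (sym eq) (sym at≡t))) (b∘a t)))
        ; least  = least inv ; reach = reach inv
        ; open-  = opn
        ; done   = dn
        }
        where
        opn : ∀ i → i < suc t → suc t ≤ a i → ∃ λ k → at s k ≡ i
        opn i i<1+t t<ai with <-split i<1+t
        ... | inj₁ refl = contradiction (sym at≡t) (<⇒≢ t<ai)
        ... | inj₂ i<t  = open- inv i i<t (<⇒≤ t<ai)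
        dn : ∀ i → i < suc t → i ∉ skip s → _ ≡ a i
        dn i i<1+t i∉s with <-split i<1+t
        ... | inj₁ refl = trans (unread inv t ≤-refl) (sym at≡t)
        ... | inj₂ i<t  = done inv i i<t i∉s

      add-invariant : ∀ {t h} {s : Stack t h} {f} → Invariant s f → t ≤ b t → t < a t → Invariant (add s) f
      add-invariant {t} {s = s} {f} inv t≤bt t<at = record
        { unread = λ i t<i → unread inv i (<⇒≤ t<i)
        ; later  = λ { zero → t<at ; (suc k) → ≤∧≢⇒< (later inv k) λ eq →
            <⇒≱ (at< s k) (≤-trans t≤bt (≤-reflexive (trans (cong b eq) (b∘a _)))) }
        ; least  = λ { zero → subst (λ m → m ≤ b m) (sym ft) t≤bt ; (suc k) → least inv k }
        ; reach  = λ { zero → 0 , ft ; (suc k) → reach inv k }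
        ; open-  = opn
        ; done   = dn
        }
        where
        ft = unread inv t ≤-refl
        opn : ∀ i → i < suc t → suc t ≤ a i → ∃ λ k → at (add s) k ≡ i
        opn i i<1+t t<ai with <-split i<1+t
        ... | inj₁ refl = zero , refl
        ... | inj₂ i<t  = let k , eq = open- inv i i<t (<⇒≤ t<ai) in suc k , eq
        dn : ∀ i → i < suc t → i ∉ add s → _ ≡ a i
        dn i i<1+t i∉s with <-split i<1+t
        ... | inj₁ refl = contradiction refl (i∉s zero)
        ... | inj₂ i<t  = done inv i i<t (i∉s ∘ suc)

      module Join {t h} {s : Stack t (suc h)} {f} (inv : Invariant s f) j (ap≡t : a (at s j) ≡ t) where
        p = at s j
        f′ = f ∘ swap p t

        f′t : f′ t ≡ f p
        f′t = cong f (swap-right p t)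

        other : ∀ k → f′ (at s (punchIn j k)) ≡ f (at s (punchIn j k))
        other k = cong f (swap-other (punchInᵢ≢i j k ∘ at-injective s) (<⇒≢ (at< s _)))

        later′ : ∀ k → t < a (at s (punchIn j k))
        later′ k = ≤∧≢⇒< (later inv (punchIn j k)) λ eq → punchInᵢ≢i j k (at-injective s
          (trans (sym (b∘a _)) (trans (cong b (trans (sym eq) (sym ap≡t))) (b∘a _))))

        reach-t : Reaches a (f′ t) t
        reach-t = Reaches-next ap≡t (subst (λ m → Reaches a m p) (sym f′t) (reach inv j))

        least-t : f′ t ≤ b (f′ t)
        least-t = subst (λ m → m ≤ b m) (sym f′t) (least inv j)

        open-old : ∀ i → i < t → t < a i → ∃ λ k → at s (punchIn j k) ≡ i
        open-old i i<t t<ai with open- inv i i<t (<⇒≤ t<ai)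
        ... | k , refl with punchIn-view j k
        ...   | inj₁ refl        = contradiction (sym ap≡t) (<⇒≢ t<ai)
        ...   | inj₂ (k′ , refl) = k′ , refl

        done-old : ∀ i → i < t → (∀ k → at s (punchIn j k) ≢ i) → f′ i ≡ a i
        done-old i i<t i∉ = go (i ≟ p)
          where
          i∉s : i ≢ p → i ∉ s
          i∉s i≢p k eq with punchIn-view j k
          ... | inj₁ refl        = i≢p (sym eq)
          ... | inj₂ (k′ , refl) = i∉ k′ eq
          go : _ → f′ i ≡ a i
          go (yes refl) = trans (cong f (swap-left p t)) (trans (unread inv t ≤-refl) (sym ap≡t))
          go (no i≢p)   = trans (cong f (swap-other i≢p (<⇒≢ i<t))) (done inv i i<t (i∉s i≢p))

        unread′ : ∀ i → t < i → f′ i ≡ i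
        unread′ i t<i = trans (cong f (swap-other (>⇒≢ (<-trans (at< s j) t<i)) (>⇒≢ t<i))) (unread inv i (<⇒≤ t<i))

        last-invariant : a t ≤ t → Invariant (skip (drop j s)) f′
        last-invariant at≤t = record
          { unread = unread′
          ; later  = later′
          ; least  = λ k → subst (λ m → m ≤ b m) (sym (other k)) (least inv _)
          ; reach  = λ k → subst (λ m → Reaches a m _) (sym (other k)) (reach inv _)
          ; open-  = opn
          ; done   = dn
          }
          where
          opn : ∀ i → i < suc t → suc t ≤ a i → ∃ λ k → at s (punchIn j k) ≡ i
          opn i i<1+t t<ai with <-split i<1+t
          ... | inj₁ refl = contradiction at≤t (<⇒≱ t<ai)
          ... | inj₂ i<t  = open-old i i<t t<ai
          dn : ∀ i → i < suc t → i ∉ skip (drop j s) → f′ i ≡ a i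
          dn i i<1+t i∉s with <-split i<1+t
          -- The block ends at `t`, so `a` descends there, and `single` shows that it leads to the
          -- first point of the block, which is `f′ t`.
          ... | inj₁ refl = sym (single reach-t least-t at≤t)
          ... | inj₂ i<t  = done-old i i<t i∉s

        middle-invariant : t < a t → Invariant (add (drop j s)) f′
        middle-invariant t<at = record
          { unread = unread′
          ; later  = λ { zero → t<at ; (suc k) → later′ k }
          ; least  = λ { zero → least-t ; (suc k) → subst (λ m → m ≤ b m) (sym (other k)) (least inv _) }
          ; reach  = λ { zero → reach-t ; (suc k) → subst (λ m → Reaches a m _) (sym (other k)) (reach inv _) }
          ; open-  = opn
          ; done   = dn
          }
          where
          opn : ∀ i → i < suc t → suc t ≤ a i → ∃ λ k → at (add (drop j s)) k ≡ i
          opn i i<1+t t<ai with <-split i<1+t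
          ... | inj₁ refl = zero , refl
          ... | inj₂ i<t  = let k , eq = open-old i i<t t<ai in suc k , eq
          dn : ∀ i → i < suc t → i ∉ add (drop j s) → f′ i ≡ a i
          dn i i<1+t i∉s with <-split i<1+t
          ... | inj₁ refl = contradiction refl (i∉s zero)
          ... | inj₂ i<t  = done-old i i<t (i∉s ∘ suc)

      encode : ∀ {t h} n {s : Stack t h} {f} → t + n ≡ N → Invariant s f →
        ∃ λ (w : Path h n) → ∀ i → i < N → f (permute s w i) ≡ a i
      encode {t} {zero}  zero eq inv =
        end , λ i i<N → done inv i (subst (i <_) (trans (sym eq) (+-identityʳ t)) i<N) λ ()
      encode {t} {suc h} zero {s} eq inv = contradiction (later inv zero)
        (<⇒≱ (subst (a (at s zero) <_) N≡t (a< (subst (at s zero <_) (sym N≡t) (at< s zero)))))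
        where
        N≡t : N ≡ t
        N≡t = trans (sym eq) (+-identityʳ t)
      -- The point `t` continues an open block if `b t < t`, and it is the last point of its block
      -- if `a t ≤ t`.
      encode {t} (suc n) {s} eq inv with b t <? t | a t ≤? t
      ... | no bt≮t | yes at≤t =
        let w , h = encode n (trans (sym (+-suc t n)) eq)
              (skip-invariant inv (single (0 , refl) (≮⇒≥ bt≮t) at≤t))
        in singleton w , h
      ... | no bt≮t | no at≰t =
        let w , h = encode n (trans (sym (+-suc t n)) eq) (add-invariant inv (≮⇒≥ bt≮t) (≰⇒> at≰t))
        in first w , h
      encode {t} {h} (suc n) {s} eq inv | yes bt<t | d
        with open- inv (b t) bt<t (≤-reflexive (sym (a∘b t)))
      encode {t} {suc h} (suc n) {s} eq inv | yes bt<t | yes at≤t | j , p≡ =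
        let w , h = encode n (trans (sym (+-suc t n)) eq)
              (Join.last-invariant inv j (trans (cong a p≡) (a∘b t)) at≤t)
        in last j w , h
      encode {t} {suc h} (suc n) {s} eq inv | yes bt<t | no at≰t | j , p≡ =
        let w , h = encode n (trans (sym (+-suc t n)) eq)
              (Join.middle-invariant inv j (trans (cong a p≡) (a∘b t)) (≰⇒> at≰t))
        in middle j w , h

    encoding : ∃ λ (w : Path 0 N) → ∀ i → i < N → permute empty w i ≡ a i
    encoding = encode N {empty} {id} refl record
      { unread = λ _ _ → refl ; later = λ () ; least = λ () ; reach = λ ()
      ; open- = λ _ () ; done = λ _ () }

-- Counting by relations, and counting two-colourings

module Counting where

  open import Data.Bool.Base using (Bool; true; false; if_then_else_)
  open import Data.Bool.Properties using () renaming (_≟_ to _≟ᵇ_)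
  open import Data.Fin.Base as Fin using (Fin; zero; suc)
  import Data.Fin.Properties as Fin
  open import Data.Fin.Subset using (∣_∣)
  open import Data.List.Base using (List; []; _∷_; _++_; length; filter; tabulate; deduplicate)
  open import Data.List.Membership.Propositional using (_∈_; _∉_)
  open import Data.List.Membership.Propositional.Properties
    using (∈-∃++; ∈-++⁻; ∈-++⁺ˡ; ∈-++⁺ʳ; ∈-deduplicate⁺; ∈-deduplicate⁻; ∈-tabulate⁺; ∈-tabulate⁻)
  open import Data.List.Properties using (length-++)
  open import Data.List.Relation.Unary.All as All using (All)
  import Data.List.Relation.Unary.All.Properties as All
  open import Data.List.Relation.Unary.AllPairs using (AllPairs; []; _∷_)
  open import Data.List.Relation.Unary.Any using (here; there)
  open import Data.List.Relation.Unary.Unique.Propositional using (Unique)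
  open import Data.List.Relation.Unary.Unique.DecPropositional.Properties using (deduplicate-!)
  open import Data.Nat.Base
  open import Data.Nat.Properties
  open import Data.Product.Base using (∃; _×_; _,_)
  open import Data.Sum.Base using (inj₁; inj₂)
  open import Data.Vec.Base as Vec using (Vec; []; _∷_; lookup)
  open import Function.Base using (_∘_)
  open import Relation.Binary.Definitions using (DecidableEquality)
  open import Relation.Binary.PropositionalEquality
  open import Relation.Nullary using (¬_; Dec; does; yes; no; contradiction)
  open import Relation.Nullary.Decidable using (_→-dec_; _×-dec_; dec-false)
  open import Relation.Unary using (Decidable)
  import Data.List.Membership.DecPropositional as DecMembership

  -- The pigeonhole principle for a relation `R` instead of a function, with distinctness up to `~`:
  -- permutations are only compared pointwise.
  length-≤ : ∀ {A B : Set} {_~_ : A → A → Set} (R : A → B → Set) (xs : List A) (ys : List B) →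
    AllPairs (λ x x′ → ¬ x ~ x′) xs → (∀ {x} → x ∈ xs → ∃ λ y → y ∈ ys × R x y) →
    (∀ {x x′ y} → x ∈ xs → x′ ∈ xs → R x y → R x′ y → x ~ x′) → length xs ≤ length ys
  length-≤ R []       ys _              _     _   = z≤n
  length-≤ {_~_ = _~_} R (x ∷ xs) ys (x≁xs ∷ dist) match inj with match (here refl)
  ... | y , y∈ys , Rxy with ∈-∃++ y∈ys
  ...   | as , bs , refl = ≤-trans (s≤s (length-≤ R xs (as ++ bs) dist match′
            λ p q → inj (there p) (there q))) (≤-reflexive (sym (begin
              length (as ++ y ∷ bs)       ≡⟨ length-++ as ⟩
              length as + suc (length bs) ≡⟨ +-suc _ _ ⟩
              suc (length as + length bs) ≡⟨ cong suc (length-++ as) ⟨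
              suc (length (as ++ bs))     ∎)))
    where
    open ≡-Reasoning
    match′ : ∀ {x′} → x′ ∈ xs → ∃ λ y′ → y′ ∈ as ++ bs × R x′ y′
    match′ x′∈xs with match (there x′∈xs)
    ... | y′ , y′∈ys , Rx′y′ with ∈-++⁻ as y′∈ys
    ...   | inj₁ y′∈as         = y′ , ∈-++⁺ˡ y′∈as , Rx′y′
    ...   | inj₂ (there y′∈bs) = y′ , ∈-++⁺ʳ as y′∈bs , Rx′y′
    ...   | inj₂ (here refl)   = contradiction (inj (here refl) (there x′∈xs) Rxy Rx′y′) (All.lookup x≁xs x′∈xs)

  Unique-length : ∀ {A : Set} {xs ys : List A} → Unique xs → Unique ys →
    (∀ {a} → a ∈ xs → a ∈ ys) → (∀ {a} → a ∈ ys → a ∈ xs) → length xs ≡ length ys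
  Unique-length {xs = xs} {ys} !xs !ys ⊆ ⊇ = ≤-antisym
    (length-≤ _≡_ xs ys !xs (λ x∈ → _ , ⊆ x∈ , refl) λ { _ _ refl refl → refl })
    (length-≤ _≡_ ys xs !ys (λ x∈ → _ , ⊇ x∈ , refl) λ { _ _ refl refl → refl })

  ∣tabulate∣ : ∀ {n} {A : Set} {P : A → Set} (P? : Decidable P) (f : Fin n → A) →
    ∣ Vec.tabulate (λ i → does (P? (f i))) ∣ ≡ length (filter P? (tabulate f))
  ∣tabulate∣ {zero}  P? f = refl
  ∣tabulate∣ {suc n} P? f with does (P? (f zero))
  ... | true  = cong suc (∣tabulate∣ P? (f ∘ suc))
  ... | false = ∣tabulate∣ P? (f ∘ suc)

  indicator : ∀ {P : Set} → Dec P → ℕ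
  indicator P? = if does P? then 1 else 0

  indicator-cong : ∀ {P Q : Set} (P? : Dec P) (Q? : Dec Q) → (P → Q) → (Q → P) → indicator P? ≡ indicator Q?
  indicator-cong (yes p) (yes q) _ _ = refl
  indicator-cong (yes p) (no ¬q) f _ = contradiction (f p) ¬q
  indicator-cong (no ¬p) (yes q) _ g = contradiction (g q) ¬p
  indicator-cong (no ¬p) (no ¬q) _ _ = refl

  Colouring : ℕ → Set
  Colouring = Vec Bool

  -- Branching on the first entry instead of filtering a list gives the count the recursive form of
  -- `run`.
  count : ∀ {n} {P : Colouring n → Set} → Decidable P → ℕ
  count {zero}  P? = indicator (P? [])
  count {suc n} P? = count (λ v → P? (true ∷ v)) + count (λ v → P? (false ∷ v))

  count-cong : ∀ {n} {P Q : Colouring n → Set} (P? : Decidable P) (Q? : Decidable Q) →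
    (∀ {v} → P v → Q v) → (∀ {v} → Q v → P v) → count P? ≡ count Q?
  count-cong {zero}  P? Q? f g = indicator-cong (P? []) (Q? []) f g
  count-cong {suc n} P? Q? f g = cong₂ _+_
    (count-cong (P? ∘ (true ∷_)) (Q? ∘ (true ∷_)) f g) (count-cong (P? ∘ (false ∷_)) (Q? ∘ (false ∷_)) f g)

  count-none : ∀ {n} {P : Colouring n → Set} (P? : Decidable P) → (∀ {v} → ¬ P v) → count P? ≡ 0
  count-none {zero}  P? ¬p = cong (if_then 1 else 0) (dec-false (P? []) ¬p)
  count-none {suc n} P? ¬p = cong₂ _+_ (count-none (P? ∘ (true ∷_)) ¬p) (count-none (P? ∘ (false ∷_)) ¬p)

  count-split : ∀ {n} {P : Colouring n → Set} (P? : Decidable P) (f : Colouring n → Bool) →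
    count (λ v → P? v ×-dec true ≟ᵇ f v) + count (λ v → P? v ×-dec false ≟ᵇ f v) ≡ count P?
  count-split {zero} P? f with f [] | P? []
  ... | true  | yes _ = refl
  ... | true  | no _  = refl
  ... | false | yes _ = refl
  ... | false | no _  = refl
  count-split {suc n} P? f = begin
    (a true + a false) + (b true + b false)  ≡⟨ interchange (a true) (a false) (b true) (b false) ⟩
    (a true + b true) + (a false + b false)  ≡⟨ cong₂ _+_ (count-split (P? ∘ (true ∷_)) _) (count-split (P? ∘ (false ∷_)) _) ⟩
    count P? ∎
    where
    open ≡-Reasoning
    open import Algebra.Properties.CommutativeSemigroup +-commutativeSemigroup using (interchange)
    a b : Bool → ℕ
    a c = count (λ v → P? (c ∷ v) ×-dec true ≟ᵇ f (c ∷ v))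
    b c = count (λ v → P? (c ∷ v) ×-dec false ≟ᵇ f (c ∷ v))

  module Keys {C : Set} (_≟_ : DecidableEquality C) where

    Factors : ∀ {n} → (Fin n → C) → Colouring n → Set
    Factors c v = ∀ i j → c i ≡ c j → lookup v i ≡ lookup v j

    factors? : ∀ {n} (c : Fin n → C) → Decidable (Factors c)
    factors? c v = Fin.all? λ i → Fin.all? λ j → c i ≟ c j →-dec lookup v i ≟ᵇ lookup v j

    keys : ∀ {n} → (Fin n → C) → List C
    keys c = deduplicate _≟_ (tabulate c)

    open DecMembership _≟_ using (_∈?_)

    private
      keys-! : ∀ {n} (c : Fin n → C) → Unique (keys c)
      keys-! c = deduplicate-! _≟_ (tabulate c)

      ∈-keys⁺ : ∀ {n} {c : Fin n → C} {x} → x ∈ tabulate c → x ∈ keys c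
      ∈-keys⁺ = ∈-deduplicate⁺ _≟_

      ∈-keys⁻ : ∀ {n} {c : Fin n → C} {x} → x ∈ keys c → x ∈ tabulate c
      ∈-keys⁻ = ∈-deduplicate⁻ _≟_ _

      repeated : ∀ {n} (c : Fin (suc n) → C) → c zero ∈ tabulate (c ∘ suc) → length (keys c) ≡ length (keys (c ∘ suc))
      repeated c c₀∈ = Unique-length (keys-! c) (keys-! (c ∘ suc))
        (λ x∈ → ∈-keys⁺ {c = c ∘ suc} (to (∈-keys⁻ {c = c} x∈))) (λ x∈ → ∈-keys⁺ {c = c} (there (∈-keys⁻ {c = c ∘ suc} x∈)))
        where
        to : ∀ {x} → x ∈ tabulate c → x ∈ tabulate (c ∘ suc)
        to (here refl) = c₀∈
        to (there x∈)  = x∈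

      new : ∀ {n} (c : Fin (suc n) → C) → c zero ∉ tabulate (c ∘ suc) → length (keys c) ≡ suc (length (keys (c ∘ suc)))
      new c c₀∉ = Unique-length (keys-! c)
        (All.tabulate (λ { x∈ refl → c₀∉ (∈-keys⁻ {c = c ∘ suc} x∈) }) ∷ keys-! (c ∘ suc))
        (λ x∈ → to (∈-keys⁻ {c = c} x∈)) from
        where
        to : ∀ {x} → x ∈ tabulate c → x ∈ c zero ∷ keys (c ∘ suc)
        to (here refl) = here refl
        to (there x∈)  = there (∈-keys⁺ {c = c ∘ suc} x∈)
        from : ∀ {x} → x ∈ c zero ∷ keys (c ∘ suc) → x ∈ keys c
        from (here refl) = here refl
        from (there x∈)  = ∈-keys⁺ {c = c} (there (∈-keys⁻ {c = c ∘ suc} x∈))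

      Factors-tail : ∀ {n} {c : Fin (suc n) → C} {b v} → Factors c (b ∷ v) → Factors (c ∘ suc) v
      Factors-tail F i j = F (suc i) (suc j)

    -- A colouring that factors through `c` is a colouring of the values of `c`: at an index with a
    -- new value the colour is free, and at a repeated value it is forced.
    count-factors : ∀ {n} (c : Fin n → C) → count (factors? c) ≡ 2 ^ length (keys c)
    count-factors {zero}  c = refl
    count-factors {suc n} c with c zero ∈? tabulate (c ∘ suc)
    ... | no c₀∉ = trans (cong₂ _+_ (half true) (trans (half false) (sym (+-identityʳ _))))
                         (cong (2 ^_) (sym (new c c₀∉)))
      where
      half : ∀ b → count (λ v → factors? c (b ∷ v)) ≡ 2 ^ length (keys (c ∘ suc))
      half b = trans (count-cong (factors? c ∘ (b ∷_)) (factors? (c ∘ suc)) (Factors-tail {c = c}) λ F → λ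
        { zero    zero    _  → refl
        ; zero    (suc j) eq → contradiction (subst (_∈ tabulate (c ∘ suc)) (sym eq) (∈-tabulate⁺ j)) c₀∉
        ; (suc i) zero    eq → contradiction (subst (_∈ tabulate (c ∘ suc)) eq (∈-tabulate⁺ i)) c₀∉
        ; (suc i) (suc j) eq → F i j eq }) (count-factors (c ∘ suc))
    ... | yes c₀∈ with ∈-tabulate⁻ c₀∈
    ...   | k , c₀≡cₖ = begin
      count (λ v → factors? c (true ∷ v)) + count (λ v → factors? c (false ∷ v))
        ≡⟨ cong₂ _+_ (half true) (half false) ⟩
      count (λ v → factors? (c ∘ suc) v ×-dec true ≟ᵇ lookup v k)
        + count (λ v → factors? (c ∘ suc) v ×-dec false ≟ᵇ lookup v k)
        ≡⟨ count-split (factors? (c ∘ suc)) (λ v → lookup v k) ⟩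
      count (factors? (c ∘ suc))
        ≡⟨ count-factors (c ∘ suc) ⟩
      2 ^ length (keys (c ∘ suc))
        ≡⟨ cong (2 ^_) (repeated c c₀∈) ⟨
      2 ^ length (keys c) ∎
      where
      open ≡-Reasoning
      half : ∀ b → count (λ v → factors? c (b ∷ v)) ≡ count (λ v → factors? (c ∘ suc) v ×-dec b ≟ᵇ lookup v k)
      half b = count-cong (factors? c ∘ (b ∷_)) (λ v → factors? (c ∘ suc) v ×-dec b ≟ᵇ lookup v k)
        (λ F → Factors-tail {c = c} F , F zero (suc k) c₀≡cₖ) λ { (F , b≡) → λ
        { zero    zero    _  → refl
        ; zero    (suc j) eq → trans b≡ (F k j (trans (sym c₀≡cₖ) eq))
        ; (suc i) zero    eq → trans (F i k (trans eq c₀≡cₖ)) (sym b≡)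
        ; (suc i) (suc j) eq → F i j eq } }

-- Orbits, periods and the number of cycles

module Orbits where

  open import Data.Bool.Base using (true)
  open import Data.Bool.Properties using () renaming (_≟_ to _≟ᵇ_)
  open import Data.Fin.Base as Fin using (Fin; zero; suc; toℕ)
  import Data.Fin.Properties as Fin
  open import Data.Fin.Permutation using (Permutation′; _⟨$⟩ʳ_; _⟨$⟩ˡ_; inverseˡ)
  open import Data.Fin.Subset using (∣_∣)
  open import Data.List.Base using (List; []; _∷_; length; filter; iterate; allFin; tabulate)
  open import Data.List.Membership.Propositional using (_∈_)
  open import Data.List.Membership.Propositional.Properties using (∈-filter⁺; ∈-filter⁻; ∈-allFin)
  import Data.List.Membership.DecPropositional as DecMembership
  open import Data.List.Properties using (map-tabulate)
  open import Data.List.Relation.Unary.All as All using (All)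
  open import Data.List.Relation.Unary.AllPairs using ([]; _∷_)
  open import Data.List.Relation.Unary.Any using (here; there)
  open import Data.List.Relation.Unary.Linked using (Linked; []; [-]; _∷_)
  open import Data.List.Relation.Unary.Unique.Propositional using (Unique)
  open import Data.List.Relation.Unary.Unique.Propositional.Properties using (allFin⁺; filter⁺)
  open import Data.Nat.Base
  open import Data.Nat.GeneralisedArithmetic using (fold; fold-+)
  open import Data.Nat.Properties
  open import Data.Product.Base using (∃; _×_; _,_; proj₂)
  open import Data.Sum.Base using (inj₁; inj₂)
  open import Data.Vec.Base as Vec using (lookup)
  open import Data.Vec.Properties using (lookup∘tabulate; tabulate-cong)
  open import Function.Base using (id)
  open import Relation.Binary.PropositionalEquality
  open import Relation.Nullary using (does; yes; no)
  open import Relation.Nullary.Decidable using (dec-true; does-⇔)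
  open import Relation.Unary using (Decidable)
  open import Function.Bundles using (mk⇔)
  open import Defs using (orbit; z; _≟ˢ_)
  open Counting

  module _ {A : Set} (f : A → A) where

    fold-step : ∀ x k → fold (f x) f k ≡ f (fold x f k)
    fold-step x zero    = refl
    fold-step x (suc k) = cong f (fold-step x k)

    ∈-iterate⁺ : ∀ x {k n} → k < n → fold x f k ∈ iterate f x n
    ∈-iterate⁺ x {zero}  {suc n} _         = here refl
    ∈-iterate⁺ x {suc k} {suc n} (s≤s k<n) =
      there (subst (_∈ iterate f (f x) n) (fold-step x k) (∈-iterate⁺ (f x) k<n))

    ∈-iterate⁻ : ∀ x {n y} → y ∈ iterate f x n → ∃ λ k → k < n × y ≡ fold x f k
    ∈-iterate⁻ x {suc n} (here refl) = 0 , s≤s z≤n , refl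
    ∈-iterate⁻ x {suc n} (there y∈) with ∈-iterate⁻ (f x) y∈
    ... | k , k<n , refl = suc k , s≤s k<n , fold-step x k

    length-iterate : ∀ x n → length (iterate f x n) ≡ n
    length-iterate x zero    = refl
    length-iterate x (suc n) = cong suc (length-iterate (f x) n)

    iterate-! : ∀ x n → (∀ {k l} → k < l → l < n → fold x f k ≢ fold x f l) → Unique (iterate f x n)
    iterate-! x zero    _ = []
    iterate-! x (suc n) ≢ =
      All.tabulate (λ y∈ x≡y → let k , k<n , eq = ∈-iterate⁻ (f x) y∈ in
        ≢ (s≤s z≤n) (s≤s k<n) (trans x≡y (trans eq (fold-step x k))))
      ∷ iterate-! (f x) n (λ {k} {l} k<l l<n eq → ≢ (s≤s k<l) (s≤s l<n)
          (trans (sym (fold-step x k)) (trans eq (fold-step x l))))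

    module _ {_∼_ : A → A → Set} where

      linked⁺ : ∀ x n → (∀ k → suc k < n → fold x f k ∼ f (fold x f k)) → Linked _∼_ (iterate f x n)
      linked⁺ x zero          _ = []
      linked⁺ x (suc zero)    _ = [-]
      linked⁺ x (suc (suc n)) ∼ = ∼ 0 (s≤s (s≤s z≤n)) ∷ linked⁺ (f x) (suc n) λ k k<n →
        subst₂ _∼_ (sym (fold-step x k)) (cong f (sym (fold-step x k))) (∼ (suc k) (s≤s k<n))

      linked⁻ : ∀ x n → Linked _∼_ (iterate f x n) → ∀ k → suc k < n → fold x f k ∼ f (fold x f k)
      linked⁻ x (suc zero)    _       _       (s≤s ())
      linked⁻ x (suc (suc n)) (r ∷ _) zero    _         = r
      linked⁻ x (suc (suc n)) (_ ∷ l) (suc k) (s≤s k<n) =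
        subst₂ _∼_ (fold-step x k) (cong f (fold-step x k)) (linked⁻ (f x) (suc n) l k k<n)

  module _ {n} (α : Permutation′ n) where

    private
      a : Fin n → Fin n
      a = α ⟨$⟩ʳ_
      open DecMembership (Fin._≟_ {n}) using (_∈?_)

    power : Fin n → ℕ → Fin n
    power i k = fold i a k

    record Period (i : Fin n) (r : ℕ) : Set where
      field
        positive : 0 < r
        closes   : power i r ≡ i
        minimal  : ∀ {k} → 0 < k → k < r → power i k ≢ i
    open Period

    private
      a-injective : ∀ {i j} → a i ≡ a j → i ≡ j
      a-injective eq = trans (sym (inverseˡ α)) (trans (cong (α ⟨$⟩ˡ_) eq) (inverseˡ α))

      cancel : ∀ i k {l} → power i (k + l) ≡ power i k → power i l ≡ i
      cancel i zero    eq = eq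
      cancel i (suc k) eq = cancel i k (a-injective eq)

      least : ∀ i r → 0 < r → power i r ≡ i → ∃ λ r′ → r′ ≤ r × Period i r′
      least i r = go r r ≤-refl
        where
        go : ∀ fuel r → r ≤ fuel → 0 < r → power i r ≡ i → ∃ λ r′ → r′ ≤ r × Period i r′
        go zero       zero    _ () _
        go (suc fuel) (suc r) (s≤s r≤fuel) 0<r eq
          with anyUpTo? (λ k → power i (suc k) Fin.≟ i) r
        ... | yes (k , k<r , eq′) =
          let r′ , r′≤ , per = go fuel (suc k) (≤-trans k<r r≤fuel) (s≤s z≤n) eq′
          in r′ , ≤-trans r′≤ (≤-trans k<r (n≤1+n r)) , per
        ... | no none = suc r , ≤-refl , record
          { positive = 0<r ; closes = eq
          ; minimal  = λ { {suc k} _ (s≤s k<r) eq′ → none (k , k<r , eq′) } }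

    period : ∀ i → ∃ λ r → r ≤ n × Period i r
    period i with Fin.pigeonhole (n<1+n n) (λ (k : Fin (suc n)) → power i (toℕ k))
    ... | k , l , k<l , eq =
      let r , r≤ , per = least i (toℕ l ∸ toℕ k) (m<n⇒0<n∸m k<l)
            (cancel i (toℕ k) (trans (cong (power i) (m+[n∸m]≡n (<⇒≤ k<l))) (sym eq)))
      in r , ≤-trans r≤ (≤-trans (m∸n≤m (toℕ l) (toℕ k)) (s≤s⁻¹ (Fin.toℕ<n l))) , per

    reduce : ∀ {i r} → Period i r → ∀ k → ∃ λ k′ → k′ < r × power i k ≡ power i k′
    reduce per zero = 0 , positive per , refl
    reduce {i} {r} per (suc k) with reduce per k
    ... | k′ , k′<r , eq with m≤n⇒m<n∨m≡n k′<r
    ...   | inj₁ 1+k′<r = suc k′ , 1+k′<r , cong a eq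
    ...   | inj₂ refl   = 0 , positive per , trans (cong a eq) (closes per)

    ∈-orbit : ∀ i j → (∃ λ k → j ≡ power i k) → j ∈ iterate a i n
    ∈-orbit i j (k , refl) =
      let r , r≤n , per = period i
          k′ , k′<r , eq = reduce per k
      in subst (_∈ iterate a i n) (sym eq) (∈-iterate⁺ a i (≤-trans k′<r r≤n))

    ∣orbit∣ : ∀ {i r} → r ≤ n → Period i r → ∣ orbit α i ∣ ≡ r
    ∣orbit∣ {i} {r} r≤n per = begin
      ∣ orbit α i ∣                                 ≡⟨ ∣tabulate∣ (_∈? iterate a i n) id ⟩
      length (filter (_∈? iterate a i n) (allFin n)) ≡⟨ Unique-length (filter⁺ (_∈? iterate a i n) (allFin⁺ n))
        (iterate-! a i r λ {k} {l} k<l l<r eq → minimal per (m<n⇒0<n∸m k<l) (≤-<-trans (m∸n≤m l k) l<r)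
          (cancel i k (trans (cong (power i) (m+[n∸m]≡n (<⇒≤ k<l))) (sym eq))))
        (λ {j} j∈ → let k , k<n , eq = ∈-iterate⁻ a i (proj₂ (∈-filter⁻ (_∈? iterate a i n) {xs = allFin n} j∈))
                        k′ , k′<r , eq′ = reduce per k
                    in subst (_∈ iterate a i r) (sym (trans eq eq′)) (∈-iterate⁺ a i k′<r))
        (λ {j} j∈ → let k , k<r , eq = ∈-iterate⁻ a i j∈
                    in ∈-filter⁺ (_∈? iterate a i n) (∈-allFin j) (∈-orbit i j (k , eq))) ⟩
      length (iterate a i r)                        ≡⟨ length-iterate a i r ⟩
      r                                             ∎
      where open ≡-Reasoning

    -- Since `cycle` takes as many iterates as the orbit has elements, this shows that it runs
    -- through exactly one period.
    orbit-period : ∀ i → Period i ∣ orbit α i ∣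
    orbit-period i = let r , r≤n , per = period i in subst (Period i) (sym (∣orbit∣ r≤n per)) per

    power-+ : ∀ i k l → power i (k + l) ≡ power (power i l) k
    power-+ i k l = fold-+ i a k

    Invariant : Colouring n → Set
    Invariant v = ∀ i → lookup v (a i) ≡ lookup v i

    invariant? : Decidable Invariant
    invariant? v = Fin.all? λ i → lookup v (a i) ≟ᵇ lookup v i

    orbit≡⇒reaches : ∀ {i j} → orbit α i ≡ orbit α j → ∃ λ k → i ≡ power j k
    orbit≡⇒reaches {i} {j} eq with i ∈? iterate a j n | inj where
      inj : does (i ∈? iterate a j n) ≡ true
      inj = trans (sym (lookup∘tabulate _ i)) (trans (cong (λ o → lookup o i) (sym eq))
        (trans (lookup∘tabulate _ i) (dec-true (i ∈? iterate a i n) (∈-orbit i i (0 , refl)))))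
    ... | yes i∈ | _ = let k , _ , eq′ = ∈-iterate⁻ a j i∈ in k , eq′
    ... | no _   | ()

    orbit-a : ∀ i → orbit α (a i) ≡ orbit α i
    orbit-a i = tabulate-cong λ j → does-⇔ (mk⇔
      (λ j∈ → let k , _ , eq = ∈-iterate⁻ a (a i) j∈ in ∈-orbit i j (suc k , trans eq (fold-step a i k)))
      (λ j∈ → let k , _ , eq = ∈-iterate⁻ a i j∈ in ∈-orbit (a i) j (back k eq)))
      (j ∈? iterate a (a i) n) (j ∈? iterate a i n)
      where
      back : ∀ {j} k → j ≡ power i k → ∃ λ k → j ≡ power (a i) k
      back (suc k) eq = k , trans eq (sym (fold-step a i k))
      back zero    eq with ∣ orbit α i ∣ | orbit-period i
      ... | suc r | per = r , trans eq (trans (sym (closes per)) (sym (fold-step a i r)))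
      ... | zero  | per with () ← positive per

    -- The invariant colourings are those that factor through the map from points to orbits, whose
    -- distinct values `z` counts. All cycle numbers are determined through this equation.
    count-invariant : count invariant? ≡ 2 ^ z α
    count-invariant = begin
      count invariant?
        ≡⟨ count-cong invariant? (factors? (orbit α))
             (λ {v} inv i j eq → let k , i≡ = orbit≡⇒reaches eq in trans (cong (lookup v) i≡) (constant v inv j k))
             (λ F i → F (a i) i (orbit-a i)) ⟩
      count (factors? (orbit α))          ≡⟨ count-factors (orbit α) ⟩
      2 ^ length (keys (orbit α))         ≡⟨ cong (λ os → 2 ^ length (Data.List.Base.deduplicate _≟ˢ_ os)) (map-tabulate id (orbit α)) ⟨
      2 ^ z α                             ∎
      where
      open ≡-Reasoning
      open Keys (_≟ˢ_ {n})
      constant : ∀ v → Invariant v → ∀ j k → lookup v (power j k) ≡ lookup v j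
      constant v inv j zero    = refl
      constant v inv j (suc k) = trans (inv (power j k)) (constant v inv j k)

-- The correspondence between partitions and paths

module Partitions where

  open import Data.Fin.Base as Fin using (Fin; zero; suc; toℕ; fromℕ<)
  import Data.Fin.Properties as Fin
  open import Data.Fin.Permutation using (Permutation′; _⟨$⟩ʳ_; _⟨$⟩ˡ_; inverseˡ; inverseʳ; permutation)
  open import Data.Fin.Subset using (∣_∣)
  open import Data.List.Relation.Unary.All as All using (All)
  open import Data.Nat.Base
  open import Data.Nat.GeneralisedArithmetic using (fold)
  open import Data.Nat.Properties
  open import Data.Product.Base using (∃; _×_; _,_)
  open import Data.Sum.Base using (_⊎_; inj₁; inj₂)
  open import Function.Base using (_∘_)
  open import Relation.Binary.PropositionalEquality
  open import Relation.Nullary using (Dec; yes; no; contradiction)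
  open import Defs using (orbit; cycle; IsPartition)
  open Orbits
  open BlockPaths
  open Encoding

  permute-beyond : ∀ {t h n} (s : Stack t h) (w : Path h n) {i} → t + n ≤ i → permute s w i ≡ i
  permute-beyond s end           t≤i = refl
  permute-beyond {t} {n = suc n} s (singleton w) {i} t≤i = permute-beyond (skip s) w (subst (_≤ i) (+-suc t n) t≤i)
  permute-beyond {t} {n = suc n} s (first w)     {i} t≤i = permute-beyond (add s) w (subst (_≤ i) (+-suc t n) t≤i)
  permute-beyond {t} {n = suc n} s (middle j w) {i} t≤i =
    trans (cong (swap _ _) (permute-beyond (add (drop j s)) w t<i))
      (swap-other (>⇒≢ (<-trans (at< s j) (m+n≤o⇒m≤o (suc t) t<i))) (>⇒≢ (m+n≤o⇒m≤o (suc t) t<i)))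
    where t<i = subst (_≤ i) (+-suc t n) t≤i
  permute-beyond {t} {n = suc n} s (last j w) {i} t≤i =
    trans (cong (swap _ _) (permute-beyond (skip (drop j s)) w t<i))
      (swap-other (>⇒≢ (<-trans (at< s j) (m+n≤o⇒m≤o (suc t) t<i))) (>⇒≢ (m+n≤o⇒m≤o (suc t) t<i)))
    where t<i = subst (_≤ i) (+-suc t n) t≤i

  Represents : ∀ {n} → Permutation′ n → (ℕ → ℕ) → Set
  Represents α f = ∀ i → toℕ (α ⟨$⟩ʳ i) ≡ f (toℕ i)

  toPermutation : ∀ {n} → Path 0 n → Permutation′ n
  toPermutation {n} w = permutation to from
      (λ i → Fin.toℕ-injective (trans (Fin.toℕ-fromℕ< _) (trans (cong (permute empty w) (Fin.toℕ-fromℕ< _)) (permute-inverseʳ empty w (toℕ i)))))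
      (λ i → Fin.toℕ-injective (trans (Fin.toℕ-fromℕ< _) (trans (cong (permute⁻¹ empty w) (Fin.toℕ-fromℕ< _)) (permute-inverseˡ empty w (toℕ i)))))
    where
    to from : Fin n → Fin n
    to i   = fromℕ< (permute-< empty w (Fin.toℕ<n i))
    from i = fromℕ< (permute⁻¹-< empty w (Fin.toℕ<n i))

  toPermutation-represents : ∀ {n} (w : Path 0 n) → Represents (toPermutation w) (permute empty w)
  toPermutation-represents w i = Fin.toℕ-fromℕ< _

  represented-unique : ∀ {n} {α : Permutation′ n} w w′ →
    Represents α (permute empty w) → Represents α (permute empty w′) → w ≡ w′
  represented-unique {n} w w′ rep rep′ = permute-injective empty w w′ λ i → agree i (i <? n)
    where
    agree : ∀ i → Dec (i < n) → permute empty w i ≡ permute empty w′ i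
    agree i (yes i<n) = subst (λ i → permute empty w i ≡ permute empty w′ i) (Fin.toℕ-fromℕ< i<n)
      (trans (sym (rep (fromℕ< i<n))) (rep′ (fromℕ< i<n)))
    agree i (no i≮n) = trans (permute-beyond empty w (≮⇒≥ i≮n)) (sym (permute-beyond empty w′ (≮⇒≥ i≮n)))

  module _ {n : ℕ} where

    extend : (Fin n → Fin n) → ℕ → ℕ
    extend g i with i <? n
    ... | yes i<n = toℕ (g (fromℕ< i<n))
    ... | no _    = i

    extend-toℕ : ∀ g i → extend g (toℕ i) ≡ toℕ (g i)
    extend-toℕ g i with toℕ i <? n
    ... | yes i<n = cong (toℕ ∘ g) (Fin.fromℕ<-toℕ i i<n)
    ... | no i≮n  = contradiction (Fin.toℕ<n i) i≮n

    extend-≥ : ∀ g {i} → i ≮ n → extend g i ≡ i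
    extend-≥ g {i} i≮n with i <? n
    ... | yes i<n = contradiction i<n i≮n
    ... | no _    = refl

    data View : ℕ → Set where
      inside  : (i : Fin n) → View (toℕ i)
      outside : ∀ {i} → i ≮ n → View i

    view : ∀ i → View i
    view i with i <? n
    ... | yes i<n = subst View (Fin.toℕ-fromℕ< i<n) (inside (fromℕ< i<n))
    ... | no i≮n  = outside i≮n

    extend-inverse : ∀ {g g′} → (∀ i → g (g′ i) ≡ i) → ∀ i → extend g (extend g′ i) ≡ i
    extend-inverse {g} {g′} inv i with view i
    ... | inside i    = trans (cong (extend g) (extend-toℕ g′ i)) (trans (extend-toℕ g (g′ i)) (cong toℕ (inv i)))
    ... | outside i≮n = trans (cong (extend g) (extend-≥ g′ i≮n)) (extend-≥ g i≮n)

    extend-< : ∀ g {i} → i < n → extend g i < n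
    extend-< g {i} i<n with view i
    ... | inside i    = subst (_< n) (sym (extend-toℕ g i)) (Fin.toℕ<n (g i))
    ... | outside i≮n = contradiction i<n i≮n

  module _ {n} {α : Permutation′ n} where

    private
      a a⁻¹ : Fin n → Fin n
      a   = α ⟨$⟩ʳ_
      a⁻¹ = α ⟨$⟩ˡ_

    open Period

    a⁻¹-power : ∀ {i r} → Period α i (suc r) → a⁻¹ i ≡ power α i r
    a⁻¹-power per = trans (cong a⁻¹ (sym (closes per))) (inverseˡ α)

    -- The step that closes the cycle at its least element `i` does not ascend, so it leads to the
    -- label. Any earlier step without ascent would lead to the same label, that is, to `i`, against
    -- the minimality of the period.
    labelling⇒partition : ∀ {f ℓ} → Represents α f → Labelling f ℓ → IsPartition α
    labelling⇒partition {f} {ℓ} rep lab i i≤ with ∣ orbit α i ∣ | orbit-period α i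
    ... | zero  | per with () ← positive per
    ... | suc r | per = linked⁺ a i (suc r) λ k k<r → ≰⇒> λ descends →
      minimal per (s≤s z≤n) k<r (Fin.toℕ-injective (begin
        toℕ (a (power α i k))   ≡⟨ label (power α i k) descends ⟩
        ℓ (toℕ (power α i k))   ≡⟨ constant k ⟩
        ℓ (toℕ i)               ≡⟨ constant r ⟨
        ℓ (toℕ (power α i r))   ≡⟨ label (power α i r) (subst (_≤ toℕ (power α i r)) (cong toℕ (sym (closes per)))
                                     (All.lookup i≤ (∈-iterate⁺ a i ≤-refl))) ⟨
        toℕ (power α i (suc r)) ≡⟨ cong toℕ (closes per) ⟩
        toℕ i                   ∎))
      where
      open ≡-Reasoning
      label : ∀ j → toℕ (a j) ≤ toℕ j → toℕ (a j) ≡ ℓ (toℕ j)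
      label j le = trans (rep j) (descent lab (toℕ j) (subst (_≤ toℕ j) (rep j) le))
      constant : ∀ k → ℓ (toℕ (power α i k)) ≡ ℓ (toℕ i)
      constant zero    = refl
      constant (suc k) = trans (trans (cong ℓ (rep (power α i k))) (invariant lab _)) (constant k)

    private
      argmin : ∀ (f : ℕ → ℕ) r → 0 < r → ∃ λ k → k < r × (∀ {l} → l < r → f k ≤ f l)
      argmin f (suc zero)    _ = 0 , s≤s z≤n , λ { {zero} _ → ≤-refl ; {suc _} (s≤s ()) }
      argmin f (suc (suc r)) _ with argmin f (suc r) (s≤s z≤n)
      ... | k , k<r , min with f k ≤? f (suc r)
      ...   | yes le = k , m<n⇒m<1+n k<r , λ { {l} (s≤s l≤) → case l (m≤n⇒m<n∨m≡n l≤) }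
        where
        case : ∀ l → l < suc r ⊎ l ≡ suc r → f k ≤ f l
        case l (inj₁ l<) = min l<
        case l (inj₂ refl) = le
      ...   | no gt = suc r , ≤-refl , λ { {l} (s≤s l≤) → case l (m≤n⇒m<n∨m≡n l≤) }
        where
        case : ∀ l → l < suc r ⊎ l ≡ suc r → f (suc r) ≤ f l
        case l (inj₁ l<) = ≤-trans (<⇒≤ (≰⇒> gt)) (min l<)
        case l (inj₂ refl) = ≤-refl

    -- A cycle of a partition has a single descent, so the descent into x is the
    -- only one on its cycle.
    partition⇒single : IsPartition α → ∀ x k → toℕ x ≤ toℕ (a⁻¹ x) →
      toℕ (a (power α x k)) ≤ toℕ (power α x k) → a (power α x k) ≡ x
    partition⇒single part x k x≤ descends =
      let r = ∣ orbit α x ∣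
          per = orbit-period α x
          -- The partition property speaks of the cycle listed from its least element, so the powers
          -- of `x` are rewritten as powers of this element `μ`.
          kμ , kμ<r , min = argmin (λ k → toℕ (power α x k)) r (positive per)
          μ = power α x kμ
          from-μ : ∀ l → power α x l ≡ power α μ (l + (r ∸ kμ))
          from-μ l = begin
            power α x l                          ≡⟨ cong (λ y → power α y l) (closes per) ⟨
            power α (power α x r) l              ≡⟨ power-+ α x l r ⟨
            power α x (l + r)                    ≡⟨ cong (λ m → power α x (l + m)) (m∸n+n≡m (<⇒≤ kμ<r)) ⟨
            power α x (l + (r ∸ kμ + kμ))        ≡⟨ cong (power α x) (+-assoc l (r ∸ kμ) kμ) ⟨
            power α x (l + (r ∸ kμ) + kμ)        ≡⟨ power-+ α x (l + (r ∸ kμ)) kμ ⟩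
            power α μ (l + (r ∸ kμ))             ∎
          least : All (λ j → toℕ μ ≤ toℕ j) (cycle α μ)
          least = All.tabulate λ {j} j∈ → let l , _ , eq = ∈-iterate⁻ a μ j∈
                                              l′ , l′<r , eq′ = reduce α per (l + kμ)
            in subst (λ j → toℕ μ ≤ toℕ j) (sym (trans eq (trans (sym (power-+ α x l kμ)) eq′))) (min l′<r)
          end = λ l le → last-descent μ (part μ least) (l + (r ∸ kμ))
                  (subst₂ _≤_ (cong (toℕ ∘ a) (from-μ l)) (cong toℕ (from-μ l)) le)
          l₀ , a⁻¹x≡ = predecessor x
          same : power α x k ≡ a⁻¹ x
          same = trans (from-μ k) (trans (end k descends) (sym (trans (trans a⁻¹x≡ (from-μ l₀)) (end l₀
            (subst₂ _≤_ (cong toℕ (sym (trans (cong a (sym a⁻¹x≡)) (inverseʳ α)))) (cong toℕ a⁻¹x≡) x≤)))))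
      in trans (cong a same) (inverseʳ α)
      where
      open ≡-Reasoning
      open import Data.List.Relation.Unary.Linked using (Linked)
      predecessor : ∀ x → ∃ λ l → a⁻¹ x ≡ power α x l
      predecessor x with ∣ orbit α x ∣ | orbit-period α x
      ... | zero  | per with () ← positive per
      ... | suc r | per = r , a⁻¹-power per
      last-descent : ∀ μ → Linked Fin._<_ (cycle α μ) → ∀ l → toℕ (a (power α μ l)) ≤ toℕ (power α μ l) →
        power α μ l ≡ power α μ (pred ∣ orbit α μ ∣)
      last-descent μ linked l le with reduce α (orbit-period α μ) l
      ... | l′ , l′<r , eq with m≤n⇒m<n∨m≡n l′<r
      ...   | inj₂ 1+l′≡r = trans eq (cong (power α μ) (cong pred 1+l′≡r))
      ...   | inj₁ 1+l′<r = contradiction (subst (λ y → toℕ (a y) ≤ toℕ y) eq le) (<⇒≱ (linked⁻ a μ _ linked l′ 1+l′<r))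

    private
      extend-fold : ∀ x k → fold (toℕ x) (extend a) k ≡ toℕ (power α x k)
      extend-fold x zero    = refl
      extend-fold x (suc k) = trans (cong (extend a) (extend-fold x k)) (extend-toℕ a _)

      fold-≥ : ∀ {m} → m ≮ n → ∀ k → fold m (extend a) k ≡ m
      fold-≥ m≮n zero    = refl
      fold-≥ m≮n (suc k) = trans (cong (extend a) (fold-≥ m≮n k)) (extend-≥ a m≮n)

    partition⇒path : IsPartition α → ∃ λ w → Represents α (permute empty w)
    partition⇒path part =
      let w , eq = Encode.encoding {n} {extend a} {extend a⁻¹}
            (extend-inverse λ _ → inverseʳ α) (extend-inverse λ _ → inverseˡ α) (extend-< a) single
      in w , λ i → trans (sym (extend-toℕ a i)) (sym (eq (toℕ i) (Fin.toℕ<n i)))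
      where
      single : ∀ {m i} → Reaches (extend a) m i → m ≤ extend a⁻¹ m → extend a i ≤ i → extend a i ≡ m
      single {m} (k , refl) m≤ le with view m
      ... | outside m≮n = trans (cong (extend a) (fold-≥ m≮n k)) (extend-≥ a m≮n)
      ... | inside x rewrite extend-fold x k | extend-toℕ a (power α x k) =
        cong toℕ (partition⇒single part x k (subst (toℕ x ≤_) (extend-toℕ a⁻¹ x) m≤) le)

-- Colourings along a path, for the cycles of `α` and of its product with `ζ`

module Colourings where

  open import Data.Bool.Base using (Bool; true; false; if_then_else_)
  open import Data.Bool.Properties using () renaming (_≟_ to _≟ᵇ_)
  open import Data.Fin.Base as Fin using (Fin; zero; suc; toℕ; fromℕ; fromℕ<; punchIn; punchOut)
  import Data.Fin.Properties as Fin
  open import Data.Fin.Permutation using (Permutation′; _⟨$⟩ʳ_; _⟨$⟩ˡ_; inverseˡ; inverseʳ; _∘ₚ_; flip)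
  open import Data.List.Base using (List; []; _∷_; tabulate)
  open import Data.List.Properties using (tabulate-cong)
  open import Data.Maybe.Base using (just)
  open import Data.Nat.Base
  open import Data.Nat.Properties
  open import Data.Product.Base using (∃; _×_; _,_; proj₁; proj₂)
  open import Data.Sum.Base using (_⊎_; inj₁; inj₂)
  open import Data.Vec.Base using ([]; _∷_; lookup)
  open import Function.Base using (_∘_; id)
  open import Relation.Binary.Definitions using (tri<; tri≈; tri>)
  open import Relation.Binary.PropositionalEquality
  open import Relation.Nullary using (Dec; does; yes; no; contradiction)
  open import Relation.Nullary.Decidable using (_×-dec_; dec-true; dec-false; map′)
  open import Relation.Unary using (Decidable)
  open import Defs using (z; ζ)
  open ChordWords
  open GenusOfWords
  open BlockPaths
  open Encoding using (<-split; assign; assign-≡; assign-≢)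
  open Counting
  open Orbits
  open Partitions

  -- extends a colouring of the first t + 1 gaps
  paint : ∀ {n} → ℕ → (ℕ → Bool) → Colouring n → ℕ → Bool
  paint t c []      = c
  paint t c (b ∷ v) = paint (suc t) (assign (suc t) b c) v

  paint-≤ : ∀ {n t c} (v : Colouring n) {i} → i ≤ t → paint t c v i ≡ c i
  paint-≤ []      i≤t = refl
  paint-≤ (b ∷ v) i≤t = trans (paint-≤ v (m≤n⇒m≤1+n i≤t)) (assign-≢ (<⇒≢ (s≤s i≤t)))

  paint-> : ∀ {n} t c (v : Colouring n) i → paint t c v (suc (t + toℕ i)) ≡ lookup v i
  paint-> t c (b ∷ v) zero rewrite +-identityʳ t = trans (paint-≤ v ≤-refl) (assign-≡ (suc t) b c)
  paint-> t c (b ∷ v) (suc i) rewrite +-suc t (toℕ i) = paint-> (suc t) (assign (suc t) b c) v i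

  paint-next : ∀ {n t b c} (v : Colouring n) → paint (suc t) (assign (suc t) b c) v (suc t) ≡ b
  paint-next {t = t} {b} {c} v = trans (paint-≤ v ≤-refl) (assign-≡ (suc t) b c)

  assign-now : ∀ {t} {b : Bool} c → assign (suc t) b c t ≡ c t
  assign-now {t} c = assign-≢ {i = t} {f = c} (<⇒≢ ≤-refl)

  private
    only : ∀ (f : Bool → ℕ) b → (∀ b′ → b′ ≢ b → f b′ ≡ 0) → f true + f false ≡ f b
    only f true  z = trans (cong (f true +_) (z false λ ())) (+-identityʳ _)
    only f false z = cong (_+ f false) (z true λ ())

  record Prefix (t : ℕ) (f : ℕ → ℕ) : Set where
    field
      maps : ∀ {i} → i < t → f i < t
      fixes : ∀ {i} → t ≤ i → f i ≡ i
  open Prefix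

  module _ {t f} (pre : Prefix t f) where

    prefix-suc : Prefix (suc t) f
    prefix-suc = record
      { maps = λ i< → case (<-split i<)
      ; fixes = λ t<i → fixes pre (<⇒≤ t<i) }
      where
      case : ∀ {i} → i ≡ t ⊎ i < t → f i < suc t
      case (inj₁ refl) = s≤s (≤-reflexive (fixes pre ≤-refl))
      case (inj₂ i<t)  = m<n⇒m<1+n (maps pre i<t)

    prefix-swap : ∀ {p} → p < t → Prefix (suc t) (f ∘ swap p t)
    prefix-swap p<t = record
      { maps = λ {i} i<1+t → maps prefix-suc (swap-< i (m<n⇒m<1+n p<t) ≤-refl i<1+t)
      ; fixes = λ t<i → trans (cong f (swap-other (>⇒≢ (<-trans p<t t<i)) (>⇒≢ t<i))) (fixes pre (<⇒≤ t<i)) }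

  -- c (i + 1) is the colour of the point i

  record Monochromatic (N : ℕ) (f : ℕ → ℕ) (c : ℕ → Bool) : Set where
    constructor monochromatic
    field
      same : ∀ {j} → j < N → c (suc (f j)) ≡ c (suc j)
  open Monochromatic

  monochromatic? : ∀ N f → Decidable (Monochromatic N f)
  monochromatic? N f c = map′ monochromatic same (allUpTo? (λ j → c (suc (f j)) ≟ᵇ c (suc j)) N)

  -- Counts the blocks at their first points, where a colour is chosen, whereas `blocks` counts them
  -- at their last points.
  starts : ∀ {h n} → Path h n → ℕ
  starts end           = 0
  starts (singleton w) = suc (starts w)
  starts (first w)     = suc (starts w)
  starts (middle j w)  = starts w
  starts (last j w)    = starts w

  blocks≡starts : ∀ {h n} (w : Path h n) → blocks w ≡ starts w + h
  blocks≡starts end           = refl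
  blocks≡starts (singleton w) = cong suc (blocks≡starts w)
  blocks≡starts (first w)     = trans (blocks≡starts w) (+-suc _ _)
  blocks≡starts (middle j w)  = blocks≡starts w
  blocks≡starts (last j w)    = trans (cong suc (blocks≡starts w)) (sym (+-suc _ _))

  private
    mono-swap : ∀ {t f p c} → p < t → f t ≡ t → Monochromatic (suc t) (f ∘ swap p t) c →
      Monochromatic t f c × c (suc t) ≡ c (suc p)
    mono-swap {t} {f} {p} {c} p<t ft mono = monochromatic (λ {j} j<t → mono′ j j<t (j ≟ p)) , colour
      where
      f′ = f ∘ swap p t
      f′p : f′ p ≡ t
      f′p = trans (cong f (swap-left p t)) ft
      colour : c (suc t) ≡ c (suc p)
      colour = trans (cong (c ∘ suc) (sym f′p)) (same mono (m<n⇒m<1+n p<t))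
      mono′ : ∀ j → j < t → Dec (j ≡ p) → c (suc (f j)) ≡ c (suc j)
      mono′ j j<t (no j≢p) = trans (cong (c ∘ suc ∘ f) (sym (swap-other j≢p (<⇒≢ j<t)))) (same mono (m<n⇒m<1+n j<t))
      mono′ j j<t (yes refl) = trans (cong (c ∘ suc ∘ f) (sym (swap-right p t))) (trans (same mono ≤-refl) colour)

    mono-unswap : ∀ {t f p c} → p < t → f t ≡ t → Monochromatic t f c → c (suc t) ≡ c (suc p) →
      Monochromatic (suc t) (f ∘ swap p t) c
    mono-unswap {t} {f} {p} {c} p<t ft mono colour = monochromatic λ {j} j<1+t → mono′ j (<-split j<1+t) (j ≟ p)
      where
      mono′ : ∀ j → j ≡ t ⊎ j < t → Dec (j ≡ p) → c (suc (f (swap p t j))) ≡ c (suc j)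
      mono′ j (inj₁ refl) _ = trans (cong (c ∘ suc ∘ f) (swap-right p t)) (trans (same mono p<t) (sym colour))
      mono′ j (inj₂ j<t) (yes refl) = trans (cong (c ∘ suc) (trans (cong f (swap-left p t)) ft)) colour
      mono′ j (inj₂ j<t) (no j≢p) = trans (cong (c ∘ suc ∘ f) (swap-other j≢p (<⇒≢ j<t))) (same mono j<t)

    mono-restrict : ∀ {t f c} → Monochromatic (suc t) f c → Monochromatic t f c
    mono-restrict mono = monochromatic λ j<t → same mono (m<n⇒m<1+n j<t)

    -- Undoing one transposition after the other preserves the condition on the colours. This shows
    -- that a wrong colour at the present point cannot be repaired by later ones.
    mono-prefix : ∀ {t h n} {s : Stack t h} (w : Path h n) {N f c} → t + n ≡ N → Prefix t f →
      Monochromatic N (f ∘ permute s w) c → Monochromatic t f c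
    mono-prefix {t} end eq pre mono = subst (λ N → Monochromatic N _ _) (trans (sym eq) (+-identityʳ t)) mono
    mono-prefix {t} (singleton w) eq pre mono =
      mono-restrict (mono-prefix w (trans (sym (+-suc t _)) eq) (prefix-suc pre) mono)
    mono-prefix {t} (first w) eq pre mono =
      mono-restrict (mono-prefix w (trans (sym (+-suc t _)) eq) (prefix-suc pre) mono)
    mono-prefix {t} {s = s} (middle j w) eq pre mono = proj₁ (mono-swap (at< s j) (fixes pre ≤-refl)
      (mono-prefix w (trans (sym (+-suc t _)) eq) (prefix-swap pre (at< s j)) mono))
    mono-prefix {t} {s = s} (last j w) eq pre mono = proj₁ (mono-swap (at< s j) (fixes pre ≤-refl)
      (mono-prefix w (trans (sym (+-suc t _)) eq) (prefix-swap pre (at< s j)) mono))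

    mono-assign : ∀ {t f b c} → Prefix t f → Monochromatic t f c → Monochromatic t f (assign (suc t) b c)
    mono-assign pre mono = monochromatic λ j<t →
      trans (assign-≢ (<⇒≢ (s≤s (maps pre j<t)))) (trans (same mono j<t) (sym (assign-≢ (<⇒≢ (s≤s j<t)))))

    mono-new : ∀ {t f b c} → Prefix t f → Monochromatic t f c → Monochromatic (suc t) f (assign (suc t) b c)
    mono-new {t} {f} {b} {c} pre mono = monochromatic λ {j} j<1+t → go j (<-split j<1+t)
      where
      go : ∀ j → j ≡ t ⊎ j < t → assign (suc t) b c (suc (f j)) ≡ assign (suc t) b c (suc j)
      go j (inj₁ refl) = cong (assign (suc t) b c ∘ suc) (fixes pre ≤-refl)
      go j (inj₂ j<t)  = same (mono-assign pre mono) j<t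

    mono-join : ∀ {t f b c p} → Prefix t f → p < t → Monochromatic t f c → b ≡ c (suc p) →
      Monochromatic (suc t) (f ∘ swap p t) (assign (suc t) b c)
    mono-join {t} {c = c} pre p<t mono refl = mono-unswap p<t (fixes pre ≤-refl) (mono-assign pre mono)
      (trans (assign-≡ (suc t) _ c) (sym (assign-≢ (<⇒≢ (s≤s p<t)))))

    mono-join⁻¹ : ∀ {t f b c p n} (v : Colouring n) → Prefix t f → p < t →
      Monochromatic (suc t) (f ∘ swap p t) (paint t c (b ∷ v)) → b ≡ c (suc p)
    mono-join⁻¹ {f = f} {b} v pre p<t mono = trans (sym (paint-next v))
      (trans (proj₂ (mono-swap {f = f} p<t (fixes pre ≤-refl) mono)) (paint-≤ (b ∷ v) p<t))

    -- A singleton or a first point takes either colour; every other point takes the colour of the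
    -- preceding point of its block.
    count-mono : ∀ {t h n} {s : Stack t h} (w : Path h n) {N f c} → t + n ≡ N → Prefix t f → Monochromatic t f c →
      count {n} (λ v → monochromatic? N (f ∘ permute s w) (paint t c v)) ≡ 2 ^ starts w
    count-mono {t} end {N} {f} {c} eq pre mono = cong (if_then 1 else 0) (dec-true (monochromatic? N f c)
      (subst (λ N → Monochromatic N f c) (trans (sym (+-identityʳ t)) eq) mono))
    count-mono {t} {s = s} (singleton w) eq pre mono = trans
      (cong₂ _+_ (count-mono w eq′ (prefix-suc pre) (mono-new pre mono))
                 (count-mono w eq′ (prefix-suc pre) (mono-new pre mono)))
      (cong (2 ^ starts w +_) (sym (+-identityʳ _)))
      where eq′ = trans (sym (+-suc t _)) eq
    count-mono {t} {s = s} (first w) eq pre mono = trans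
      (cong₂ _+_ (count-mono w eq′ (prefix-suc pre) (mono-new pre mono))
                 (count-mono w eq′ (prefix-suc pre) (mono-new pre mono)))
      (cong (2 ^ starts w +_) (sym (+-identityʳ _)))
      where eq′ = trans (sym (+-suc t _)) eq
    count-mono {t} {n = suc n} {s} (middle j w) {N} {f} {c} eq pre mono = trans
      (only (λ b → count {n} (λ v → good? (b ∷ v))) (c (suc (at s j))) λ b b≢ →
        count-none {n} (λ v → good? (b ∷ v)) λ {v} m → b≢ (mono-join⁻¹ v pre (at< s j)
          (mono-prefix w eq′ (prefix-swap pre (at< s j)) m)))
      (count-mono w eq′ (prefix-swap pre (at< s j)) (mono-join pre (at< s j) mono refl))
      where
      eq′ = trans (sym (+-suc t _)) eq
      good? : Decidable λ (v : Colouring (suc n)) → Monochromatic N (f ∘ permute s (middle j w)) (paint t c v)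
      good? v = monochromatic? N (f ∘ permute s (middle j w)) (paint t c v)
    count-mono {t} {n = suc n} {s} (last j w) {N} {f} {c} eq pre mono = trans
      (only (λ b → count {n} (λ v → good? (b ∷ v))) (c (suc (at s j))) λ b b≢ →
        count-none {n} (λ v → good? (b ∷ v)) λ {v} m → b≢ (mono-join⁻¹ v pre (at< s j)
          (mono-prefix w eq′ (prefix-swap pre (at< s j)) m)))
      (count-mono w eq′ (prefix-swap pre (at< s j)) (mono-join pre (at< s j) mono refl))
      where
      eq′ = trans (sym (+-suc t _)) eq
      good? : Decidable λ (v : Colouring (suc n)) → Monochromatic N (f ∘ permute s (last j w)) (paint t c v)
      good? v = monochromatic? N (f ∘ permute s (last j w)) (paint t c v)

  2^-injective : ∀ {a b} → 2 ^ a ≡ 2 ^ b → a ≡ b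
  2^-injective eq = ≤-antisym (≮⇒≥ λ b<a → <⇒≢ (^-monoʳ-< 2 (s≤s (s≤s z≤n)) b<a) (sym eq))
                              (≮⇒≥ λ a<b → <⇒≢ (^-monoʳ-< 2 (s≤s (s≤s z≤n)) a<b) eq)

  prefix-0 : Prefix 0 id
  prefix-0 = record { maps = λ () ; fixes = λ _ → refl }

  module _ {n} {α : Permutation′ n} (w : Path 0 n) (rep : Represents α (permute empty w)) where

    z-blocks : z α ≡ blocks w
    z-blocks = trans (2^-injective (begin
      2 ^ z α              ≡⟨ count-invariant α ⟨
      count (invariant? α) ≡⟨ count-cong (invariant? α)
          (λ v → monochromatic? n (permute empty w) (paint 0 (λ _ → true) v))
          (λ {v} inv → monochromatic λ {j} j<n → to v inv j j<n)
          (λ {v} mono i → trans (sym (paint-> 0 _ v (α ⟨$⟩ʳ i))) (trans (cong (paint 0 _ v ∘ suc) (rep i))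
             (trans (same mono (Fin.toℕ<n i)) (paint-> 0 _ v i)))) ⟩
      count (λ (v : Colouring n) → monochromatic? n (permute empty w) (paint 0 (λ _ → true) v))
        ≡⟨ count-mono {s = empty} w refl prefix-0 (monochromatic λ ()) ⟩
      2 ^ starts w         ∎)) (sym (trans (blocks≡starts w) (+-identityʳ _)))
      where
      open ≡-Reasoning
      to : ∀ v → Invariant α v → ∀ j → j < n →
        paint 0 (λ _ → true) v (suc (permute empty w j)) ≡ paint 0 (λ _ → true) v (suc j)
      to v inv j j<n rewrite sym (Fin.toℕ-fromℕ< j<n) =
        trans (cong (paint 0 _ v ∘ suc) (sym (rep i))) (trans (paint-> 0 _ v (α ⟨$⟩ʳ i)) (trans (inv i) (sym (paint-> 0 _ v i))))
        where i = fromℕ< j<n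

  -- c i is the colour of the gap before the point i

  record Consistent (N : ℕ) (f : ℕ → ℕ) (c : ℕ → Bool) : Set where
    constructor consistent
    field
      along : ∀ {j} → j < N → c (suc j) ≡ c (f j)
      wraps : c N ≡ c 0
  open Consistent

  consistent? : ∀ N f → Decidable (Consistent N f)
  consistent? N f c = map′ to (λ k → along k , wraps k)
    (allUpTo? (λ j → c (suc j) ≟ᵇ c (f j)) N ×-dec c N ≟ᵇ c 0)
    where
    to : (∀ {j} → j < N → c (suc j) ≡ c (f j)) × c N ≡ c 0 → Consistent N f c
    to (along , wraps) = consistent along wraps

  private
    -- the constraints that only involve closed blocks
    Closed : ∀ {t h} → Stack t h → (ℕ → ℕ) → (ℕ → Bool) → Set
    Closed {t} s f c = ∀ j → j < t → j ∉ s → c (suc j) ≡ c (f j)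

    closed-assign : ∀ {t h} {s : Stack t h} {f b c} → Prefix t f → Closed s f c → Closed s f (assign (suc t) b c)
    closed-assign pre cl j j<t j∉s = trans (assign-≢ (<⇒≢ (s≤s j<t))) (trans (cl j j<t j∉s)
      (sym (assign-≢ (<⇒≢ (m<n⇒m<1+n (maps pre j<t))))))

    closed-prefix : ∀ {t h n} {s : Stack t h} {N f c} (w : Path h n) → t + n ≡ N → Prefix t f → (v : Colouring n) →
      Consistent N (f ∘ permute s w) (paint t c v) → Closed s f c
    closed-prefix {t} {n = n} {s} {f = f} {c} w eq pre v con j j<t j∉s = trans (sym (paint-≤ v j<t)) (trans
      (along con (<-≤-trans j<t (subst (t ≤_) eq (m≤m+n t n))))
      (trans (cong (paint t c v ∘ f) (permute-fix s w j<t j∉s)) (paint-≤ v (<⇒≤ (maps pre j<t)))))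

    -- As `f` closes an open block to a cycle, `f (at s k)` is the first point of the block. The
    -- second colour is thus that of the gap before the block; it passes from arc to arc, being the
    -- colour between the two letters of each middle point.
    colours : ∀ {t h} → Stack t h → (ℕ → ℕ) → (ℕ → Bool) → List (Bool × Bool)
    colours s f c = tabulate λ k → c (suc (at s k)) , c (f (at s k))

    pick-tabulate : ∀ {h} {A : Set} (g : Fin (suc h) → A) j →
      pick (toℕ j) (tabulate g) ≡ just (g j , tabulate (g ∘ punchIn j))
    pick-tabulate g zero = refl
    pick-tabulate {suc h} g (suc j) rewrite pick-tabulate (g ∘ suc) j = refl

    colours-assign : ∀ {t h b f c} {s : Stack t h} → Prefix t f → colours s f (assign (suc t) b c) ≡ colours s f c
    colours-assign {s = s} pre = tabulate-cong λ k → cong₂ _,_ (assign-≢ (<⇒≢ (s≤s (at< s k))))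
      (assign-≢ (<⇒≢ (m<n⇒m<1+n (maps pre (at< s k)))))

    colours-swap : ∀ {t h b f c} {s : Stack t (suc h)} j → Prefix t f →
      colours (drop j s) (f ∘ swap (at s j) t) (assign (suc t) b c) ≡
        tabulate (λ k → c (suc (at s (punchIn j k))) , c (f (at s (punchIn j k))))
    colours-swap {t} {b = b} {f} {c} {s} j pre = tabulate-cong λ k → cong₂ _,_ (assign-≢ (<⇒≢ (s≤s (at< s _))))
      (trans (cong (assign (suc t) b c ∘ f) (swap-other (Fin.punchInᵢ≢i j k ∘ at-injective s) (<⇒≢ (at< s _))))
        (assign-≢ (<⇒≢ (m<n⇒m<1+n (maps pre (at< s _))))))

    if-≟ : ∀ {x y : Bool} {A : Set} {a b : A} → x ≡ y → (if does (x ≟ᵇ y) then a else b) ≡ a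
    if-≟ {x} {y} eq = cong (if_then _ else _) (dec-true (x ≟ᵇ y) eq)

    if-≟-no : ∀ {x y : Bool} {A : Set} {a b : A} → x ≢ y → (if does (x ≟ᵇ y) then a else b) ≡ b
    if-≟-no {x} {y} neq = cong (if_then _ else _) (dec-false (x ≟ᵇ y) neq)

    closed-join : ∀ {t h} {s : Stack t (suc h)} {f c b} j → Prefix t f → Closed s f c → c (suc (at s j)) ≡ c t →
      ∀ i → i < t → (∀ k → at s (punchIn j k) ≢ i) →
      assign (suc t) b c (suc i) ≡ assign (suc t) b c (f (swap (at s j) t i))
    closed-join {t} {s = s} {f} {c} {b} j pre cl colour i i<t i∉ with i ≟ at s j
    ... | yes refl = trans (assign-≢ (<⇒≢ (s≤s i<t))) (trans colour (sym
            (trans (cong (assign (suc t) b c) (fixes pre ≤-refl)) (assign-now c))))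
    ... | no i≢p with i ≟ t
    ...   | yes refl = contradiction i<t (<-irrefl refl)
    ...   | no _     = closed-assign {s = s} pre cl i i<t λ k eq → go k eq (punchIn-view j k)
      where
      go : ∀ k → at s k ≡ i → k ≡ j ⊎ (∃ λ k′ → k ≡ punchIn j k′) → _
      go k eq (inj₁ refl)        = i≢p (sym eq)
      go k eq (inj₂ (k′ , refl)) = i∉ k′ eq

    -- The entry for the point `t` colours the gap after `t`. It is free after a first or a middle
    -- point, which gives the two branches of `run` at `O`. After a singleton it repeats the colour
    -- before it, and after a last point it repeats the colour before the block.
    count-consistent : ∀ {t h n} {s : Stack t h} (w : Path h n) {N f c} → t + n ≡ N → Prefix t f → Closed s f c →
      count {n} (λ v → consistent? N (f ∘ permute s w) (paint t c v)) ≡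
        run (chordWord w) (colours s f c) (c t) (c 0)
    count-consistent {t} end {N} {f} {c} eq pre cl = indicator-cong (consistent? N f c) (c t ≟ᵇ c 0)
      (λ con → trans (cong c (trans (sym (+-identityʳ t)) eq)) (wraps con))
      (λ ct≡c0 → consistent (λ j<N → cl _ (subst (_ <_) (sym N≡t) j<N) λ ())
        (trans (cong c (sym N≡t)) ct≡c0))
      where
      N≡t : t ≡ N
      N≡t = trans (sym (+-identityʳ t)) eq
    count-consistent {t} {n = suc n} {s} (singleton w) {N} {f} {c} eq pre cl = begin
      count {n} (λ v → good? (true ∷ v)) + count {n} (λ v → good? (false ∷ v))
        ≡⟨ only (λ b → count {n} (λ v → good? (b ∷ v))) (c t) (λ b b≢ →
             count-none {n} (λ v → good? (b ∷ v)) λ {v} con → b≢ (read v con)) ⟩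
      count {n} (λ v → good? (c t ∷ v))
        ≡⟨ count-consistent {s = skip s} w eq′ (prefix-suc pre) closed′ ⟩
      run (chordWord w) (colours (skip s) f (assign (suc t) (c t) c)) (assign (suc t) (c t) c (suc t)) (assign (suc t) (c t) c 0)
        ≡⟨ cong₂ (λ cs b → run (chordWord w) cs b (c 0)) (colours-assign {s = s} pre) (assign-≡ (suc t) (c t) c) ⟩
      run (chordWord w) (colours s f c) (c t) (c 0) ∎
      where
      open ≡-Reasoning
      eq′ = trans (sym (+-suc t _)) eq
      good? : Decidable λ (v : Colouring (suc n)) → Consistent N (f ∘ permute s (singleton w)) (paint t c v)
      good? v = consistent? N (f ∘ permute s (singleton w)) (paint t c v)
      read : ∀ {b} v → Consistent N (f ∘ permute s (singleton w)) (paint t c (b ∷ v)) → b ≡ c t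
      read {b} v con = trans (sym (assign-≡ (suc t) b c)) (trans
        (closed-prefix {s = skip s} w eq′ (prefix-suc pre) v con t ≤-refl (t∉skip s))
        (trans (cong (assign (suc t) b c) (fixes pre ≤-refl)) (assign-now c)))
      closed′ : Closed (skip s) f (assign (suc t) (c t) c)
      closed′ j j<1+t j∉s with <-split j<1+t
      ... | inj₁ refl = trans (assign-≡ (suc t) (c t) c) (sym
            (trans (cong (assign (suc t) (c t) c) (fixes pre ≤-refl)) (assign-now c)))
      ... | inj₂ j<t  = closed-assign {s = s} pre cl j j<t j∉s
    count-consistent {t} {n = suc n} {s} (first w) {N} {f} {c} eq pre cl = cong₂ _+_ (branch true) (branch false)
      where
      eq′ = trans (sym (+-suc t _)) eq
      closed′ : ∀ b → Closed (add s) f (assign (suc t) b c)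
      closed′ b j j<1+t j∉s with <-split j<1+t
      ... | inj₁ refl = contradiction refl (j∉s zero)
      ... | inj₂ j<t  = closed-assign {s = s} pre cl j j<t (j∉s ∘ suc)
      branch : ∀ b → count {n} (λ v → consistent? N (f ∘ permute s (first w)) (paint t c (b ∷ v))) ≡
        run (chordWord w) ((b , c t) ∷ colours s f c) b (c 0)
      branch b = trans (count-consistent {s = add s} w eq′ (prefix-suc pre) (closed′ b))
        (cong₂ (λ cs b → run (chordWord w) cs b (c 0))
          (cong₂ _∷_ (cong₂ _,_ (assign-≡ (suc t) b c)
              (trans (cong (assign (suc t) b c) (fixes pre ≤-refl)) (assign-now c)))
            (colours-assign {s = s} pre))
          (assign-≡ (suc t) b c))
    count-consistent {t} {suc h} {suc n} {s} (middle j w) {N} {f} {c} eq pre cl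
      rewrite pick-tabulate (λ k → c (suc (at s k)) , c (f (at s k))) j = go (c (suc p) ≟ᵇ c t)
      where
      p = at s j
      eq′ = trans (sym (+-suc t _)) eq
      f′ = f ∘ swap p t
      total = count {n} (λ v → consistent? N (f ∘ permute s (middle j w)) (paint t c (true ∷ v)))
            + count {n} (λ v → consistent? N (f ∘ permute s (middle j w)) (paint t c (false ∷ v)))
      rest : List (Bool × Bool)
      rest = tabulate λ k → c (suc (at s (punchIn j k))) , c (f (at s (punchIn j k)))
      closed′ : ∀ b → c (suc p) ≡ c t → Closed (add (drop j s)) f′ (assign (suc t) b c)
      closed′ b colour i i<1+t i∉s with <-split i<1+t
      ... | inj₁ refl = contradiction refl (i∉s zero)
      ... | inj₂ i<t  = closed-join {s = s} j pre cl colour i i<t (i∉s ∘ suc)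
      branch : ∀ b → c (suc p) ≡ c t →
        count {n} (λ v → consistent? N (f ∘ permute s (middle j w)) (paint t c (b ∷ v))) ≡
          run (chordWord w) ((b , c (f p)) ∷ rest) b (c 0)
      branch b colour = trans (count-consistent {s = add (drop j s)} w eq′ (prefix-swap pre (at< s j)) (closed′ b colour))
        (cong₂ (λ cs b → run (chordWord w) cs b (c 0))
          (cong₂ _∷_ (cong₂ _,_ (assign-≡ (suc t) b c)
              (trans (cong (assign (suc t) b c ∘ f) (swap-right p t)) (assign-≢ (<⇒≢ (m<n⇒m<1+n (maps pre (at< s j)))))))
            (colours-swap {s = s} j pre))
          (assign-≡ (suc t) b c))
      clash : ∀ b → c (suc p) ≢ c t → count {n} (λ v → consistent? N (f ∘ permute s (middle j w)) (paint t c (b ∷ v))) ≡ 0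
      clash b colour = count-none {n} (λ v → consistent? N (f ∘ permute s (middle j w)) (paint t c (b ∷ v))) λ {v} con →
        colour (trans (sym (assign-≢ (<⇒≢ (s≤s (at< s j))))) (trans
          (closed-prefix {s = add (drop j s)} w eq′ (prefix-swap pre (at< s j)) v con p (m<n⇒m<1+n (at< s j)) (∉-add-drop s j))
          (trans (cong (assign (suc t) b c) (trans (cong f (swap-left p t)) (fixes pre ≤-refl))) (assign-now c))))
      go : Dec (c (suc p) ≡ c t) → total ≡
        (if does (c (suc p) ≟ᵇ c t) then run (O ∷ chordWord w) rest (c (f p)) (c 0) else 0)
      go (yes colour) = trans (cong₂ _+_ (branch true colour) (branch false colour)) (sym (if-≟ colour))
      go (no colour)  = trans (cong₂ _+_ (clash true colour) (clash false colour)) (sym (if-≟-no colour))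
    count-consistent {t} {suc h} {suc n} {s} (last j w) {N} {f} {c} eq pre cl
      rewrite pick-tabulate (λ k → c (suc (at s k)) , c (f (at s k))) j = go (c (suc p) ≟ᵇ c t)
      where
      p = at s j
      eq′ = trans (sym (+-suc t _)) eq
      f′ = f ∘ swap p t
      f′t = cong f (swap-right p t)
      total = count {n} (λ v → consistent? N (f ∘ permute s (last j w)) (paint t c (true ∷ v)))
            + count {n} (λ v → consistent? N (f ∘ permute s (last j w)) (paint t c (false ∷ v)))
      rest : List (Bool × Bool)
      rest = tabulate λ k → c (suc (at s (punchIn j k))) , c (f (at s (punchIn j k)))
      o = c (f p)
      read-o : ∀ b → assign (suc t) b c (f′ t) ≡ o
      read-o b = trans (cong (assign (suc t) b c) f′t) (assign-≢ (<⇒≢ (m<n⇒m<1+n (maps pre (at< s j)))))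
      closed′ : c (suc p) ≡ c t → Closed (skip (drop j s)) f′ (assign (suc t) o c)
      closed′ colour i i<1+t i∉s with <-split i<1+t
      ... | inj₁ refl = trans (assign-≡ (suc t) o c) (sym (read-o o))
      ... | inj₂ i<t  = closed-join {s = s} j pre cl colour i i<t i∉s
      branch : c (suc p) ≡ c t →
        count {n} (λ v → consistent? N (f ∘ permute s (last j w)) (paint t c (o ∷ v))) ≡
          run (chordWord w) rest o (c 0)
      branch colour = trans (count-consistent {s = skip (drop j s)} w eq′ (prefix-swap pre (at< s j)) (closed′ colour))
        (cong₂ (λ cs b → run (chordWord w) cs b (c 0)) (colours-swap {s = s} j pre) (assign-≡ (suc t) o c))
      closed-up : ∀ {b} v → Consistent N (f ∘ permute s (last j w)) (paint t c (b ∷ v)) →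
        Closed (skip (drop j s)) f′ (assign (suc t) b c)
      closed-up v con = closed-prefix {s = skip (drop j s)} w eq′ (prefix-swap pre (at< s j)) v con
      other : ∀ b → b ≢ o → count {n} (λ v → consistent? N (f ∘ permute s (last j w)) (paint t c (b ∷ v))) ≡ 0
      other b b≢o = count-none {n} (λ v → consistent? N (f ∘ permute s (last j w)) (paint t c (b ∷ v))) λ {v} con →
        b≢o (trans (sym (assign-≡ (suc t) b c)) (trans (closed-up v con t ≤-refl (t∉skip (drop j s))) (read-o b)))
      clash : ∀ b → c (suc p) ≢ c t → count {n} (λ v → consistent? N (f ∘ permute s (last j w)) (paint t c (b ∷ v))) ≡ 0
      clash b colour = count-none {n} (λ v → consistent? N (f ∘ permute s (last j w)) (paint t c (b ∷ v))) λ {v} con →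
        colour (trans (sym (assign-≢ (<⇒≢ (s≤s (at< s j))))) (trans
          (closed-up v con p (m<n⇒m<1+n (at< s j)) (∉-skip-drop s j))
          (trans (cong (assign (suc t) b c) (trans (cong f (swap-left p t)) (fixes pre ≤-refl))) (assign-now c))))
      go : Dec (c (suc p) ≡ c t) → total ≡
        (if does (c (suc p) ≟ᵇ c t) then run (chordWord w) rest o (c 0) else 0)
      go (yes colour) = trans (only (λ b → count {n} (λ v → consistent? N (f ∘ permute s (last j w)) (paint t c (b ∷ v)))) o other)
        (trans (branch colour) (sym (if-≟ colour)))
      go (no colour)  = trans (cong₂ _+_ (clash true colour) (clash false colour)) (sym (if-≟-no colour))

  ζ-wrap : ∀ m → ζ ⟨$⟩ʳ fromℕ m ≡ zero
  ζ-wrap m with fromℕ m Fin.≟ fromℕ m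
  ... | yes _  = refl
  ... | no m≢m = contradiction refl m≢m

  toℕ-punchOut-fromℕ : ∀ {m} {i : Fin (suc m)} (m≢i : fromℕ m ≢ i) → toℕ (punchOut m≢i) ≡ toℕ i
  toℕ-punchOut-fromℕ {zero}  {zero}  m≢i = contradiction refl m≢i
  toℕ-punchOut-fromℕ {suc m} {zero}  m≢i = refl
  toℕ-punchOut-fromℕ {suc m} {suc i} m≢i = cong suc (toℕ-punchOut-fromℕ (m≢i ∘ cong suc))

  ζ-suc : ∀ {m} {i : Fin (suc m)} → i ≢ fromℕ m → toℕ (ζ ⟨$⟩ʳ i) ≡ suc (toℕ i)
  ζ-suc {m} {i} i≢m with fromℕ m Fin.≟ i
  ... | yes m≡i = contradiction (sym m≡i) i≢m
  ... | no m≢i  = cong suc (toℕ-punchOut-fromℕ m≢i)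

  module _ {m} {α : Permutation′ (suc m)} (w : Path 0 (suc m)) (rep : Represents α (permute empty w)) where

    -- Let a point have the colour of the gap after it. For `j = α⁻¹ (ζ i)`, the gap after `i` is
    -- the gap before `α j`, so invariance under the product means that the gaps after `j` and
    -- before `α j` agree for all `j`. At the last point `ζ` wraps around, which identifies the last
    -- gap with the first one; its colour `r` is summed over.
    colourings-z : colourings (chordWord w) ≡ 2 ^ z (ζ ∘ₚ flip α)
    colourings-z = begin
      run (chordWord w) [] true true + run (chordWord w) [] false false
        ≡⟨ cong₂ _+_ (half true) (half false) ⟨
      count {suc m} (λ v → invariant? β v ×-dec true ≟ᵇ lookup v (fromℕ m))
        + count {suc m} (λ v → invariant? β v ×-dec false ≟ᵇ lookup v (fromℕ m))
        ≡⟨ count-split (invariant? β) (λ v → lookup v (fromℕ m)) ⟩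
      count (invariant? β)
        ≡⟨ count-invariant β ⟩
      2 ^ z β ∎
      where
      open ≡-Reasoning
      β = ζ ∘ₚ flip α
      f = permute empty w

      gaps : Bool → Colouring (suc m) → ℕ → Bool
      gaps r v = paint 0 (λ _ → r) v

      gaps-suc : ∀ r v i → gaps r v (suc (toℕ i)) ≡ lookup v i
      gaps-suc r v i = paint-> 0 (λ _ → r) v i

      gaps-ζ : ∀ r v i → r ≡ lookup v (fromℕ m) → gaps r v (toℕ (ζ ⟨$⟩ʳ i)) ≡ lookup v i
      gaps-ζ r v i r≡ with i Fin.≟ fromℕ m
      ... | yes refl = trans (cong (gaps r v ∘ toℕ) (ζ-wrap m)) (trans (paint-≤ v z≤n) r≡)
      ... | no i≢m   = trans (cong (gaps r v) (ζ-suc i≢m)) (gaps-suc r v i)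

      gaps-last : ∀ r v → gaps r v (suc m) ≡ lookup v (fromℕ m)
      gaps-last r v = trans (cong (gaps r v ∘ suc) (sym (Fin.toℕ-fromℕ m))) (gaps-suc r v (fromℕ m))

      to : ∀ {r v} → Consistent (suc m) f (gaps r v) → Invariant β v × r ≡ lookup v (fromℕ m)
      to {r} {v} con = inv , r≡
        where
        r≡ : r ≡ lookup v (fromℕ m)
        r≡ = trans (sym (paint-≤ v z≤n)) (trans (sym (wraps con)) (gaps-last r v))
        inv : Invariant β v
        inv i = trans (sym (gaps-suc r v j)) (trans (along con (Fin.toℕ<n j))
          (trans (cong (gaps r v) (trans (sym (rep j)) (cong toℕ (inverseʳ α)))) (gaps-ζ r v i r≡)))
          where j = α ⟨$⟩ˡ (ζ ⟨$⟩ʳ i)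

      from : ∀ {r v} → Invariant β v × r ≡ lookup v (fromℕ m) → Consistent (suc m) f (gaps r v)
      from {r} {v} (inv , r≡) = consistent
        (λ {j} j< → subst (λ j → gaps r v (suc j) ≡ gaps r v (f j)) (Fin.toℕ-fromℕ< j<) (step (fromℕ< j<)))
        (trans (gaps-last r v) (trans (sym r≡) (sym (paint-≤ v z≤n))))
        where
        step : ∀ j → gaps r v (suc (toℕ j)) ≡ gaps r v (f (toℕ j))
        step j = begin
          gaps r v (suc (toℕ j))             ≡⟨ gaps-suc r v j ⟩
          lookup v j                         ≡⟨ cong (lookup v) (trans (cong (α ⟨$⟩ˡ_) (inverseʳ ζ)) (inverseˡ α)) ⟨
          lookup v (β ⟨$⟩ʳ i)                ≡⟨ inv i ⟩
          lookup v i                         ≡⟨ gaps-ζ r v i r≡ ⟨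
          gaps r v (toℕ (ζ ⟨$⟩ʳ i))          ≡⟨ cong (gaps r v ∘ toℕ) (inverseʳ ζ) ⟩
          gaps r v (toℕ (α ⟨$⟩ʳ j))          ≡⟨ cong (gaps r v) (rep j) ⟩
          gaps r v (f (toℕ j))               ∎
          where i = ζ ⟨$⟩ˡ (α ⟨$⟩ʳ j)

      half : ∀ r → count {suc m} (λ v → invariant? β v ×-dec r ≟ᵇ lookup v (fromℕ m)) ≡ run (chordWord w) [] r r
      half r = trans (count-cong {suc m} (λ v → invariant? β v ×-dec r ≟ᵇ lookup v (fromℕ m))
          (λ v → consistent? (suc m) f (gaps r v)) (λ {v} → from {r} {v}) (λ {v} → to {r} {v}))
        (count-consistent {s = empty} w refl prefix-0 (λ _ ()))

-- Numbers of partitions as numbers of paths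

module PathCount where

  open import Data.Bool.Base using (Bool; true; false; if_then_else_; _∧_)
  open import Data.Bool.Properties using (∧-zeroʳ) renaming (_≟_ to _≟ᵇ_)
  open import Data.Fin.Base as Fin using (Fin; zero; suc; toℕ)
  import Data.Fin.Properties as Fin
  open import Data.Fin.Permutation using (Permutation′; _∘ₚ_; flip) renaming (_≈_ to _≈ₚ_)
  open import Data.List.Base using (List; []; _∷_; _++_; map; concatMap; filter; length; tabulate; allFin)
  open import Data.List.Membership.Propositional using (_∈_; find)
  open import Data.List.Membership.Propositional.Properties
    using (∈-++⁺ˡ; ∈-++⁺ʳ; ∈-map⁺; ∈-map⁻; ∈-concatMap⁺; ∈-concatMap⁻; ∈-++⁻; ∈-allFin; ∈-filter⁺; ∈-filter⁻)
  open import Data.List.Relation.Unary.All as All using (All)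
  import Data.List.Relation.Unary.All.Properties as All
  open import Data.List.Relation.Unary.AllPairs as AllPairs using (AllPairs; []; _∷_)
  import Data.List.Relation.Unary.AllPairs.Properties as AllPairs
  open import Data.List.Relation.Unary.Any as Any using (here)
  open import Data.List.Relation.Unary.Unique.Propositional using (Unique)
  import Data.List.Relation.Unary.Unique.Propositional.Properties as Unique
  open import Data.Nat.Base
  open import Data.Nat.Properties
  open import Data.Product.Base using (∃; _×_; _,_; proj₂)
  open import Data.Sum.Base using (_⊎_; inj₁; inj₂)
  open import Function.Base using (_∘_; id)
  open import Relation.Binary.PropositionalEquality
  open import Relation.Nullary using (¬_; yes; no)
  open import Relation.Nullary.Decidable using (_×-dec_)
  open import Relation.Unary using (Decidable)
  open import Defs using (z; ζ; p; HasGenus; hasGenus?; IsPartition; isPartition?; allPermutations; allPermutations-complete; allPermutations-distinct)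
  open ChordWords
  open GenusOfWords
  open BlockPaths
  open Encoding
  open Counting
  open Orbits
  open Partitions
  open Colourings

  ∑ₙ : ℕ → (ℕ → ℕ) → ℕ
  ∑ₙ zero    g = 0
  ∑ₙ (suc n) g = g 0 + ∑ₙ n (λ j → g (suc j))

  -- Multiplication by `y` on the level of coefficients: one more block is completed.
  delay : (ℕ → ℕ) → ℕ → ℕ
  delay f zero    = 0
  delay f (suc k) = f k

  -- the number of paths in Path h n with k completed blocks whose chord word is in φ
  pathCount : ℕ → ℕ → ℕ → Language → ℕ
  pathCount zero    zero    zero    φ = if φ [] then 1 else 0
  pathCount zero    zero    (suc h) φ = 0
  pathCount zero    (suc k) h       φ = 0
  pathCount (suc n) k       h       φ =
    delay (λ k → pathCount n k h φ) k + (pathCount n k (suc h) (φ · O) +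
      ∑ₙ h (λ j → pathCount n k h (φ · C j · O) + delay (λ k → pathCount n k (pred h) (φ · C j)) k))

  allPaths : ∀ h n → List (Path h n)
  allPaths zero    zero    = end ∷ []
  allPaths (suc h) zero    = []
  allPaths zero    (suc n) = map singleton (allPaths zero n) ++ map first (allPaths 1 n)
  allPaths (suc h) (suc n) = map singleton (allPaths (suc h) n) ++ (map first (allPaths (suc (suc h)) n) ++
    concatMap (λ j → map (middle j) (allPaths (suc h) n) ++ map (last j) (allPaths h n)) (allFin (suc h)))

  ∈-allPaths : ∀ {h n} (w : Path h n) → w ∈ allPaths h n
  ∈-allPaths end = here refl
  ∈-allPaths {zero}  (singleton w) = ∈-++⁺ˡ (∈-map⁺ singleton (∈-allPaths w))
  ∈-allPaths {suc h} (singleton w) = ∈-++⁺ˡ (∈-map⁺ singleton (∈-allPaths w))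
  ∈-allPaths {zero}  {suc n} (first w) = ∈-++⁺ʳ (map singleton (allPaths zero n)) (∈-map⁺ first (∈-allPaths w))
  ∈-allPaths {suc h} {suc n} (first w) =
    ∈-++⁺ʳ (map singleton (allPaths (suc h) n)) (∈-++⁺ˡ (∈-map⁺ first (∈-allPaths w)))
  ∈-allPaths {suc h} {suc n} (middle j w) = ∈-++⁺ʳ (map singleton (allPaths (suc h) n)) (∈-++⁺ʳ (map first (allPaths (suc (suc h)) n))
    (∈-concatMap⁺ _ {xs = allFin (suc h)} (Any.map (λ { refl → ∈-++⁺ˡ (∈-map⁺ (middle j) (∈-allPaths w)) }) (∈-allFin j))))
  ∈-allPaths {suc h} {suc n} (last j w) = ∈-++⁺ʳ (map singleton (allPaths (suc h) n)) (∈-++⁺ʳ (map first (allPaths (suc (suc h)) n))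
    (∈-concatMap⁺ _ {xs = allFin (suc h)} (Any.map (λ { refl → ∈-++⁺ʳ (map (middle j) (allPaths (suc h) n)) (∈-map⁺ (last j) (∈-allPaths w)) }) (∈-allFin j))))

  ++-! : ∀ {A : Set} {xs ys : List A} → Unique xs → Unique ys → (∀ {x} → x ∈ xs → ¬ x ∈ ys) → Unique (xs ++ ys)
  ++-! !xs !ys dis = Unique.++⁺ !xs !ys λ { (x∈ , y∈) → dis x∈ y∈ }

  concatMap-! : ∀ {A B : Set} (f : A → List B) {xs} → (∀ x → Unique (f x)) →
    (∀ {x x′ y} → y ∈ f x → y ∈ f x′ → x ≡ x′) → Unique xs → Unique (concatMap f xs)
  concatMap-! f         !f dis []           = []
  concatMap-! f {x ∷ xs} !f dis (x≢ ∷ !xs) = ++-! (!f x) (concatMap-! f !f dis !xs) λ y∈ y∈′ →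
    let x′ , x′∈ , y∈″ = find (∈-concatMap⁻ f {xs = xs} y∈′) in All.lookup x≢ x′∈ (dis y∈ y∈″)

  allPaths-! : ∀ h n → Unique (allPaths h n)
  allPaths-! zero    zero    = All.[] ∷ []
  allPaths-! (suc h) zero    = []
  allPaths-! zero    (suc n) = ++-! (Unique.map⁺ (λ { refl → refl }) (allPaths-! zero n))
    (Unique.map⁺ (λ { refl → refl }) (allPaths-! 1 n))
    λ x∈ x∈′ → case (proj₂ (proj₂ (∈-map⁻ singleton x∈))) (proj₂ (proj₂ (∈-map⁻ first x∈′)))
    where
    case : ∀ {x : Path 0 (suc n)} {w w′} → x ≡ singleton w → ¬ x ≡ first w′
    case refl ()
  allPaths-! (suc h) (suc n) = ++-! (Unique.map⁺ (λ { refl → refl }) (allPaths-! (suc h) n))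
    (++-! (Unique.map⁺ (λ { refl → refl }) (allPaths-! (suc (suc h)) n))
      (concatMap-! branch (λ j → ++-! (Unique.map⁺ (λ { refl → refl }) (allPaths-! (suc h) n))
          (Unique.map⁺ (λ { refl → refl }) (allPaths-! h n))
          λ x∈ x∈′ → middle≢last (proj₂ (proj₂ (∈-map⁻ (middle j) x∈))) (proj₂ (proj₂ (∈-map⁻ (last j) x∈′))))
        (λ {j} {j′} x∈ x∈′ → same-index (joins j x∈) (joins j′ x∈′)) (Unique.allFin⁺ (suc h)))
      λ x∈ x∈′ → first≢join (proj₂ (proj₂ (∈-map⁻ first x∈))) (proj₂ (joins-any x∈′)))
    λ x∈ x∈′ → case (proj₂ (proj₂ (∈-map⁻ singleton x∈))) (∈-++⁻ (map first (allPaths (suc (suc h)) n)) x∈′)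
    where
    branch : Fin (suc h) → List (Path (suc h) (suc n))
    branch j = map (middle j) (allPaths (suc h) n) ++ map (last j) (allPaths h n)
    Joins : Fin (suc h) → Path (suc h) (suc n) → Set
    Joins j x = (∃ λ w → x ≡ middle j w) ⊎ (∃ λ w → x ≡ last j w)
    joins : ∀ j {x} → x ∈ branch j → Joins j x
    joins j x∈ with ∈-++⁻ (map (middle j) (allPaths (suc h) n)) x∈
    ... | inj₁ x∈m = inj₁ (let w , _ , eq = ∈-map⁻ (middle j) x∈m in w , eq)
    ... | inj₂ x∈l = inj₂ (let w , _ , eq = ∈-map⁻ (last j) x∈l in w , eq)
    joins-any : ∀ {x} → x ∈ concatMap branch (allFin (suc h)) → ∃ λ j → Joins j x
    joins-any x∈ = let j , _ , x∈j = find (∈-concatMap⁻ branch {xs = allFin (suc h)} x∈) in j , joins j x∈j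
    same-index : ∀ {j j′ x} → Joins j x → Joins j′ x → j ≡ j′
    same-index (inj₁ (_ , refl)) (inj₁ (_ , refl)) = refl
    same-index (inj₂ (_ , refl)) (inj₂ (_ , refl)) = refl
    same-index (inj₁ (_ , refl)) (inj₂ (_ , ()))
    same-index (inj₂ (_ , refl)) (inj₁ (_ , ()))
    middle≢last : ∀ {j} {x : Path (suc h) (suc n)} {w w′} → x ≡ middle j w → ¬ x ≡ last j w′
    middle≢last refl ()
    first≢join : ∀ {j x w} → x ≡ first w → ¬ Joins j x
    first≢join refl (inj₁ (_ , ()))
    first≢join refl (inj₂ (_ , ()))
    case : ∀ {x : Path (suc h) (suc n)} {w} → x ≡ singleton w →
      ¬ (x ∈ map first (allPaths (suc (suc h)) n) ⊎ x ∈ concatMap branch (allFin (suc h)))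
    case refl (inj₁ x∈) with ∈-map⁻ first x∈
    ... | _ , _ , ()
    case refl (inj₂ x∈) with joins-any x∈
    ... | j , inj₁ (_ , ())
    ... | j , inj₂ (_ , ())

  occurrences : ∀ {A : Set} → (A → Bool) → List A → ℕ
  occurrences q []       = 0
  occurrences q (x ∷ xs) = (if q x then 1 else 0) + occurrences q xs

  module _ {A : Set} (q : A → Bool) where

    occurrences-filter : ∀ xs → length (filter (λ x → q x ≟ᵇ true) xs) ≡ occurrences q xs
    occurrences-filter []       = refl
    occurrences-filter (x ∷ xs) with q x
    ... | true  = cong suc (occurrences-filter xs)
    ... | false = occurrences-filter xs

    occurrences-++ : ∀ xs ys → occurrences q (xs ++ ys) ≡ occurrences q xs + occurrences q ys
    occurrences-++ []       ys = refl
    occurrences-++ (x ∷ xs) ys = trans (cong (_ +_) (occurrences-++ xs ys)) (sym (+-assoc (if q x then 1 else 0) _ _))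

    occurrences-map : ∀ {B : Set} (f : B → A) xs → occurrences q (map f xs) ≡ occurrences (q ∘ f) xs
    occurrences-map f []       = refl
    occurrences-map f (x ∷ xs) = cong (_ +_) (occurrences-map f xs)

    occurrences-concatMap : ∀ {n} {B : Set} (f : B → List A) (g : Fin n → B) {t} →
      (∀ i → occurrences q (f (g i)) ≡ t (toℕ i)) → occurrences q (concatMap f (tabulate g)) ≡ ∑ₙ n t
    occurrences-concatMap {zero}  f g eq = refl
    occurrences-concatMap {suc n} f g eq = trans (occurrences-++ (f (g zero)) _)
      (cong₂ _+_ (eq zero) (occurrences-concatMap f (g ∘ suc) (eq ∘ suc)))

    occurrences-none : (∀ x → q x ≡ false) → ∀ xs → occurrences q xs ≡ 0
    occurrences-none none []       = refl
    occurrences-none none (x ∷ xs) rewrite none x = occurrences-none none xs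

  admissible : ∀ {h n} → Language → ℕ → Path h n → Bool
  admissible φ k w = φ (chordWord w) ∧ (blocks w ≡ᵇ k)

  private
    delayed : ∀ {h n h′ n′} φ k (f : Path h n → Path h′ n′) φ′ →
      (∀ k w → admissible φ k (f w) ≡ φ′ (chordWord w) ∧ (suc (blocks w) ≡ᵇ k)) → {c : ℕ → ℕ} →
      (∀ k → occurrences (admissible φ′ k) (allPaths h n) ≡ c k) →
      occurrences (admissible φ k) (map f (allPaths h n)) ≡ delay c k
    delayed {h} {n} φ zero f φ′ eq _ = trans (occurrences-map (admissible φ 0) f (allPaths h n))
      (occurrences-none (admissible φ 0 ∘ f) (λ w → trans (eq 0 w) (∧-zeroʳ _)) (allPaths h n))
    delayed {h} {n} φ (suc k) f φ′ eq ih = trans (occurrences-map (admissible φ (suc k)) f (allPaths h n))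
      (trans (occurrences-cong (eq (suc k)) (allPaths h n)) (ih k))
      where
      occurrences-cong : ∀ {A : Set} {q q′ : A → Bool} → (∀ x → q x ≡ q′ x) → ∀ xs → occurrences q xs ≡ occurrences q′ xs
      occurrences-cong eq []       = refl
      occurrences-cong eq (x ∷ xs) = cong₂ _+_ (cong (if_then 1 else 0) (eq x)) (occurrences-cong eq xs)

  occurrences-allPaths : ∀ n k h φ → occurrences (admissible φ k) (allPaths h n) ≡ pathCount n k h φ
  occurrences-allPaths zero zero zero φ with φ []
  ... | true  = refl
  ... | false = refl
  occurrences-allPaths zero zero (suc h) φ = refl
  occurrences-allPaths zero (suc k) zero φ rewrite ∧-zeroʳ (φ []) = refl
  occurrences-allPaths zero (suc k) (suc h) φ = refl
  occurrences-allPaths (suc n) k zero φ = trans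
    (occurrences-++ (admissible φ k) (map singleton (allPaths zero n)) _)
    (cong₂ _+_ (delayed {zero} {n} φ k singleton φ (λ _ _ → refl) (λ k → occurrences-allPaths n k zero φ))
      (trans (occurrences-map (admissible φ k) first (allPaths 1 n))
        (trans (occurrences-allPaths n k 1 (φ · O)) (sym (+-identityʳ _)))))
  occurrences-allPaths (suc n) k (suc h) φ = trans
    (occurrences-++ (admissible φ k) (map singleton (allPaths (suc h) n)) _)
    (cong₂ _+_ (delayed {suc h} {n} φ k singleton φ (λ _ _ → refl) (λ k → occurrences-allPaths n k (suc h) φ))
      (trans (occurrences-++ (admissible φ k) (map first (allPaths (suc (suc h)) n)) _)
        (cong₂ _+_ (trans (occurrences-map (admissible φ k) first (allPaths (suc (suc h)) n))
            (occurrences-allPaths n k (suc (suc h)) (φ · O)))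
          (occurrences-concatMap (admissible φ k)
            (λ j → map (middle j) (allPaths (suc h) n) ++ map (last j) (allPaths h n)) id
            {λ j → pathCount n k (suc h) (φ · C j · O) + delay (λ k → pathCount n k h (φ · C j)) k} λ j →
            trans (occurrences-++ (admissible φ k) (map (middle j) (allPaths (suc h) n)) _)
              (cong₂ _+_ (trans (occurrences-map (admissible φ k) (middle j) (allPaths (suc h) n))
                  (occurrences-allPaths n k (suc h) (φ · C (toℕ j) · O)))
                (delayed {h} {n} φ k (last j) (φ · C (toℕ j)) (λ _ _ → refl)
                  (λ k → occurrences-allPaths n k h (φ · C (toℕ j)))))))))

  ∧-true : ∀ {a b} → a ≡ true → b ≡ true → a ∧ b ≡ true
  ∧-true refl refl = refl

  ∧-true⁻ : ∀ {a b} → a ∧ b ≡ true → a ≡ true × b ≡ true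
  ∧-true⁻ {true} {true} _ = refl , refl

  ≡ᵇ-true⁻ : ∀ {a b} → (a ≡ᵇ b) ≡ true → a ≡ b
  ≡ᵇ-true⁻ {a} {b} eq with a ≟ b
  ... | yes a≡b = a≡b
  ... | no a≢b with () ← trans (sym eq) (≢⇒≡ᵇ-false a≢b)

  module _ {m} {α : Permutation′ (suc m)} (w : Path 0 (suc m)) (rep : Represents α (permute empty w)) where

    private
      N = suc m
      zβ = z (ζ ∘ₚ flip α)
      c = chords (chordWord w)

      power-of-2 : ∀ g → colourings (chordWord w) * 4 ^ g ≡ 2 ^ (zβ + 2 * g)
      power-of-2 g = trans (cong₂ _*_ (colourings-z {α = α} w rep) (^-*-assoc 2 2 g)) (sym (^-distribˡ-+-* 2 zβ (2 * g)))

      size : N + 1 ≡ z α + suc c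
      size = begin
        N + 1             ≡⟨ +-comm N 1 ⟩
        suc N             ≡⟨ cong suc (chords+blocks w) ⟨
        suc c + blocks w  ≡⟨ cong (suc c +_) (z-blocks {α = α} w rep) ⟨
        suc c + z α       ≡⟨ +-comm (suc c) (z α) ⟩
        z α + suc c       ∎
        where open ≡-Reasoning

    -- As points are chords plus blocks, the defining equation of the genus reduces to
    -- `zβ + 2 * g ≡ suc c`, and `genus` compares the powers of 2 with these exponents.
    genus⁺ : ∀ g → HasGenus g α → genus g (chordWord w) ≡ true
    genus⁺ g has = trans (cong₂ _≡ᵇ_ (trans (power-of-2 g) (cong (2 ^_) eq)) refl) (≡ᵇ-refl (2 ^ suc c))
      where
      eq : zβ + 2 * g ≡ suc c
      eq = +-cancelˡ-≡ (z α) _ _ (trans (sym (+-assoc (z α) zβ (2 * g))) (trans (sym has) size))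

    genus⁻ : ∀ g → genus g (chordWord w) ≡ true → HasGenus g α
    genus⁻ g eq = trans size (trans (cong (z α +_) (sym (2^-injective (trans (sym (power-of-2 g)) (≡ᵇ-true⁻ eq)))))
      (sym (+-assoc (z α) zβ (2 * g))))

  -- Along `Represents` a permutation has one path, and a path has one permutation up to pointwise
  -- equality. Each of the two inequalities uses one direction.
  p≡pathCount : ∀ g m k → p g (suc m) k ≡ pathCount (suc m) k 0 (genus g)
  p≡pathCount g m k = trans (≤-antisym
      (length-≤ {_~_ = _≈ₚ_} (λ α w → Represents α (permute empty w)) perms paths
        (AllPairs.filter⁺ good? (allPermutations-distinct N)) perm→path
        (λ {α} {α′} _ _ rep rep′ i → Fin.toℕ-injective (trans (rep i) (sym (rep′ i)))))
      (length-≤ {_~_ = _≡_} (λ w α → Represents α (permute empty w)) paths perms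
        (Unique.filter⁺ (λ w → admissible φ k w ≟ᵇ true) (allPaths-! 0 N)) path→perm
        (λ {w} {w′} {α} _ _ rep rep′ → represented-unique {α = α} w w′ rep rep′)))
    (trans (occurrences-filter (admissible φ k) (allPaths 0 N)) (occurrences-allPaths N k 0 φ))
    where
    N = suc m
    φ = genus g
    good? : Decidable λ (α : Permutation′ N) → IsPartition α × HasGenus g α × z α ≡ k
    good? α = isPartition? α ×-dec hasGenus? g α ×-dec (z α ≟ k)
    perms : List (Permutation′ N)
    perms = filter good? (allPermutations N)
    paths : List (Path 0 N)
    paths = filter (λ w → admissible φ k w ≟ᵇ true) (allPaths 0 N)
    perm→path : ∀ {α} → α ∈ perms → ∃ λ w → w ∈ paths × Represents α (permute empty w)
    perm→path {α} α∈ =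
      let _ , part , has , zα≡k = ∈-filter⁻ good? {xs = allPermutations N} α∈
          w , rep = partition⇒path {α = α} part
      in w , ∈-filter⁺ (λ w → admissible φ k w ≟ᵇ true) (∈-allPaths w)
          (∧-true (genus⁺ {α = α} w rep g has)
            (trans (cong (_≡ᵇ k) (trans (sym (z-blocks {α = α} w rep)) zα≡k)) (≡ᵇ-refl k))) , rep
    path→perm : ∀ {w} → w ∈ paths → ∃ λ α → α ∈ perms × Represents α (permute empty w)
    path→perm {w} w∈ =
      let _ , adm = ∈-filter⁻ (λ w → admissible φ k w ≟ᵇ true) {xs = allPaths 0 N} w∈
          gen , bl = ∧-true⁻ adm
          α , α∈ , eq = find (allPermutations-complete (toPermutation w))
          rep : Represents α (permute empty w)
          rep i = trans (cong toℕ (sym (eq i))) (toPermutation-represents w i)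
          ℓ , lab = permute-labelling w
      in α , ∈-filter⁺ good? α∈ (labelling⇒partition {α = α} rep lab , genus⁻ {α = α} w rep g gen
          , trans (z-blocks {α = α} w rep) (≡ᵇ-true⁻ bl)) , rep

-- Primitive words as irreducible matchings

module Irreducibility where

  open import Data.Bool.Base using (Bool; true; false; if_then_else_)
  open import Data.Fin.Base as Fin using (Fin; zero; suc; toℕ; fromℕ<; punchIn)
  import Data.Fin.Properties as Fin
  open import Data.List.Base using (List; []; _∷_; _++_; length)
  open import Data.List.Properties using (length-++)
  open import Data.Maybe.Base using (Maybe; just; nothing)
  open import Data.Nat.Base
  open import Data.Nat.Properties
  open import Data.Product.Base using (∃; Σ-syntax; _×_; _,_)
  open import Data.Sum.Base using (inj₁; inj₂)
  open import Relation.Binary.PropositionalEquality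
  open import Relation.Nullary using (Dec; yes; no; contradiction)
  open ChordWords
  open GenusOfWords
  open BlockPaths
  open Encoding using (swap-injective)

  flagAt : List Bool → ℕ → Bool
  flagAt []       _       = false
  flagAt (f ∷ _)  zero    = f
  flagAt (_ ∷ fs) (suc k) = flagAt fs k

  flagAt-push : ∀ μ fs k → flagAt fs (suc k) ≡ true → flagAt (push μ fs) (suc (suc k)) ≡ true
  flagAt-push initial fs       k eq = eq
  flagAt-push opened  (_ ∷ fs) k eq = eq
  flagAt-push closed  fs       k eq = eq

  flagAt-left : ∀ xs {f ys k} → k < length xs → flagAt (xs ++ f ∷ ys) k ≡ flagAt (xs ++ lower ys) k
  flagAt-left (x ∷ xs) {k = zero}  _         = refl
  flagAt-left (x ∷ xs) {k = suc k} (s≤s k<n) = flagAt-left xs k<n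

  flagAt-right : ∀ xs {f ys} k → flagAt (xs ++ f ∷ ys) (length xs + suc (suc k)) ≡ flagAt (xs ++ lower ys) (length xs + suc k)
  flagAt-right []       {ys = []}     k = refl
  flagAt-right []       {ys = _ ∷ ys} k = refl
  flagAt-right (x ∷ xs) k = flagAt-right xs k

  flagAt-top : ∀ xs {f ys} → flagAt (xs ++ f ∷ ys) (suc (length xs)) ≡ topFlag ys
  flagAt-top []       {ys = []}    = refl
  flagAt-top []       {ys = _ ∷ _} = refl
  flagAt-top (x ∷ xs) = flagAt-top xs

  toℕ-punchIn-< : ∀ {h} (j : Fin (suc h)) k → toℕ k < toℕ j → toℕ (punchIn j k) ≡ toℕ k
  toℕ-punchIn-< (suc j) zero    _         = refl
  toℕ-punchIn-< (suc j) (suc k) (s≤s k<j) = cong suc (toℕ-punchIn-< j k k<j)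

  toℕ-punchIn-≥ : ∀ {h} (j : Fin (suc h)) k → toℕ j ≤ toℕ k → toℕ (punchIn j k) ≡ suc (toℕ k)
  toℕ-punchIn-≥ zero    k       _         = refl
  toℕ-punchIn-≥ (suc j) (suc k) (s≤s j≤k) = cong suc (toℕ-punchIn-≥ j k j≤k)

  -- No pair of neighbouring left endpoints escapes the flags: if two open arcs start at consecutive
  -- points, they are adjacent on the stack and the lower one is flagged. The field `latest`
  -- prepares this for the next opening letter.
  record Flagged {t h} (s : Stack t h) (fs : List Bool) (μ : Mode) : Set where
    field
      adjacent : ∀ j k → at s j ≡ suc (at s k) → toℕ k ≡ suc (toℕ j) × flagAt fs (toℕ k) ≡ true
      latest   : ∀ k → suc (at s k) ≡ t → μ ≡ opened × toℕ k ≡ 0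
  open Flagged

  flagged-push : ∀ {t h} {s : Stack t h} {fs μ} → length fs ≡ h → Flagged s fs μ → Flagged (add s) (push μ fs) opened
  flagged-push {t} {s = s} {fs} {μ} len fl = record { adjacent = adj ; latest = lat }
    where
    lat : ∀ k → suc (at (add s) k) ≡ suc t → opened ≡ opened × toℕ k ≡ 0
    lat zero    _  = refl , refl
    lat (suc k) eq = contradiction (suc-injective eq) (<⇒≢ (at< s k))
    adj : ∀ j k → at (add s) j ≡ suc (at (add s) k) → toℕ k ≡ suc (toℕ j) × flagAt (push μ fs) (toℕ k) ≡ true
    adj zero zero eq = contradiction eq (<⇒≢ ≤-refl)
    adj zero (suc k) eq with latest fl k (sym eq)
    ... | refl , k≡0 rewrite k≡0 = refl , go fs len
      where
      go : ∀ fs → length fs ≡ _ → flagAt (push opened fs) 1 ≡ true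
      go (_ ∷ _) _ = refl
      go [] 0≡h = contradiction (subst Fin (sym 0≡h) k) Fin.¬Fin0
    adj (suc j) zero eq = contradiction eq (<⇒≢ (m<n⇒m<1+n (at< s j)))
    adj (suc j) (suc k) eq with adjacent fl j k eq
    ... | k≡ , flag rewrite k≡ = refl , flagAt-push μ fs (toℕ j) flag

  flagged-drop : ∀ {t h} {s : Stack t (suc h)} {xs f ys μ} j → toℕ j ≡ length xs →
    Flagged s (xs ++ f ∷ ys) μ → Flagged (skip (drop j s)) (xs ++ lower ys) closed
  flagged-drop {t} {s = s} {xs} {f} {ys} j j≡ fl = record { adjacent = adj ; latest = lat }
    where
    lat : ∀ k → suc (at s (punchIn j k)) ≡ suc t → _
    lat k eq = contradiction (suc-injective eq) (<⇒≢ (at< s _))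
    adj : ∀ a b → at s (punchIn j a) ≡ suc (at s (punchIn j b)) → toℕ b ≡ suc (toℕ a) × flagAt (xs ++ lower ys) (toℕ b) ≡ true
    adj a b eq with adjacent fl (punchIn j a) (punchIn j b) eq
    ... | b≡ , flag with toℕ b <? toℕ j | toℕ a <? toℕ j
    ...   | yes b<j | yes a<j = trans (sym (toℕ-punchIn-< j b b<j)) (trans b≡ (cong suc (toℕ-punchIn-< j a a<j)))
            , trans (sym (flagAt-left xs {f} {ys} (subst (toℕ b <_) j≡ b<j))) (subst (λ k → flagAt (xs ++ f ∷ ys) k ≡ true) (toℕ-punchIn-< j b b<j) flag)
    ...   | yes b<j | no a≮j = contradiction
            (trans (sym (toℕ-punchIn-< j b b<j)) (trans b≡ (cong suc (toℕ-punchIn-≥ j a (≮⇒≥ a≮j)))))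
            (<⇒≢ (<-≤-trans b<j (≤-trans (≮⇒≥ a≮j) (≤-trans (n≤1+n _) (n≤1+n _)))))
    ...   | no b≮j | yes a<j = contradiction
            (suc-injective (trans (sym (toℕ-punchIn-≥ j b (≮⇒≥ b≮j))) (trans b≡ (cong suc (toℕ-punchIn-< j a a<j)))))
            (>⇒≢ (<-≤-trans a<j (≮⇒≥ b≮j)))
    ...   | no b≮j | no a≮j = b≡1+a
            , go (m≤n⇒∃[o]m+o≡n (≮⇒≥ a≮j))
      where
      b≡1+a : toℕ b ≡ suc (toℕ a)
      b≡1+a = suc-injective (trans (sym (toℕ-punchIn-≥ j b (≮⇒≥ b≮j))) (trans b≡ (cong suc (toℕ-punchIn-≥ j a (≮⇒≥ a≮j)))))
      go : (∃ λ d → toℕ j + d ≡ toℕ a) → flagAt (xs ++ lower ys) (toℕ b) ≡ true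
      go (d , j+d≡a) = trans (cong (flagAt (xs ++ lower ys)) b≡′) (trans (sym (flagAt-right xs {f} {ys} d))
        (trans (cong (flagAt (xs ++ f ∷ ys)) (sym (trans (toℕ-punchIn-≥ j b (≮⇒≥ b≮j)) (trans (cong suc b≡′) (sym (+-suc _ _)))))) flag))
        where
        b≡′ : toℕ b ≡ length xs + suc d
        b≡′ = trans b≡1+a (trans (cong suc (trans (sym j+d≡a) (cong (_+ d) j≡))) (sym (+-suc _ d)))

  -- in terms of the matching D: no chord joins consecutive points, and no two
  -- chords are parallel
  record Irreducible {h} (t : ℕ) (s : Stack t h) (fb : Maybe ℕ) (D : ℕ → ℕ) : Set where
    field
      banned      : ∀ k → fb ≡ just (toℕ k) → D (at s k) ≢ t
      no-short    : ∀ i → t ≤ i → D i ≢ suc i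
      no-parallel : ∀ {i j} → t ≤ j → i < j → D i ≡ suc j → D j ≢ suc i
  open Irreducible

  private
    allowed-≢ : ∀ {fb j} → allowed fb j ≡ true → fb ≢ just j
    allowed-≢ {j = j} al refl rewrite ≡ᵇ-refl j with () ← al

    permute-inj : ∀ {t h n} (s : Stack t h) (w : Path h n) {i j} → permute s w i ≡ permute s w j → i ≡ j
    permute-inj s w eq = trans (sym (permute-inverseˡ s w _)) (trans (cong (permute⁻¹ s w) eq) (permute-inverseˡ s w _))

  irreducible-first : ∀ {t h n} {s : Stack t h} (w : Path (suc h) n) {fb} →
    Irreducible (suc t) (add s) (just 0) (permute (add s) w) → Irreducible t s fb (permute s (first w))
  irreducible-first {t} {s = s} w irr = record
    { banned      = λ k _ → >⇒≢ (permute-stack (add s) w (suc k))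
    ; no-short    = short′
    ; no-parallel = par
    }
    where
    short′ : ∀ i → t ≤ i → permute (add s) w i ≢ suc i
    short′ i t≤i with m≤n⇒m<n∨m≡n t≤i
    ... | inj₁ t<i = no-short irr i t<i
    ... | inj₂ refl = banned irr zero refl
    par : ∀ {i j} → t ≤ j → i < j → permute (add s) w i ≡ suc j → permute (add s) w j ≢ suc i
    par {i} {j} t≤j i<j Di Dj with m≤n⇒m<n∨m≡n t≤j
    ... | inj₁ t<j = no-parallel irr t<j i<j Di Dj
    ... | inj₂ refl = <⇒≱ (permute-first-t s w) (subst (_≤ t) (sym Dj) i<j)

  -- The only new danger is a chord parallel to the one that joins `p` and `t`, hence one from `i`
  -- to `suc t` with `p` equal to `suc i`. Then `i` is an open left endpoint, by `Flagged` it lies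
  -- directly below `p` with its flag set, and `forbid` bans closing it right after `t`.
  irreducible-last : ∀ {t h n} {s : Stack t (suc h)} j (w : Path h n) {fb xs f ys μ} → toℕ j ≡ length xs →
    Flagged s (xs ++ f ∷ ys) μ → allowed fb (length xs) ≡ true →
    Irreducible (suc t) (skip (drop j s)) (forbid xs ys) (permute (skip (drop j s)) w) →
    Irreducible t s fb (permute s (last j w))
  irreducible-last {t} {h} {s = s} j w {fb} {xs} {f} {ys} j≡ fl al irr = record
    { banned = ban ; no-short = short′ ; no-parallel = par }
    where
    p = at s j
    p<t = at< s j
    s′ = skip (drop j s)
    D′ = permute s′ w
    D = permute s (last j w)
    D′p : D′ p ≡ p
    D′p = permute-fix s′ w (m<n⇒m<1+n p<t) (∉-skip-drop s j)
    D′t : D′ t ≡ t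
    D′t = permute-fix s′ w ≤-refl (t∉skip (drop j s))
    -- D and D′ agree wherever one of them takes a value after t
    after : ∀ {i v} → t < v → D i ≡ v → D′ i ≡ v
    after {i} {v} t<v Di = swap-injective p t (trans Di (sym (swap-other (>⇒≢ (<-trans p<t t<v)) (>⇒≢ t<v))))
    ban : ∀ k → fb ≡ just (toℕ k) → D (at s k) ≢ t
    ban k fb≡ eq with punchIn-view j k
    ... | inj₁ refl        = allowed-≢ al (trans fb≡ (cong just j≡))
    ... | inj₂ (k′ , refl) = >⇒≢ (permute-last-other s j w k′) eq
    short′ : ∀ i → t ≤ i → D i ≢ suc i
    short′ i t≤i eq with m≤n⇒m<n∨m≡n t≤i
    ... | inj₁ t<i  = no-short irr i t<i (after (m<n⇒m<1+n t<i) eq)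
    ... | inj₂ refl = <⇒≢ (<-trans p<t ≤-refl) (trans (sym (permute-last-t s j w)) eq)
    par : ∀ {i l} → t ≤ l → i < l → D i ≡ suc l → D l ≢ suc i
    par {i} {l} t≤l i<l Di Dl with m≤n⇒m<n∨m≡n t≤l
    ... | inj₁ t<l = no-parallel irr t<l i<l (after (m<n⇒m<1+n t<l) Di)
        (swap-injective p t (trans Dl (sym (swap-other i≢p i≢t))))
      where
      i≢p : suc i ≢ p
      i≢p eq = >⇒≢ t<l (permute-inj s′ w (trans (swap-injective p t (trans (trans Dl eq) (sym (swap-right p t)))) (sym D′t)))
      i≢t : suc i ≢ t
      i≢t eq = >⇒≢ (<-trans p<t t<l) (permute-inj s′ w (trans (swap-injective p t (trans (trans Dl eq) (sym (swap-left p t)))) (sym D′p)))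
    ... | inj₂ refl = go (Fin.any? λ k → at s k ≟ i)
      where
      p≡1+i : p ≡ suc i
      p≡1+i = trans (sym (permute-last-t s j w)) Dl
      go : Dec (∃ λ k → at s k ≡ i) → _
      go (no i∉) = <⇒≢ (<-trans i<l ≤-refl) (trans (sym (permute-fix s (last j w) i<l λ k eq → i∉ (k , eq))) Di)
      go (yes (k , refl)) with adjacent fl j k p≡1+i | punchIn-view j k
      ... | k≡ , flag | inj₁ refl = <⇒≢ ≤-refl k≡
      ... | k≡ , flag | inj₂ (k′ , refl) = banned irr k′ (trans fb≡ (cong just (sym k′≡))) (after ≤-refl Di)
        where
        k′≡ : toℕ k′ ≡ length xs
        k′≡ with toℕ k′ <? toℕ j
        ... | yes k′<j = contradiction (trans (sym (toℕ-punchIn-< j k′ k′<j)) k≡) (<⇒≢ (m<n⇒m<1+n k′<j))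
        ... | no k′≮j = trans (suc-injective (trans (sym (toℕ-punchIn-≥ j k′ (≮⇒≥ k′≮j))) k≡)) j≡
        fb≡ : forbid xs ys ≡ just (length xs)
        fb≡ = cong (if_then just (length xs) else nothing) (trans (sym (flagAt-top xs {f} {ys}))
          (trans (cong (flagAt (xs ++ f ∷ ys)) (sym (trans k≡ (cong suc j≡)))) flag))

  length-lower : ∀ xs f (ys : List Bool) → length (xs ++ f ∷ ys) ≡ suc (length (xs ++ lower ys))
  length-lower []       f []       = refl
  length-lower []       f (_ ∷ ys) = refl
  length-lower (x ∷ xs) f ys       = cong suc (length-lower xs f ys)

  length-push : ∀ μ fs → length (push μ fs) ≡ suc (length fs)
  length-push initial fs       = refl
  length-push opened  []       = refl
  length-push opened  (_ ∷ fs) = refl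
  length-push closed  fs       = refl

  -- Each letter becomes a point of its own, and only the steps `first` and `last` occur. From the
  -- empty stack all blocks are pairs, and the permutation is a matching.
  primitive⇒path : ∀ {t h} (s : Stack t h) {fs μ fb w} → length fs ≡ h → Flagged s fs μ → Primitive fs μ fb w →
    Σ[ path ∈ Path h (length w) ] (chordWord path ≡ w × Irreducible t s fb (permute s path))
  primitive⇒path s refl fl ending = end , refl , record
    { banned = λ () ; no-short = λ i _ → <⇒≢ ≤-refl ; no-parallel = λ _ i<j Di _ → <⇒≢ (m<n⇒m<1+n i<j) Di }
  primitive⇒path s {fs} {μ} refl fl (opening pr) with primitive⇒path (add s) (length-push μ fs) (flagged-push {fs = fs} refl fl) pr
  ... | path , eq , irr = first path , cong (O ∷_) eq , irreducible-first path irr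
  primitive⇒path {t} {h} s len fl (closing xs f ys al pr) = go h len s fl
    where
    go : ∀ h (len : length (xs ++ f ∷ ys) ≡ h) (s : Stack t h) → Flagged s (xs ++ f ∷ ys) _ →
      Σ[ path ∈ Path h _ ] (chordWord path ≡ _ × Irreducible t s _ (permute s path))
    go zero    len s fl with () ← trans (sym len) (length-lower xs f ys)
    go (suc h) len s fl with primitive⇒path (skip (drop j s)) (suc-injective (trans (sym (length-lower xs f ys)) len))
                                (flagged-drop j j≡ fl) pr
      where
      j< : length xs < suc h
      j< = subst (length xs <_) len (subst (length xs <_) (sym (length-++ xs)) (m<m+n _ (s≤s z≤n)))
      j : Fin (suc h)
      j = fromℕ< j<
      j≡ : toℕ j ≡ length xs
      j≡ = Fin.toℕ-fromℕ< j<
    ... | path , eq , irr = last _ path , cong₂ (λ k v → C k ∷ v) (Fin.toℕ-fromℕ< _) eq ,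
      irreducible-last _ path {xs = xs} {f} {ys} (Fin.toℕ-fromℕ< _) fl al irr

  primitive-length : ∀ {fs μ fb w} → Primitive fs μ fb w → length w ≡ 2 * chords w + length fs
  primitive-length ending = refl
  primitive-length {fs} {μ} {w = O ∷ w} (opening pr) = begin
    suc (length w)                              ≡⟨ cong suc (primitive-length pr) ⟩
    suc (2 * chords w + length (push μ fs))     ≡⟨ cong (λ l → suc (2 * chords w + l)) (length-push μ fs) ⟩
    suc (2 * chords w + suc (length fs))        ≡⟨ cong suc (+-suc (2 * chords w) (length fs)) ⟩
    suc (suc (2 * chords w)) + length fs        ≡⟨ cong (_+ length fs) (*-suc 2 (chords w)) ⟨
    2 * suc (chords w) + length fs              ∎
    where open ≡-Reasoning
  primitive-length {w = C _ ∷ w} (closing xs f ys al pr) = begin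
    suc (length w)                                   ≡⟨ cong suc (primitive-length pr) ⟩
    suc (2 * chords w + length (xs ++ lower ys))     ≡⟨ +-suc (2 * chords w) _ ⟨
    2 * chords w + suc (length (xs ++ lower ys))     ≡⟨ cong (2 * chords w +_) (length-lower xs f ys) ⟨
    2 * chords w + length (xs ++ f ∷ ys)             ∎
    where open ≡-Reasoning

-- A bound for the length of primitive words of given genus

module LengthBound where

  open import Data.Bool.Base using (true)
  open import Data.Fin.Base as Fin using (Fin; zero; suc; toℕ; fromℕ)
  import Data.Fin.Properties as Fin
  open import Data.Fin.Permutation using (Permutation′; _⟨$⟩ʳ_; inverseʳ; _∘ₚ_; flip)
  open import Data.Fin.Subset using (Subset)
  open import Data.List.Base using (List; []; _∷_; map; concatMap; filter; length; tabulate; allFin)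
  open import Data.List.Properties using (map-tabulate; length-tabulate)
  open import Data.List.Membership.Propositional using (_∈_; find)
  open import Data.List.Membership.Propositional.Properties using (∈-map⁻; ∈-concatMap⁻; ∈-allFin; ∈-filter⁺; ∈-filter⁻; ∈-deduplicate⁻; ∈-tabulate⁻)
  open import Data.List.Relation.Unary.Any using (here; there)
  open import Data.List.Relation.Unary.All using ([]; _∷_)
  open import Data.List.Relation.Unary.AllPairs using ([]; _∷_)
  open import Data.List.Relation.Unary.Unique.Propositional using (Unique)
  import Data.List.Relation.Unary.Unique.Propositional.Properties as Unique
  open import Data.List.Relation.Unary.Unique.DecPropositional.Properties using (deduplicate-!)
  open import Data.Maybe.Base using (nothing)
  open import Data.Nat.Base
  open import Data.Nat.Properties
  open import Data.Product.Base using (_×_; _,_; proj₁; proj₂)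
  open import Function.Base using (id)
  open import Relation.Binary.Definitions using (tri<; tri≈; tri>)
  open import Relation.Binary.PropositionalEquality
  open import Relation.Nullary using (Dec; yes; no; contradiction)
  open import Relation.Nullary.Decidable using (¬?)
  open import Defs using (orbit; z; ζ; _≟ˢ_)
  open ChordWords
  open GenusOfWords
  open BlockPaths
  open Counting
  open Orbits
  open Partitions
  open Colourings
  open PathCount
  open Irreducibility

  module _ {n} (β : Permutation′ n) (e : Fin n)
    (no-fixed : ∀ i → i ≢ e → β ⟨$⟩ʳ i ≢ i)
    (no-2-cycle : ∀ i → i ≢ e → β ⟨$⟩ʳ i ≢ e → β ⟨$⟩ʳ (β ⟨$⟩ʳ i) ≢ i) where

    private
      keys′ : List (Subset n)
      keys′ = Keys.keys _≟ˢ_ (orbit β)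

      others : List (Subset n)
      others = filter (λ o → ¬? (o ≟ˢ orbit β e)) keys′

      others-! : Unique others
      others-! = Unique.filter⁺ (λ o → ¬? (o ≟ˢ orbit β e)) (deduplicate-! _≟ˢ_ (tabulate (orbit β)))

      length-keys : length keys′ ≤ suc (length others)
      length-keys = length-≤ {_~_ = _≡_} _≡_ keys′ (orbit β e ∷ others) (deduplicate-! _≟ˢ_ (tabulate (orbit β)))
        (λ {o} o∈ → o , place o∈ (o ≟ˢ orbit β e) , refl) λ { _ _ refl refl → refl }
        where
        place : ∀ {o} → o ∈ keys′ → Dec (o ≡ orbit β e) → o ∈ orbit β e ∷ others
        place o∈ (yes refl) = here refl
        place o∈ (no o≢)    = there (∈-filter⁺ (λ o → ¬? (o ≟ˢ orbit β e)) o∈ o≢)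

      member : Subset n → Fin n
      member o with Fin.any? (λ r → orbit β r ≟ˢ o)
      ... | yes (r , _) = r
      ... | no _        = e

      orbit-member : ∀ {o} → o ∈ others → orbit β (member o) ≡ o
      orbit-member {o} o∈ with Fin.any? (λ r → orbit β r ≟ˢ o)
      ... | yes (r , eq) = eq
      ... | no ∄         = contradiction (let r , eq = ∈-tabulate⁻ {f = orbit β} (∈-deduplicate⁻ _≟ˢ_ _ o∈keys) in r , sym eq) ∄
        where
        o∈keys : o ∈ keys′
        o∈keys = proj₁ (∈-filter⁻ (λ o → ¬? (o ≟ˢ orbit β e)) {xs = keys′} o∈)

      orbit-power : ∀ i k → orbit β (power β i k) ≡ orbit β i
      orbit-power i zero    = refl
      orbit-power i (suc k) = trans (orbit-a β (power β i k)) (orbit-power i k)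

      labels : List (Subset n × Fin 3)
      labels = concatMap (λ o → map (o ,_) (allFin 3)) others

      labels-! : Unique labels
      labels-! = concatMap-! (λ o → map (o ,_) (allFin 3)) (λ o → Unique.map⁺ {f = o ,_} (cong proj₂) (Unique.allFin⁺ 3))
        (λ {o} {o′} x∈ x∈′ → trans (sym (cong proj₁ (proj₂ (proj₂ (∈-map⁻ (o ,_) x∈)))))
          (cong proj₁ (proj₂ (proj₂ (∈-map⁻ (o′ ,_) x∈′)))))
        others-!

      length-labels : ∀ os → length (concatMap (λ (o : Subset n) → map (o ,_) (allFin 3)) os) ≡ length os * 3
      length-labels []       = refl
      length-labels (o ∷ os) = cong (3 +_) (length-labels os)

      labels⁻ : ∀ {o k} → (o , k) ∈ labels → o ∈ others
      labels⁻ ok∈ with find (∈-concatMap⁻ (λ o → map (o ,_) (allFin 3)) {xs = others} ok∈)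
      ... | o , o∈ , ok∈′ with ∈-map⁻ (o ,_) ok∈′
      ...   | _ , _ , refl = o∈

      point : Subset n × Fin 3 → Fin n
      point (o , k) = power β (member o) (toℕ k)

      orbit-point : ∀ {o k} → (o , k) ∈ labels → orbit β (point (o , k)) ≡ o
      orbit-point {o} {k} ok∈ = trans (orbit-power (member o) (toℕ k)) (orbit-member (labels⁻ ok∈))

      ≢e : ∀ {o} → o ∈ others → ∀ k → power β (member o) k ≢ e
      ≢e {o} o∈ k eq = proj₂ (∈-filter⁻ (λ o → ¬? (o ≟ˢ orbit β e)) {xs = keys′} o∈)
        (trans (sym (trans (orbit-power (member o) k) (orbit-member o∈))) (cong (orbit β) eq))

      distinct : ∀ {o} → o ∈ others → ∀ k l → power β (member o) (toℕ {3} k) ≡ power β (member o) (toℕ {3} l) → k ≡ l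
      distinct {o} o∈ zero zero _ = refl
      distinct {o} o∈ zero (suc zero) eq = contradiction (sym eq) (no-fixed _ (≢e o∈ 0))
      distinct {o} o∈ zero (suc (suc zero)) eq = contradiction (sym eq) (no-2-cycle _ (≢e o∈ 0) (≢e o∈ 1))
      distinct {o} o∈ (suc zero) zero eq = contradiction eq (no-fixed _ (≢e o∈ 0))
      distinct {o} o∈ (suc zero) (suc zero) _ = refl
      distinct {o} o∈ (suc zero) (suc (suc zero)) eq = contradiction (sym eq) (no-fixed _ (≢e o∈ 1))
      distinct {o} o∈ (suc (suc zero)) zero eq = contradiction eq (no-2-cycle _ (≢e o∈ 0) (≢e o∈ 1))
      distinct {o} o∈ (suc (suc zero)) (suc zero) eq = contradiction eq (no-fixed _ (≢e o∈ 1))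
      distinct {o} o∈ (suc (suc zero)) (suc (suc zero)) _ = refl

    -- Every cycle that avoids `e` contains three different points `r`, `β r` and `β (β r)`, and
    -- cycles are disjoint. The cycle of `e` may be shorter and accounts for the additional 3.
    z-bound : z β * 3 ≤ n + 3
    z-bound = begin
      z β * 3                     ≡⟨ cong (λ os → length (Data.List.Base.deduplicate _≟ˢ_ os) * 3) (map-tabulate id (orbit β)) ⟩
      length keys′ * 3            ≤⟨ *-monoˡ-≤ 3 length-keys ⟩
      3 + length others * 3       ≡⟨ cong (3 +_) (length-labels others) ⟨
      3 + length labels           ≤⟨ +-monoʳ-≤ 3 (length-≤ {_~_ = _≡_} (λ ok i → point ok ≡ i) labels (allFin n) labels-!
                                       (λ {ok} _ → point ok , ∈-allFin _ , refl) injective) ⟩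
      3 + length (allFin n)       ≡⟨ cong (3 +_) (length-tabulate id) ⟩
      3 + n                       ≡⟨ +-comm 3 n ⟩
      n + 3                       ∎
      where
      open ≤-Reasoning
      injective : ∀ {ok ok′ i} → ok ∈ labels → ok′ ∈ labels → point ok ≡ i → point ok′ ≡ i → ok ≡ ok′
      injective {o , k} {o′ , k′} ok∈ ok∈′ eq eq′
        with trans (sym (orbit-point ok∈)) (trans (cong (orbit β) (trans eq (sym eq′))) (orbit-point ok∈′))
      ... | refl = cong (o ,_) (distinct (labels⁻ ok∈) k k′ (trans eq (sym eq′)))

  private
    -- Away from the last point, where `ζ` wraps around, `β i = j` means `α j = i + 1`. A fixed
    -- point of `β` would be a chord between neighbours, and a cycle of length two would be a pair
    -- of parallel chords.
    irreducible⇒bound : ∀ {m} (w : Path 0 (suc m)) → Irreducible 0 empty nothing (permute empty w) →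
      z (ζ ∘ₚ flip (toPermutation w)) * 3 ≤ suc m + 3
    irreducible⇒bound {m} w irr = z-bound β (fromℕ m) fixed 2-cycle
      where
      open Irreducible
      α = toPermutation w
      β = ζ ∘ₚ flip α
      f = permute empty w
      image : ∀ {i j} → i ≢ fromℕ m → β ⟨$⟩ʳ i ≡ j → f (toℕ j) ≡ suc (toℕ i)
      image {i} {j} i≢ eq = trans (sym (toPermutation-represents w j)) (trans
        (cong toℕ (trans (cong (α ⟨$⟩ʳ_) (sym eq)) (inverseʳ α))) (ζ-suc i≢))
      fixed : ∀ i → i ≢ fromℕ m → β ⟨$⟩ʳ i ≢ i
      fixed i i≢ eq = no-short irr (toℕ i) z≤n (image i≢ eq)
      2-cycle : ∀ i → i ≢ fromℕ m → β ⟨$⟩ʳ i ≢ fromℕ m → β ⟨$⟩ʳ (β ⟨$⟩ʳ i) ≢ i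
      2-cycle i i≢ j≢ eq with <-cmp (toℕ i) (toℕ (β ⟨$⟩ʳ i))
      ... | tri< i<j _ _ = no-parallel irr z≤n i<j (image j≢ eq) (image i≢ refl)
      ... | tri≈ _ i≡j _ = fixed i i≢ (sym (Fin.toℕ-injective i≡j))
      ... | tri> _ _ j<i = no-parallel irr z≤n j<i (image i≢ refl) (image j≢ eq)

  -- For `c` chords on `2c` points, `zβ + 2g = c + 1` and `3 zβ ≤ 2c + 3` yield `c ≤ 6g`. The number
  -- of letters is `2c`.
  primitive-bound : ∀ g {w} → Primitive [] initial nothing w → genus g w ≡ true → length w ≤ 12 * g
  primitive-bound g {[]}        pr gen = z≤n
  primitive-bound g {w@(_ ∷ _)} pr gen with primitive⇒path empty refl (record { adjacent = λ () ; latest = λ () }) pr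
  ... | path , eq , irr = begin
    length w         ≡⟨ primitive-length pr ⟩
    2 * c + 0        ≡⟨ +-identityʳ (2 * c) ⟩
    2 * c            ≤⟨ *-monoʳ-≤ 2 c≤6g ⟩
    2 * (6 * g)      ≡⟨ *-assoc 2 6 g ⟨
    12 * g           ∎
    where
    open ≤-Reasoning
    c = chords w
    α = toPermutation path
    zβ = z (ζ ∘ₚ flip α)
    euler : zβ + 2 * g ≡ suc c
    euler = 2^-injective (trans (^-distribˡ-+-* 2 zβ (2 * g)) (trans (cong₂ _*_
      (trans (sym (colourings-z {α = α} path (toPermutation-represents path))) (cong colourings eq))
      (sym (^-*-assoc 2 2 g))) (≡ᵇ-true⁻ gen)))
    c≤6g : c ≤ 6 * g
    c≤6g = +-cancelˡ-≤ (2 * c + 3) _ _ (begin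
      2 * c + 3 + c                    ≡⟨ solve 1 (λ c → con 2 :* c :+ con 3 :+ c := (con 1 :+ c) :* con 3) refl c ⟩
      suc c * 3                        ≡⟨ cong (_* 3) euler ⟨
      (zβ + 2 * g) * 3                 ≡⟨ *-distribʳ-+ 3 zβ (2 * g) ⟩
      zβ * 3 + 2 * g * 3               ≤⟨ +-monoˡ-≤ (2 * g * 3) (irreducible⇒bound path irr) ⟩
      length w + 3 + 2 * g * 3         ≡⟨ cong (λ l → l + 3 + 2 * g * 3) (trans (primitive-length pr) (+-identityʳ (2 * c))) ⟩
      2 * c + 3 + 2 * g * 3            ≡⟨ solve 2 (λ c g → con 2 :* c :+ con 3 :+ con 2 :* g :* con 3 := con 2 :* c :+ con 3 :+ con 6 :* g) refl c g ⟩
      2 * c + 3 + 6 * g                ∎)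
      where open import Data.Nat.Solver using (module +-*-Solver); open +-*-Solver

-- The generating series of the partitions of genus `g`

module GeneratingFunction where

  open import Algebra.Bundles using (CommutativeRing)
  open import Data.Bool.Base using (true; false)
  open import Data.List.Base using (List; [])
  open import Data.Nat.Base using (ℕ; zero; suc; pred; _≤_; _<_; z≤n; s≤s)
  import Data.Nat.Base as ℕ
  import Data.Nat.Properties as ℕ
  open import Data.Maybe.Base using (nothing)
  open import Data.Rational.Base as ℚ using (ℚ; 0ℚ; 1ℚ)
  import Data.Rational.Properties as ℚ
  open import Data.Vec.Base as Vec using ([])
  open import Data.Vec.Relation.Binary.Pointwise.Inductive using ([])
  open import Relation.Binary.PropositionalEquality as ≡ using (_≡_)
  open import Relation.Nullary using (contradiction)
  open import Defs
  open ChordWords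
  open GenusOfWords using (genus; genus-reducible)
  open PathCount using (pathCount; delay; ∑ₙ)
  open LengthBound using (primitive-bound)
  open PrimitiveWords
  open SeriesRing
  open BivariateSeries renaming (x to x𝕊; y to y𝕊)

  private
    module 𝕊 = CommutativeRing 𝕊
  open 𝕊 using (_≈_; 0#; 1#) renaming (Carrier to Seriesℚ; _+_ to _⊕_; _*_ to _⊗_; -_ to ⊝_)

  open Words-in 𝕊 using (∑<; indicator; module Weighted)
  open Weighted o R (R ⊕ 1#) using (J; final; unflagged; J-stable-≥)
  open Polynomials.RationalPolynomials 𝕊 con-hom
  open Narayana x𝕊 y𝕊 R o R-unfold o-unfold

  ℕ→ℚ : ℕ → ℚ
  ℕ→ℚ zero    = 0ℚ
  ℕ→ℚ (suc n) = 1ℚ ℚ.+ ℕ→ℚ n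

  ℕ→ℚ-+ : ∀ m n → ℕ→ℚ (m ℕ.+ n) ≡ ℕ→ℚ m ℚ.+ ℕ→ℚ n
  ℕ→ℚ-+ zero    n = ≡.sym (ℚ.+-identityˡ _)
  ℕ→ℚ-+ (suc m) n = ≡.trans (≡.cong (1ℚ ℚ.+_) (ℕ→ℚ-+ m n)) (≡.sym (ℚ.+-assoc 1ℚ (ℕ→ℚ m) (ℕ→ℚ n)))

  pathSeries : ℕ → Language → Seriesℚ
  pathSeries h φ n k = ℕ→ℚ (pathCount n k h φ)

  x⊗-0 : ∀ f k → (x𝕊 ⊗ f) 0 k ≡ 0ℚ
  x⊗-0 f k = 𝕏𝕐.𝕏-⊛-zero f k

  x⊗-suc : ∀ f n k → (x𝕊 ⊗ f) (suc n) k ≡ f n k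
  x⊗-suc f n k = 𝕏𝕐.𝕏-⊛-suc f n k

  y⊗-0 : ∀ f n → (y𝕊 ⊗ f) n 0 ≡ 0ℚ
  y⊗-0 f n = ≡.trans (𝕏𝕐.scalar-⊛ 𝕐.𝕏 f n 0) (𝕐.𝕏-⊛-zero (f n))

  y⊗-suc : ∀ f n k → (y𝕊 ⊗ f) n (suc k) ≡ f n k
  y⊗-suc f n k = ≡.trans (𝕏𝕐.scalar-⊛ 𝕐.𝕏 f n (suc k)) (𝕐.𝕏-⊛-suc (f n) k)

  module Paths-system = Comparison.System 𝕊 con-hom x𝕊 y𝕊 R S o R-unfold S-* o*S≈x pathSeries
  open Paths-system using (fromStart; fromClosed; A≈fromStart)

  private
    y⊗-delay : ∀ h φ n k → (y𝕊 ⊗ pathSeries h φ) n k ≡ ℕ→ℚ (delay (λ k → pathCount n k h φ) k)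
    y⊗-delay h φ n zero    = y⊗-0 (pathSeries h φ) n
    y⊗-delay h φ n (suc k) = y⊗-suc (pathSeries h φ) n k

    ∑<-0 : ∀ h g k → (∀ j → g j 0 k ≡ 0ℚ) → (∑< h g) 0 k ≡ 0ℚ
    ∑<-0 zero    g k eq = ≡.refl
    ∑<-0 (suc h) g k eq = ≡.trans (≡.cong₂ ℚ._+_ (eq 0) (∑<-0 h (λ j → g (suc j)) k (λ j → eq (suc j)))) (ℚ.+-identityˡ 0ℚ)

    ∑<-ℕ : ∀ h g t n k → (∀ {j} → j < h → g j n k ≡ ℕ→ℚ (t j)) → (∑< h g) n k ≡ ℕ→ℚ (∑ₙ h t)
    ∑<-ℕ zero    g t n k eq = ≡.refl
    ∑<-ℕ (suc h) g t n k eq = ≡.trans (≡.cong₂ ℚ._+_ (eq (s≤s z≤n))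
      (∑<-ℕ h (λ j → g (suc j)) (λ j → t (suc j)) n k λ j<h → eq (s≤s j<h))) (≡.sym (ℕ→ℚ-+ (t 0) _))

    final-0 : ∀ h φ k → ℕ→ℚ (pathCount 0 k h φ) ≡ final (unflagged h) φ 0 k
    final-0 zero φ zero with φ []
    ... | true  = ≡.refl
    ... | false = ≡.refl
    final-0 zero φ (suc k) with φ []
    ... | true  = ≡.refl
    ... | false = ≡.refl
    final-0 (suc h) φ zero    = ≡.refl
    final-0 (suc h) φ (suc k) = ≡.refl

    final-suc : ∀ h φ n k → final (unflagged h) φ (suc n) k ≡ 0ℚ
    final-suc zero φ n k with φ []
    ... | true  = ≡.refl
    ... | false = ≡.refl
    final-suc (suc h) φ n k = ≡.refl

  pathSeries-unfold : ∀ h φ → pathSeries h φ ≈ final (unflagged h) φ ⊕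
    (x𝕊 ⊗ (y𝕊 ⊗ pathSeries h φ) ⊕ (x𝕊 ⊗ pathSeries (suc h) (φ · O) ⊕ ∑< h (λ j → fromClosed (pred h) (φ · C j))))
  pathSeries-unfold h φ zero k = ≡.trans (final-0 h φ k) (≡.sym (≡.trans
    (≡.cong (final (unflagged h) φ 0 k ℚ.+_) (≡.cong₂ ℚ._+_ (x⊗-0 (y𝕊 ⊗ pathSeries h φ) k)
      (≡.cong₂ ℚ._+_ (x⊗-0 (pathSeries (suc h) (φ · O)) k) (∑<-0 h _ k λ j →
        x⊗-0 (y𝕊 ⊗ pathSeries (pred h) (φ · C j) ⊕ pathSeries (suc (pred h)) (φ · C j · O)) k))))
    (ℚ.+-identityʳ _)))
  pathSeries-unfold h φ (suc n) k = begin
    ℕ→ℚ (d ℕ.+ (a ℕ.+ s))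
      ≡⟨ ≡.trans (ℕ→ℚ-+ d (a ℕ.+ s)) (≡.cong (ℕ→ℚ d ℚ.+_) (ℕ→ℚ-+ a s)) ⟩
    ℕ→ℚ d ℚ.+ (ℕ→ℚ a ℚ.+ ℕ→ℚ s)
      ≡⟨ ℚ.+-identityˡ _ ⟨
    0ℚ ℚ.+ (ℕ→ℚ d ℚ.+ (ℕ→ℚ a ℚ.+ ℕ→ℚ s))
      ≡⟨ ≡.cong₂ ℚ._+_ (≡.sym (final-suc h φ n k)) (≡.cong₂ ℚ._+_
           (≡.sym (≡.trans (x⊗-suc (y𝕊 ⊗ pathSeries h φ) n k) (y⊗-delay h φ n k)))
           (≡.cong₂ ℚ._+_ (≡.sym (x⊗-suc (pathSeries (suc h) (φ · O)) n k))
             (≡.sym (∑<-ℕ h (λ j → fromClosed (pred h) (φ · C j)) _ (suc n) k λ {j} j<h → term h j j<h)))) ⟩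
    final (unflagged h) φ (suc n) k ℚ.+ ((x𝕊 ⊗ (y𝕊 ⊗ pathSeries h φ)) (suc n) k ℚ.+
      ((x𝕊 ⊗ pathSeries (suc h) (φ · O)) (suc n) k ℚ.+ (∑< h (λ j → fromClosed (pred h) (φ · C j))) (suc n) k)) ∎
    where
    open ≡.≡-Reasoning
    d = delay (λ k → pathCount n k h φ) k
    a = pathCount n k (suc h) (φ · O)
    s = ∑ₙ h (λ j → pathCount n k h (φ · C j · O) ℕ.+ delay (λ k → pathCount n k (pred h) (φ · C j)) k)
    term : ∀ h j → j < h → fromClosed (pred h) (φ · C j) (suc n) k ≡
      ℕ→ℚ (pathCount n k h (φ · C j · O) ℕ.+ delay (λ k → pathCount n k (pred h) (φ · C j)) k)
    term (suc h) j _ = ≡.trans (x⊗-suc (y𝕊 ⊗ pathSeries h (φ · C j) ⊕ pathSeries (suc h) (φ · C j · O)) n k)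
      (≡.trans (≡.cong (ℚ._+ ℕ→ℚ (pathCount n k (suc h) (φ · C j · O))) (y⊗-delay h (φ · C j) n k))
        (≡.trans (ℚ.+-comm (ℕ→ℚ (delay (λ k → pathCount n k h (φ · C j)) k)) (ℕ→ℚ (pathCount n k (suc h) (φ · C j · O)))) (≡.sym (ℕ→ℚ-+ (pathCount n k (suc h) (φ · C j · O)) _))))

  o-contraction : ∀ {a f f′} → f 𝕏𝕐.≋[ a ] f′ → (o ⊗ f) 𝕏𝕐.≋[ suc a ] (o ⊗ f′)
  o-contraction {a} {f} {f′} f≋f′ {n} n<1+a = 𝕊₁.trans (o⊗ f n) (𝕊₁.trans
    (𝕏𝕐.𝕏-⊛-mod {f = e ⊗ f} {e ⊗ f′} (𝕏𝕐.⊛-cong-mod {f = e} {e} {f} {f′} (λ _ _ → ≡.refl) f≋f′) n<1+a)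
    (𝕊₁.sym (o⊗ f′ n)))
    where
    module 𝕊₁ = CommutativeRing 𝕐.powerSeriesRing
    e = 1# ⊕ o ⊗ (1# ⊕ y𝕊 ⊕ (R ⊕ R))
    o⊗ : ∀ f → o ⊗ f ≈ x𝕊 ⊗ (e ⊗ f)
    o⊗ f = 𝕊.trans (𝕊.*-congʳ {x = f} {o} {x𝕊 ⊗ e} o-unfold) (𝕊.*-assoc x𝕊 e f)

  module System-unfolded = Paths-system.Unfold (λ h φ _ → pathSeries-unfold h φ)

  module Paths-approximation = System-unfolded.Approximation (λ f a h → f 𝕏𝕐.≋[ a ] h)
    (λ f≈h {n} _ → f≈h n)
    (λ f≋h h≋k {n} n<a k → ≡.trans (f≋h n<a k) (h≋k n<a k))
    (λ f g ())
    (λ {a} {f} {f′} {g} {g′} → 𝕏𝕐.⊕-cong-mod {a} {f} {f′} {g} {g′})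
    (λ {a} {f} {f′} g → 𝕏𝕐.⊛-cong-mod {a} {g} {g} {f} {f′} (λ _ _ → ≡.refl))
    (λ f≋ n<a k → ≡.cong ℚ.-_ (f≋ n<a k))
    (λ {a} {f} {f′} → o-contraction {a} {f} {f′})

  -- Each coefficient is computed by a sufficiently long truncation. As no primitive word of genus
  -- `g` has more than `12 g` letters, all of these truncations agree with a single one.
  fromStart-primitive : ∀ g → fromStart 0 (genus g) ≈ J (suc (12 ℕ.* g)) (genus g) [] initial nothing
  fromStart-primitive g n k = ≡.trans
    (Paths-approximation.fromStart-approx N (suc n) 0 (genus g) (genus-reducible g) (ℕ.m≤n+m (suc n ℕ.+ suc n) (suc (12 ℕ.* g))) (ℕ.n<1+n n) k)
    (J-stable-≥ {M = N} {genus g} {[]} {initial} {nothing} (ℕ.m≤m+n _ _) rejects n k)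
    where
    -- Precision `suc n` is needed to see the coefficient `n`, and with no open arc it costs twice
    -- as many letters. The other summand is the common bound, which is one more than `12 g` because
    -- `J` counts the words of fewer letters.
    N = suc (12 ℕ.* g) ℕ.+ (suc n ℕ.+ suc n)
    rejects : ∀ {w} → Primitive [] initial nothing w → suc (12 ℕ.* g) ≤ Data.List.Base.length w → genus g w ≡ false
    rejects {w} pr long with genus g w in eq
    ... | false = ≡.refl
    ... | true  = contradiction (primitive-bound g pr eq) (ℕ.<⇒≱ long)

  -- the empty word is a diagram of genus 0, but the empty partition is not counted
  partitionSeries : ℕ → Seriesℚ
  partitionSeries g = pathSeries 0 (genus g) ⊕ ⊝ indicator (genus g [])

  fractional-partitionSeries : ∀ g → Fractional (partitionSeries g)
  fractional-partitionSeries g = frac-+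
    (frac-resp (𝕊.sym (𝕊.trans (A≈fromStart 0 (genus g)) (𝕊.*-congˡ {x = R ⊕ 1#} (fromStart-primitive g))))
      (frac-* (frac-+ frac-R frac-1) (frac-J (suc (12 ℕ.* g)) (genus g) [] initial nothing)))
    (frac-poly (poly-neg (poly-indicator (genus g []))))
    where
    poly-indicator : ∀ b → Polynomial xy (indicator b)
    poly-indicator true  = poly-1
    poly-indicator false = poly-0

-- Passage to real coefficients, the rational function and the algebraic equation

module RealSeries where

  open import Algebra.Bundles using (CommutativeRing)
  open import Algebra.Bundles.Raw using (RawRing)
  import Algebra.Definitions.RawMonoid as RawMonoidDefs
  open import Data.Bool.Base using (true; false)
  import Data.Fin.Base as Fin
  open import Data.List.Base using (List; []; _∷_; map)
  open import Data.List.Relation.Unary.Any as Any using (Any; here; there)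
  import Data.List.Relation.Unary.Any.Properties as Any
  open import Data.Nat.Base using (ℕ; zero; suc; _∸_; _<_)
  import Data.Nat.Base as ℕ
  import Data.Nat.Properties as ℕ
  open import Data.Product.Base using (_×_; _,_; Σ-syntax)
  open import Data.Rational.Base as ℚ using (ℚ; 0ℚ; 1ℚ)
  import Data.Rational.Properties as ℚ
  open import Data.Vec.Base as Vec using (Vec; []; _∷_)
  open import Data.Vec.Relation.Binary.Pointwise.Inductive using (Pointwise; []; _∷_)
  open import Level as Level using (lift; 0ℓ)
  open import Relation.Binary.PropositionalEquality as ≡ using (_≡_; _≢_)
  open import Relation.Nullary using (¬_)
  open import Defs using (module Series; ℝ; _≃_; fromℚ; ℝ-rawRing; P; p; module ℝ)
  import Defs
  open ChordWords
  open GenusOfWords using (genus)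
  open PathCount using (pathCount; ∑ₙ; p≡pathCount)
  open SeriesRing
  open BivariateSeries renaming (x to x𝕊; y to y𝕊)
  open Polynomials using (Polyℚ; NonzeroPolyℚ; constantPoly; ℚ-rawRing)
  open GeneratingFunction
  open PrimitiveWords using (module Words-in)

  private
    module 𝕊 = CommutativeRing 𝕊
  open 𝕊 using (_≈_; 0#; 1#) renaming (Carrier to Seriesℚ; _+_ to _⊕_; _*_ to _⊗_; -_ to ⊝_)
  open Polynomials.RationalPolynomials 𝕊 con-hom
  open Narayana x𝕊 y𝕊 R o R-unfold o-unfold renaming (S to S𝕊)
  open Words-in 𝕊 using (indicator)

  -- The relation `r ~ q` says that the real number `r` is represented by the rational `q`. Only the
  -- compatibility of the operations with such representations enters; all identities are proved for
  -- the rational series.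
  module Transfer (Real : RawRing 0ℓ 0ℓ)
    (_~_ : RawRing.Carrier Real → ℚ → Set) (ι : ℚ → RawRing.Carrier Real) (ι-~ : ∀ q → ι q ~ q)
    (~-≈ : ∀ {r s q} → r ~ q → s ~ q → RawRing._≈_ Real r s)
    (~-≉ : ∀ {r s q q′} → r ~ q → s ~ q′ → q ≢ q′ → ¬ RawRing._≈_ Real r s)
    (~-+ : ∀ {r s q q′} → r ~ q → s ~ q′ → RawRing._+_ Real r s ~ (q ℚ.+ q′))
    (~-* : ∀ {r s q q′} → r ~ q → s ~ q′ → RawRing._*_ Real r s ~ (q ℚ.* q′))
    (~-neg : ∀ {r q} → r ~ q → RawRing.-_ Real r ~ (ℚ.- q))
    (~-0 : RawRing.0# Real ~ 0ℚ) (~-1 : RawRing.1# Real ~ 1ℚ) where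

    private
      module R = RawRing Real
    open Series Real
    private
      module PS = RawRing PowerSeries-rawRing

    infix 4 _↝_
    record _↝_ (f : PowerSeries) (f′ : Seriesℚ) : Set where
      constructor rational
      field
        coefficient : ∀ m n → f m n ~ f′ m n
    open _↝_

    ↝-resp : ∀ {f f′ f″} → f′ ≈ f″ → f ↝ f′ → f ↝ f″
    ↝-resp {f} eq f↝ = rational λ m n → ≡.subst (f m n ~_) (eq m n) (coefficient f↝ m n)

    ↝-≈ : ∀ {f h f′ h′} → f ↝ f′ → h ↝ h′ → f′ ≈ h′ → f PS.≈ h
    ↝-≈ {f} {h} f↝ h↝ eq m n =
      ~-≈ (coefficient f↝ m n) (≡.subst (h m n ~_) (≡.sym (eq m n)) (coefficient h↝ m n))

    ↝-+ : ∀ {f h f′ h′} → f ↝ f′ → h ↝ h′ → f PS.+ h ↝ f′ ⊕ h′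
    ↝-+ f↝ h↝ = rational λ m n → ~-+ (coefficient f↝ m n) (coefficient h↝ m n)

    ↝-neg : ∀ {f f′} → f ↝ f′ → PS.- f ↝ ⊝ f′
    ↝-neg f↝ = rational λ m n → ~-neg (coefficient f↝ m n)

    private
      inner : ∀ n {F G} → (∀ j → F j ~ G j) → ∑≤ n F ~ 𝕐.∑≤ n G
      inner zero    eq = eq 0
      inner (suc n) eq = ~-+ (inner n eq) (eq (suc n))

      outer : ∀ m n {F G} → (∀ i → F i ~ G i n) → ∑≤ m F ~ 𝕏𝕐.∑≤ m G n
      outer zero    n eq = eq 0
      outer (suc m) n eq = ~-+ (outer m n eq) (eq (suc m))

    ↝-* : ∀ {f h f′ h′} → f ↝ f′ → h ↝ h′ → f PS.* h ↝ f′ ⊗ h′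
    ↝-* {f′ = f′} {h′} f↝ h↝ = rational λ m n →
      outer m n {G = λ i → CommutativeRing._*_ 𝕐.powerSeriesRing (f′ i) (h′ (m ∸ i))} λ i →
        inner n λ j → ~-* (coefficient f↝ i j) (coefficient h↝ (m ∸ i) (n ∸ j))

    ↝-con : ∀ {q} → constant (ι q) ↝ con q
    ↝-con = rational λ { zero zero → ι-~ _ ; zero (suc n) → ~-0 ; (suc m) n → ~-0 }

    ↝-0 : PS.0# ↝ 0#
    ↝-0 = rational λ { zero zero → ~-0 ; zero (suc n) → ~-0 ; (suc m) n → ~-0 }

    ↝-1 : PS.1# ↝ 1#
    ↝-1 = rational λ { zero zero → ~-1 ; zero (suc n) → ~-0 ; (suc m) n → ~-0 }

    ↝-X : X ↝ x𝕊
    ↝-X = rational λ { zero n → ~-0 ; (suc zero) zero → ~-1 ; (suc zero) (suc n) → ~-0 ; (suc (suc m)) n → ~-0 }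

    ↝-Y : Y ↝ y𝕊
    ↝-Y = rational λ { zero zero → ~-0 ; zero (suc zero) → ~-1 ; zero (suc (suc n)) → ~-0 ; (suc m) n → ~-0 }

    realise : Seriesℚ → PowerSeries
    realise f m n = ι (f m n)

    realise-↝ : ∀ f → realise f ↝ f
    realise-↝ f = rational λ m n → ι-~ (f m n)

    embed : ∀ {n} → Polyℚ n → Poly n
    embed {zero}  a = ι a
    embed {suc n} p = map (embed {n}) p

    embed-eval : ∀ {n} (p : Polyℚ n) {vs vs′} → Pointwise _↝_ vs vs′ → evalPoly {n} (embed {n} p) vs ↝ eval {n} p vs′
    embed-eval {zero}  a       []         = ↝-con
    embed-eval {suc n} []      (v↝ ∷ vs↝) = ↝-0
    embed-eval {suc n} (a ∷ p) {v ∷ vs} {v′ ∷ vs′} (v↝ ∷ vs↝) =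
      ↝-+ {evalPoly {n} (embed {n} a) vs} {v PS.* evalPoly {suc n} (embed {suc n} p) (v ∷ vs)}
          {eval {n} a vs′} {v′ ⊗ eval {suc n} p (v′ ∷ vs′)} (embed-eval {n} a vs↝) (↝-* v↝ (embed-eval {suc n} p (v↝ ∷ vs↝)))

    embed-nonzero : ∀ {n} {p : Polyℚ n} → NonzeroPolyℚ {n} p → NonzeroPoly {n} (embed {n} p)
    embed-nonzero {zero} {a} (lift a≢0) = lift (~-≉ (ι-~ a) ~-0 a≢0)
    embed-nonzero {suc n} p≢0        = Any.map⁺ (Any.map (λ {a} → embed-nonzero {n} {a}) p≢0)

    xyS : Vec Seriesℚ 3
    xyS = x𝕊 ∷ y𝕊 ∷ S𝕊 ∷ []

    ↝-xy : Pointwise _↝_ (X ∷ Y ∷ []) xy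
    ↝-xy = ↝-X ∷ ↝-Y ∷ []

    ratFun : ∀ {n} {vs : Vec Seriesℚ n} {a b} → Polynomial vs a → (pb : Polynomial vs b) → ¬ b ≈ 0# → RatFun n
    ratFun {n} pa pb b≉0 = record
      { num = embed {n} (poly pa) ; den = embed {n} (poly pb)
      ; den≢0 = embed-nonzero {n} {poly pb} (poly-nonzero pb b≉0) }

    ↝-poly : ∀ {n} {vs : Vec PowerSeries n} {vs′ a} → Pointwise _↝_ vs vs′ → (pa : Polynomial vs′ a) → evalPoly {n} (embed {n} (poly pa)) vs ↝ a
    ↝-poly {n} {vs} {vs′} {a} vs↝ (polynomial p eq) = ↝-resp {evalPoly {n} (embed {n} p) vs} {eval {n} p vs′} {a} eq (embed-eval {n} p vs↝)

    1ℚ≢0ℚ : 1ℚ ≢ 0ℚ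
    1ℚ≢0ℚ ()

    private
      constant-term-↑ : ∀ f n → f 0 0 ≡ 1ℚ → (f ↑ n) 0 0 ≡ 1ℚ
      constant-term-↑ f zero    eq = ≡.refl
      constant-term-↑ f (suc n) eq = ≡.trans (≡.cong₂ ℚ._*_ eq (constant-term-↑ f n eq)) (ℚ.*-identityˡ 1ℚ)

      leading : ∀ n f → (x𝕊 ↑ n ⊗ f) n 0 ≡ f 0 0
      leading zero    f = 𝕊.*-identityˡ f 0 0
      leading (suc n) f = ≡.trans (𝕊.*-assoc x𝕊 (x𝕊 ↑ n) f (suc n) 0)
        (≡.trans (x⊗-suc (x𝕊 ↑ n ⊗ f) n 0) (leading n f))

      discriminant-00 : discriminant 0 0 ≡ 1ℚ
      discriminant-00 = ≡.refl

      S-00 : S𝕊 0 0 ≡ 1ℚ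
      S-00 = ≡.refl

    -- The discriminant has constant term 1, so the coefficient of the `n`-th power of `x` in the
    -- `n`-th power of `x * discriminant` is 1.
    denominator-↑ : ∀ n → (denominator ↑ n) n 0 ≢ 0ℚ
    denominator-↑ n eq = 1ℚ≢0ℚ (≡.trans (≡.sym (≡.trans (↑-* x𝕊 discriminant n n 0)
      (≡.trans (leading n (discriminant ↑ n)) (constant-term-↑ discriminant n discriminant-00)))) eq)

    ↝-Δ : Δ ↝ discriminant
    ↝-Δ = ↝-+ (↝-* ↝-t ↝-t) (↝-neg (↝-+ ↝-z (↝-+ ↝-z (↝-+ ↝-z (↝-+ ↝-z ↝-0)))))
      where
      ↝-t = ↝-+ (↝-+ ↝-X (↝-* ↝-X ↝-Y)) (↝-neg ↝-1)
      ↝-z = ↝-* (↝-* ↝-X ↝-X) ↝-Y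

    sqrt : IsSqrt Δ (realise S𝕊)
    sqrt = ↝-≈ (↝-* ↝-S ↝-S) ↝-Δ S²≈discriminant , ~-≈ (≡.subst (ι (S𝕊 0 0) ~_) S-00 (ι-~ (S𝕊 0 0))) ~-1
      where
      ↝-S = realise-↝ S𝕊

    -- Fractions are never cancelled, so denominators accumulate in sums and products. Here they all
    -- remain equal to 1, and only numerators have to be followed.
    record Integral (fr : Fraction) (f : Seriesℚ) : Set where
      constructor integral
      field
        top↝    : top fr ↝ f
        bottom↝ : bottom fr ↝ 1#

    integral-+ : ∀ {u v f h} → Integral u f → Integral v h → Integral (u +ᶠ v) (f ⊕ h)
    integral-+ {f = f} {h} (integral t b) (integral t′ b′) = integral
      (↝-resp (𝕊.+-cong {f ⊗ 1#} {f} {h ⊗ 1#} {h} (𝕊.*-identityʳ f) (𝕊.*-identityʳ h)) (↝-+ (↝-* t b′) (↝-* t′ b)))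
      (↝-resp (𝕊.*-identityˡ 1#) (↝-* b b′))

    integral-* : ∀ {u v f h} → Integral u f → Integral v h → Integral (u *ᶠ v) (f ⊗ h)
    integral-* (integral t b) (integral t′ b′) = integral (↝-* t t′) (↝-resp (𝕊.*-identityˡ 1#) (↝-* b b′))

    integral-⌊⌋ : ∀ {f f′} → f ↝ f′ → Integral ⌊ f ⌋ f′
    integral-⌊⌋ f↝ = integral f↝ ↝-1

    polyFun : ∀ {a} → Polynomial xy a → RatFun 2
    polyFun pa = ratFun pa poly-1 (λ 1≈0 → 1ℚ≢0ℚ (1≈0 0 0))

    integral-polyFun : ∀ {a} (pa : Polynomial xy a) → Integral (evalRat (polyFun pa) (X ∷ Y ∷ [])) a
    integral-polyFun pa = integral (↝-poly ↝-xy pa) (↝-poly ↝-xy poly-1)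

    -- Both claims rest on `f D = a + b S` with polynomials `a`, `b` and `D`. Replacing `S` by a
    -- third variable gives `F`, and eliminating `S` gives a quadratic equation for `f` with the
    -- leading coefficient `D * D`.
    transfer : ∀ {f f′ u v} → f ↝ f′ → u ↝ x𝕊 → v ↝ y𝕊 → Fractional f′ →
      Algebraic f
        × (Σ[ F ∈ RatFun 3 ] Σ[ S ∈ PowerSeries ]
            (IsSqrt Δ S × (f ≈⟦ F ⟧ (u ∷ v ∷ S ∷ []))))
    transfer {f} {f′} {u} {v} f↝ u↝ v↝ (fractional m (quadratic {a} {b} pa pb eq)) =
        (coefficients , there (there (here leading≢0)) , root)
      , ratFun num den (λ D≈0 → denominator-↑ m (D≈0 m 0)) , realise S𝕊 , sqrt , (m , 0 , den≄0) , quotient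
      where
      D = denominator ↑ m

      uvS↝ : Pointwise _↝_ (u ∷ v ∷ realise S𝕊 ∷ []) xyS
      uvS↝ = u↝ ∷ v↝ ∷ realise-↝ S𝕊 ∷ []

      pD : Polynomial xy D
      pD = poly-↑ m poly-denominator

      den : Polynomial xyS D
      den = poly-weaken S𝕊 pD

      num : Polynomial xyS (a ⊕ b ⊗ S𝕊)
      num = poly-+ (poly-weaken S𝕊 pa) (poly-* (poly-weaken S𝕊 pb) (poly-var (Fin.suc (Fin.suc Fin.zero))))

      ↝-den : evalPoly {3} (embed {3} (poly den)) (u ∷ v ∷ realise S𝕊 ∷ []) ↝ D
      ↝-den = ↝-poly uvS↝ den

      den≄0 : ¬ evalPoly {3} (embed {3} (poly den)) (u ∷ v ∷ realise S𝕊 ∷ []) m 0 R.≈ R.0#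
      den≄0 = ~-≉ (coefficient ↝-den m 0) ~-0 (denominator-↑ m)

      F-num F-den : PowerSeries
      F-num = evalPoly {3} (embed {3} (poly num)) (u ∷ v ∷ realise S𝕊 ∷ [])
      F-den = evalPoly {3} (embed {3} (poly den)) (u ∷ v ∷ realise S𝕊 ∷ [])

      quotient : f PS.* F-den PS.≈ F-num PS.* PS.1#
      quotient = ↝-≈ {f PS.* F-den} {F-num PS.* PS.1#} {f′ ⊗ D} {(a ⊕ b ⊗ S𝕊) ⊗ 1#}
        (↝-* {f} {F-den} {f′} {D} f↝ ↝-den) (↝-* {F-num} {PS.1#} {a ⊕ b ⊗ S𝕊} {1#} (↝-poly uvS↝ num) ↝-1)
        (𝕊.trans {f′ ⊗ D} {a ⊕ b ⊗ S𝕊} {(a ⊕ b ⊗ S𝕊) ⊗ 1#} eq (𝕊.sym {(a ⊕ b ⊗ S𝕊) ⊗ 1#} {a ⊕ b ⊗ S𝕊} (𝕊.*-identityʳ (a ⊕ b ⊗ S𝕊))))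

      c₀ c₁ c₂ : Seriesℚ
      c₀ = a ⊗ a ⊕ ⊝ (b ⊗ b ⊗ discriminant)
      c₁ = ⊝ (D ⊗ a ⊕ D ⊗ a)
      c₂ = D ⊗ D
      p₀ : Polynomial xy c₀
      p₀ = poly-+ {f = a ⊗ a} {⊝ (b ⊗ b ⊗ discriminant)} (poly-* {f = a} {a} pa pa)
        (poly-neg {f = b ⊗ b ⊗ discriminant} (poly-* {f = b ⊗ b} {discriminant} (poly-* {f = b} {b} pb pb) poly-discriminant))
      p₁ : Polynomial xy c₁
      p₁ = poly-neg {f = D ⊗ a ⊕ D ⊗ a} (poly-+ {f = D ⊗ a} {D ⊗ a} (poly-* {f = D} {a} pD pa) (poly-* {f = D} {a} pD pa))
      p₂ : Polynomial xy c₂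
      p₂ = poly-* {f = D} {D} pD pD

      coefficients : List (RatFun 2)
      coefficients = polyFun p₀ ∷ polyFun p₁ ∷ polyFun p₂ ∷ []

      leading≢0 : NonzeroPoly {2} (RatFun.num (polyFun p₂))
      leading≢0 = embed-nonzero {2} {poly p₂} (poly-nonzero p₂ λ D²≈0 →
        denominator-↑ (m ℕ.+ m) (≡.trans (↑-+ denominator m m (m ℕ.+ m) 0) (D²≈0 (m ℕ.+ m) 0)))

      e₀ e₁ e₂ : Fraction
      e₀ = evalRat (polyFun p₀) (X ∷ Y ∷ [])
      e₁ = evalRat (polyFun p₁) (X ∷ Y ∷ [])
      e₂ = evalRat (polyFun p₂) (X ∷ Y ∷ [])

      times-f : ∀ {u h} → Integral u h → Integral (⌊ f ⌋ *ᶠ u) (f′ ⊗ h)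
      times-f {u} {h} = integral-* {⌊ f ⌋} {u} {f′} {h} (integral-⌊⌋ f↝)

      evaluated : Integral (evalAt coefficients f) (c₀ ⊕ f′ ⊗ (c₁ ⊕ f′ ⊗ (c₂ ⊕ f′ ⊗ 0#)))
      evaluated =
        integral-+ {e₀} {⌊ f ⌋ *ᶠ (e₁ +ᶠ ⌊ f ⌋ *ᶠ (e₂ +ᶠ ⌊ f ⌋ *ᶠ ⌊ PS.0# ⌋))} {c₀} {f′ ⊗ (c₁ ⊕ f′ ⊗ (c₂ ⊕ f′ ⊗ 0#))} (integral-polyFun p₀)
          (times-f {e₁ +ᶠ ⌊ f ⌋ *ᶠ (e₂ +ᶠ ⌊ f ⌋ *ᶠ ⌊ PS.0# ⌋)} {c₁ ⊕ f′ ⊗ (c₂ ⊕ f′ ⊗ 0#)}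
        (integral-+ {e₁} {⌊ f ⌋ *ᶠ (e₂ +ᶠ ⌊ f ⌋ *ᶠ ⌊ PS.0# ⌋)} {c₁} {f′ ⊗ (c₂ ⊕ f′ ⊗ 0#)} (integral-polyFun p₁)
          (times-f {e₂ +ᶠ ⌊ f ⌋ *ᶠ ⌊ PS.0# ⌋} {c₂ ⊕ f′ ⊗ 0#}
        (integral-+ {e₂} {⌊ f ⌋ *ᶠ ⌊ PS.0# ⌋} {c₂} {f′ ⊗ 0#} (integral-polyFun p₂)
          (times-f {⌊ PS.0# ⌋} {0#} (integral-⌊⌋ ↝-0))))))

      value : Seriesℚ
      value = c₀ ⊕ f′ ⊗ (c₁ ⊕ f′ ⊗ (c₂ ⊕ f′ ⊗ 0#))

      value≈0 : value ⊗ 1# ≈ 0# ⊗ 1#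
      value≈0 = 𝕊.*-congʳ {1#} {value} {0#} (quadratic-equation {f′} {D} {a} {b} eq)

      root : evalAt coefficients f ≃ᶠ ⌊ PS.0# ⌋
      root = ↝-≈ {top (evalAt coefficients f) PS.* PS.1#} {PS.0# PS.* bottom (evalAt coefficients f)} {value ⊗ 1#} {0# ⊗ 1#}
        (↝-* {top (evalAt coefficients f)} {PS.1#} {value} {1#} (Integral.top↝ evaluated) ↝-1)
        (↝-* {PS.0#} {bottom (evalAt coefficients f)} {0#} {1#} ↝-0 (Integral.bottom↝ evaluated)) value≈0

  -- All operations on real numbers act termwise, so the class of constant sequences is closed under
  -- them, and equality of terms replaces convergence.
  record IsRational (r : ℝ) (q : ℚ) : Set where
    constructor isRational
    field
      constantly : ∀ n → ℝ.seq r n ≡ q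
  open IsRational

  rational-≃ : ∀ {r s q} → IsRational r q → IsRational s q → r ≃ s
  rational-≃ {q = q} r≡q s≡q ε 0<ε = 0 , λ n _ → ≡.subst (ℚ._< ε)
    (≡.sym (≡.trans (≡.cong₂ (λ a b → ℚ.∣ a ℚ.- b ∣) (constantly r≡q n) (constantly s≡q n)) (≡.cong ℚ.∣_∣ (ℚ.+-inverseʳ q)))) 0<ε

  rational-≄ : ∀ {r s q q′} → IsRational r q → IsRational s q′ → q ≢ q′ → ¬ r ≃ s
  rational-≄ {q = q} {q′} r≡q s≡q′ q≢q′ r≃s =
    -- With the distance itself as tolerance, the distance would have to be smaller than itself.
    let N , near = r≃s ℚ.∣ q ℚ.- q′ ∣ 0<
    in ℚ.<-irrefl (≡.cong₂ (λ a b → ℚ.∣ a ℚ.- b ∣) (constantly r≡q N) (constantly s≡q′ N)) (near N ℕ.≤-refl)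
    where
    0< : 0ℚ ℚ.< ℚ.∣ q ℚ.- q′ ∣
    0< = ℚ.≰⇒> λ ≤0 → q≢q′ (ℚ-difference (ℚ.∣p∣≡0⇒p≡0 (q ℚ.- q′) (ℚ.≤-antisym ≤0 (ℚ.0≤∣p∣ (q ℚ.- q′)))))
      where
      ℚ-difference : q ℚ.- q′ ≡ 0ℚ → q ≡ q′
      ℚ-difference eq = begin
        q                     ≡⟨ ℚ.+-identityʳ q ⟨
        q ℚ.+ 0ℚ              ≡⟨ ≡.cong (q ℚ.+_) (ℚ.+-inverseˡ q′) ⟨
        q ℚ.+ (ℚ.- q′ ℚ.+ q′) ≡⟨ ℚ.+-assoc q (ℚ.- q′) q′ ⟨
        q ℚ.- q′ ℚ.+ q′       ≡⟨ ≡.cong (ℚ._+ q′) eq ⟩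
        0ℚ ℚ.+ q′             ≡⟨ ℚ.+-identityˡ q′ ⟩
        q′                    ∎
        where open ≡.≡-Reasoning

  open Transfer ℝ-rawRing IsRational fromℚ (λ q → isRational λ n → ≡.refl) rational-≃ rational-≄
    (λ r≡q s≡q′ → isRational λ n → ≡.cong₂ ℚ._+_ (constantly r≡q n) (constantly s≡q′ n))
    (λ r≡q s≡q′ → isRational λ n → ≡.cong₂ ℚ._*_ (constantly r≡q n) (constantly s≡q′ n))
    (λ r≡q → isRational λ n → ≡.cong ℚ.-_ (constantly r≡q n))
    (isRational λ n → ≡.refl) (isRational λ n → ≡.refl)

  private
    open ℝ using (seq)
    open RawMonoidDefs (RawRing.+-rawMonoid ℝ-rawRing) using () renaming (_×_ to _·ℝ_)

    -- An open block is completed sooner or later. This is needed because `P` is zero by definition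
    -- where `y` does not occur.
    no-blocks : ∀ n h φ → pathCount n 0 (suc h) φ ≡ 0
    no-blocks zero    h φ = ≡.refl
    no-blocks (suc n) h φ = ≡.cong₂ ℕ._+_ (no-blocks n (suc h) (φ · O)) (sum-0 (suc h) λ j →
      ≡.trans (ℕ.+-identityʳ _) (no-blocks n h (φ · C j · O)))
      where
      sum-0 : ∀ m {t} → (∀ j → t j ≡ 0) → ∑ₙ m t ≡ 0
      sum-0 zero    eq = ≡.refl
      sum-0 (suc m) eq = ≡.cong₂ ℕ._+_ (eq 0) (sum-0 m λ j → eq (suc j))

    indicator-0 : ∀ b n k → indicator b (suc n) k ≡ 0ℚ
    indicator-0 true  n k = ≡.refl
    indicator-0 false n k = ≡.refl

    drop-indicator : ∀ b n k q → q ℚ.+ (⊝ indicator b) (suc n) k ≡ q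
    drop-indicator b n k q = ≡.trans (≡.cong (λ r → q ℚ.+ ℚ.- r) (indicator-0 b n k)) (ℚ.+-identityʳ q)

    seq-multiple : ∀ n k → seq (n ·ℝ fromℚ 1ℚ) k ≡ ℕ→ℚ n
    seq-multiple zero    k = ≡.refl
    seq-multiple (suc n) k = ≡.cong (1ℚ ℚ.+_) (seq-multiple n k)

  partitionSeries-suc : ∀ g n k → partitionSeries g (suc n) k ≡ ℕ→ℚ (pathCount (suc n) k 0 (genus g))
  partitionSeries-suc g n k = drop-indicator (genus g []) n k (ℕ→ℚ (pathCount (suc n) k 0 (genus g)))

  P-rational : ∀ g n k → IsRational (P g n k) (partitionSeries g n k)
  P-rational g n k = isRational (go n k)
    where
    go : ∀ n k i → ℝ.seq (P g n k) i ≡ partitionSeries g n k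
    go zero zero i with genus g []
    ... | true  = ≡.refl
    ... | false = ≡.refl
    go zero (suc k) i with genus g []
    ... | true  = ≡.refl
    ... | false = ≡.refl
    go (suc n) zero i = ≡.sym (≡.trans (partitionSeries-suc g n 0)
      (≡.cong ℕ→ℚ (≡.trans (ℕ.+-identityʳ (pathCount n 0 1 (genus g · O))) (no-blocks n 0 (genus g · O)))))
    go (suc n) (suc k) i = ≡.trans (seq-multiple (p g (suc n) (suc k)) i)
      (≡.trans (≡.cong ℕ→ℚ (p≡pathCount g n (suc k))) (≡.sym (partitionSeries-suc g n (suc k))))

  transferℝ : ∀ {f f′ u v} → f ↝ f′ → u ↝ x𝕊 → v ↝ y𝕊 → Fractional f′ →
    Defs.Algebraic f
      × (Σ[ F ∈ Defs.RatFun 3 ] Σ[ S ∈ Defs.PowerSeries ]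
          (Defs.IsSqrt Defs.Δ S × (f Defs.≈⟦ F ⟧ (u ∷ v ∷ S ∷ []))))
  transferℝ = transfer

  P↝ : ∀ g → P g ↝ partitionSeries g
  P↝ g = rational (P-rational g)

  X↝ : Defs.X ↝ x𝕊
  X↝ = ↝-X

  Y↝ : Defs.Y ↝ y𝕊
  Y↝ = ↝-Y

open import Defs
open import Data.Nat.Base using (ℕ)
open import Data.Product.Base using (_×_; Σ-syntax)
open import Data.Vec.Base using ([]; _∷_)
open GeneratingFunction using (fractional-partitionSeries)
open RealSeries using (transferℝ; P↝; X↝; Y↝)

theorem6p10 : ∀ (g : ℕ) →
    Algebraic (P g)
    × (Σ[ F ∈ RatFun 3 ] Σ[ S ∈ PowerSeries ]
    (IsSqrt Δ S × (P g ≈⟦ F ⟧ (X ∷ Y ∷ S ∷ []))))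
theorem6p10 g = transferℝ (P↝ g) X↝ Y↝ (fractional-partitionSeries g)
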